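{- Let $d>1$ be an odd squarefree integer and $K=\mathbb{Q}(\sqrt{d})$. Then $K$ has a PWR ideal if and only if there exist positive integers $d_1,d_2$ with $d=d_1d_2$, $d_1<d_2\le 3d_1$, such that the equation \[ k^2d_2-\ell^2d_1=\begin{cases}\pm 2 & \text{if } d\equiv 3 \pmod 4,\\ \pm 4 & \text{if } d\equiv 1\pmod 4\end{cases} \] has a solution in integers $k,\ell$ (for some choice of the sign). Moreover, every primitive PWR ideal $I$ of $K$ is of the form $I_1$ or $I_2$ for such a factorization $d=d_1d_2$, where, writing $d_1=p_1\cdots p_r$ and $d_2=q_1\cdots q_s$ for the prime factorizations, and letting $P$, $P_i$, $Q_j$ denote the unique prime ideals of $O_K$ above $2$, $p_i$, $q_j$ respectively, \[ I_1=PP_1\cdots P_r,\quad I_2=PQ_1\cdots Q_s \ \text{ if } d\equiv 3\pmod 4,\qquad I_1=P_1\cdots P_r,\quad I_2=Q_1\cdots Q_s\ \text{ if } d\equiv 1\pmod 4 \] (an empty product being $O_K$). Moreover, the two ideals $I_1$ and $I_2$ are similar.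
   Context: For a real quadratic field $K=\mathbb{Q}(\sqrt d)$ with ring of integers $O_K$, let $\sigma_1,\sigma_2$ be the two real embeddings ($\sigma_{1,2}(x+y\sqrt d)=x\pm y\sqrt d$) and $\Lambda:K\to\mathbb{R}^2$, $\Lambda(\alpha)=(\sigma_1(\alpha),\sigma_2(\alpha))$. For a nonzero ideal $I\subseteq O_K$, $\Lambda(I)$ is a full-rank lattice in $\mathbb{R}^2$. A lattice $L\subset\mathbb{R}^2$ is well-rounded (WR) if its set of nonzero vectors of minimal Euclidean length spans $\mathbb{R}^2$. An ideal $I$ is WR if $\Lambda(I)$ is WR, and PWR (principal well-rounded) if it is principal and WR. An integral ideal is primitive if it is not of the form $mJ$ with $J$ an integral ideal and $m>1$ a rational integer. Two lattices $L_1,L_2$ are similar if $L_2=\gamma UL_1$ for some real $\gamma>0$ and orthogonal $2\times2$ matrix $U$; two ideals are similar if their images under $\Lambda$ are similar lattices. -}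

module Defs where

open import Data.Nat as ℕ using (ℕ; zero; suc)
open import Data.Nat.Divisibility using (_∣_)
open import Data.Integer as ℤ using (ℤ; +_)
open import Data.Rational as ℚ using (ℚ; 0ℚ; 1ℚ)
open import Data.Product using (Σ; ∃; ∃-syntax; _×_; _,_)
open import Data.Sum using (_⊎_)
open import Data.List using (List; []; _∷_; map; _++_)
open import Data.Nat.ListAction using (product)
open import Data.List.Relation.Unary.All using (All)
open import Data.Nat.Primality using (Prime)
open import Data.Bool using (if_then_else_)
open import Relation.Binary.PropositionalEquality using (_≡_)
open import Relation.Nullary using (¬_)

Squarefree : ℕ → Set
Squarefree n = ∀ m → m ℕ.* m ∣ n → m ≡ 1

-- Elements of K = ℚ(√d): x + y√d is represented by the pair (x , y).
-- (Data.Rational's ℚ is normalised, so _≡_ is equality in K.)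

record K : Set where
  constructor _+_√d
  field
    re : ℚ
    im : ℚ
open K public

IsRatInt : ℚ → Set
IsRatInt q = ∃[ z ] q ≡ z ℚ./ 1

module Field (d : ℕ) where

  dℚ : ℚ
  dℚ = (+ d) ℚ./ 1

  infixl 6 _⊕_
  infixl 7 _⊛_

  0K 1K √d : K
  0K = 0ℚ + 0ℚ √d
  1K = 1ℚ + 0ℚ √d
  √d = 0ℚ + 1ℚ √d

  _⊕_ : K → K → K
  (a + b √d) ⊕ (c + e √d) = (a ℚ.+ c) + (b ℚ.+ e) √d

  ⊝_ : K → K
  ⊝ (a + b √d) = (ℚ.- a) + (ℚ.- b) √d

  _⊛_ : K → K → K
  (a + b √d) ⊛ (c + e √d) = (a ℚ.* c ℚ.+ dℚ ℚ.* (b ℚ.* e)) + (a ℚ.* e ℚ.+ b ℚ.* c) √d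

  ι : ℤ → K
  ι m = (m ℚ./ 1) + 0ℚ √d

  tr : K → ℚ
  tr (a + b √d) = a ℚ.+ a

  nm : K → ℚ
  nm (a + b √d) = a ℚ.* a ℚ.- dℚ ℚ.* (b ℚ.* b)

  -- α is an algebraic integer: its characteristic polynomial
  -- X² - tr(α) X + nm(α) has integer coefficients.
  O : K → Set
  O α = IsRatInt (tr α) × IsRatInt (nm α)

  -- Squared Euclidean length of Λ(x + y√d) = (x + y√d , x - y√d):
  -- (x + y√d)² + (x - y√d)² = 2 (x² + d y²).
  ‖_‖² : K → ℚ
  ‖ a + b √d ‖² = (+ 2 ℚ./ 1) ℚ.* (a ℚ.* a ℚ.+ dℚ ℚ.* (b ℚ.* b))

  -- Λ(u), Λ(v) are linearly independent in ℝ² iff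
  -- det(Λ u, Λ v) = 2√d (b c - a e) ≠ 0 for u = a+b√d, v = c+e√d.
  Independent : K → K → Set
  Independent (a + b √d) (c + e √d) = ¬ (a ℚ.* e ≡ b ℚ.* c)

  Subset : Set₁
  Subset = K → Set

  _∈_ : K → Subset → Set
  x ∈ S = S x

  _≈_ : Subset → Subset → Set
  S ≈ T = ∀ x → (x ∈ S → x ∈ T) × (x ∈ T → x ∈ S)

  record IsIdeal (I : Subset) : Set where
    field
      ⊆O      : ∀ x → x ∈ I → O x
      zero∈   : 0K ∈ I
      ⊕-closed : ∀ x y → x ∈ I → y ∈ I → (x ⊕ y) ∈ I
      ⊝-closed : ∀ x → x ∈ I → (⊝ x) ∈ I
      ⊛-closed : ∀ r x → O r → x ∈ I → (r ⊛ x) ∈ I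
      nonzero : ∃[ x ] (x ∈ I × ¬ (x ≡ 0K))

  IsPrincipal : Subset → Set
  IsPrincipal I = ∃[ α ] (∀ x → x ∈ I → ∃[ β ] (O β × x ≡ α ⊛ β))
                       × (∀ β → O β → (α ⊛ β) ∈ I)

  -- well-rounded: the minimal nonzero vectors of Λ(I) span ℝ²,
  -- i.e. there are two linearly independent minimal vectors.
  IsMinimal : Subset → K → Set
  IsMinimal I u = u ∈ I × ¬ (u ≡ 0K) × (∀ w → w ∈ I → ¬ (w ≡ 0K) → ‖ u ‖² ℚ.≤ ‖ w ‖²)

  IsWR : Subset → Set
  IsWR I = ∃[ u ] ∃[ v ] (IsMinimal I u × IsMinimal I v × Independent u v)

  IsPWR : Subset → Set
  IsPWR I = IsIdeal I × IsPrincipal I × IsWR I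

  scale : ℤ → Subset → Subset
  scale m J x = ∃[ y ] (y ∈ J × x ≡ ι m ⊛ y)

  IsPrimitive : Subset → Set₁
  IsPrimitive I = ¬ (∃[ m ] ∃[ J ] (1 ℕ.< m × IsIdeal J × I ≈ scale (+ m) J))

  record IsPrimeIdeal (P : Subset) : Set where
    field
      ideal  : IsIdeal P
      proper : ¬ (1K ∈ P)
      prime  : ∀ a b → O a → O b → (a ⊛ b) ∈ P → a ∈ P ⊎ b ∈ P

  LiesAbove : Subset → ℕ → Set
  LiesAbove P p = IsPrimeIdeal P × ι (+ p) ∈ P

  data SumOfProducts (I J : Subset) : K → Set where
    sp-nil  : SumOfProducts I J 0K
    sp-cons : ∀ {a b s} → a ∈ I → b ∈ J → SumOfProducts I J s
            → SumOfProducts I J ((a ⊛ b) ⊕ s)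

  _·_ : Subset → Subset → Subset
  (I · J) = SumOfProducts I J

  prodIdeals : List Subset → Subset
  prodIdeals []       = O
  prodIdeals (I ∷ Is) = I · prodIdeals Is

  -- similarity: Λ(J) = γ U Λ(I) (γ > 0 real, U orthogonal).  Rendered as a
  -- map φ : I → J onto J, additive, scaling squared lengths by a constant c > 0
  -- (c = γ², necessarily rational).
  Similar : Subset → Subset → Set
  Similar I J = Σ (K → K) λ φ → Σ ℚ λ c → (0ℚ ℚ.< c
      × (∀ x → x ∈ I → φ x ∈ J)
      × (∀ y → y ∈ J → ∃[ x ] (x ∈ I × φ x ≡ y))
      × (∀ x y → x ∈ I → y ∈ I → φ (x ⊕ y) ≡ φ x ⊕ φ y)
      × (∀ x → x ∈ I → ‖ φ x ‖² ≡ c ℚ.* ‖ x ‖²))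

RHS : ℕ → ℕ → Set
RHS d c = (d ℕ.% 4 ≡ 3 × c ≡ 2) ⊎ (d ℕ.% 4 ≡ 1 × c ≡ 4)

EqSolvable : ℕ → ℕ → ℕ → Set
EqSolvable d d₁ d₂ = ∃[ c ] (RHS d c × ∃[ k ] ∃[ ℓ ]
    (  (k ℤ.* k ℤ.* + d₂ ℤ.- ℓ ℤ.* ℓ ℤ.* + d₁ ≡ + c)
     ⊎ (k ℤ.* k ℤ.* + d₂ ℤ.- ℓ ℤ.* ℓ ℤ.* + d₁ ≡ ℤ.- (+ c))))

GoodFactorization : ℕ → ℕ → ℕ → Set
GoodFactorization d d₁ d₂ =
  d₁ ℕ.* d₂ ≡ d × 0 ℕ.< d₁ × d₁ ℕ.< d₂ × d₂ ℕ.≤ 3 ℕ.* d₁ × EqSolvable d d₁ d₂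

PrimeFactorization : List ℕ → ℕ → Set
PrimeFactorization ps n = All Prime ps × product ps ≡ n

module Ideals (d : ℕ) where
  open Field d

  twoPart : (ℕ → Subset) → List Subset
  twoPart 𝔓 = if d ℕ.% 4 ℕ.≡ᵇ 3 then 𝔓 2 ∷ [] else []

  idealOf : (ℕ → Subset) → List ℕ → Subset
  idealOf 𝔓 ps = prodIdeals (twoPart 𝔓 ++ map 𝔓 ps)

{-# OPTIONS --safe #-}
-- Let u and v be independent minimal vectors of the well-rounded ideal I; rounding coordinates
-- shows that they form a ℤ-basis of I.  In this basis multiplication by √d is an integral
-- matrix with trace 0 and determinant -d, symmetric for the length form, and b + c = t d for
-- its off-diagonal entries, where s² + d t² = 4 for an integer s because d is squarefree.  For
-- t = 0 this says v = ±ū.  Otherwise d = 3 and the lattice is hexagonal, and among its six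
-- minimal vectors another pair has t = 0.  So I = ℤu + ℤū with u = n (j + √d) / 2, and
-- √d u ∈ I forces j ∣ d, while minimality of u bounds the ratio of j and i = d / j.  Up to an
-- integer factor I is therefore one explicit lattice L for each j ∣ d, and L is principal
-- exactly if it contains an element whose norm is, up to sign, the index of L; written out,
-- this is the equation j ℓ² - i k² = ±c.
-- The same lattice L consists of the integers whose trace and norm are divisible by n, where
-- n = j or n = 2 j.  Each of the primes above the prime factors of n is of this form, and by
-- Bézout such sets multiply like coprime integers.  Multiplication by √d / j exchanges the
-- lattices of j and i, which makes I₁ and I₂ similar.
module Submission where

open import Defs
open import Data.Nat as ℕ using (ℕ)
open import Data.Integer as ℤ using (ℤ; +_)
open import Relation.Binary.PropositionalEquality using (_≡_; _≢_)

-- Why well-roundedness is so restrictive: read a pair (x , y) as the complex number x + √-d y. Two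
-- vectors u, v of equal length satisfy |u² - v²| = 2 |Im (ū v)|, twice the area of their
-- parallelogram. Dividing by this area gives a point on a circle of radius 2. Integrality of the
-- √d-matrix and squarefreeness of d make the point integral, and the resulting ellipse s² + d t² =
-- 4 has hardly any integer points once d is odd and at least 3. Principality is a determinant: for
-- z in the lattice, z and ω z span the ideal generated by z, so z generates the lattice exactly
-- when the determinant of their coordinates is ±1. The prime ideals are handled without
-- factorization theory. A ramified prime is pinned down by divisibility of trace and norm, which
-- also yields its uniqueness. The obstacle is that such a set is not visibly closed under addition,
-- the norm being quadratic; closure is therefore inherited from the given primes and carried along
-- the induction over the prime factors.

-- Integer arithmetic: rounding, Bézout, rational square roots.

module IntegerArithmetic where
  open import Data.Nat as ℕ using (ℕ; suc; z≤n; s≤s)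
  open import Data.Nat.Properties as ℕ using ()
  open import Data.Nat.Divisibility as ℕ using ()
  import Data.Nat.GCD as ℕ
  import Data.Nat.DivMod as ℕ
  import Data.Nat.Tactic.RingSolver as ℕSolver
  import Data.Nat.Coprimality as Coprimality
  open import Data.Nat.Primality using (Prime; prime⇒irreducible)
  open import Data.Integer
  open import Data.Integer.Properties
  open import Data.Integer.DivMod using (a≡a%ℕn+[a/ℕn]*n; n%ℕd<d; _/ℕ_; _%ℕ_)
  open import Data.Integer.Divisibility.Signed
  open import Data.Integer.Tactic.RingSolver using (solve-∀)
  open import Data.Product using (∃-syntax; _×_; _,_)
  open import Data.Sum using (_⊎_; inj₁; inj₂)
  open import Relation.Binary.PropositionalEquality
  open import Relation.Nullary using (¬_; contradiction)

  -- To derive a ≡ b from hypotheses lᵢ ≡ rᵢ it suffices to write a - b as a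
  -- combination Σ kᵢ (lᵢ - rᵢ), which the ring solver then verifies.
  combine₁ : ∀ {a b l r} k → l ≡ r → a - b ≡ k * (l - r) → a ≡ b
  combine₁ {a} {b} {l} k refl eq = i-j≡0⇒i≡j a b (trans eq (lemma k l))
    where
    lemma : ∀ k l → k * (l - l) ≡ 0ℤ
    lemma = solve-∀

  combine₂ : ∀ {a b l r l′ r′} k k′ → l ≡ r → l′ ≡ r′ →
             a - b ≡ k * (l - r) + k′ * (l′ - r′) → a ≡ b
  combine₂ {a} {b} {l} {l′ = l′} k k′ refl refl eq = i-j≡0⇒i≡j a b (trans eq (lemma k l k′ l′))
    where
    lemma : ∀ k l k′ l′ → k * (l - l) + k′ * (l′ - l′) ≡ 0ℤ
    lemma = solve-∀

  combine₃ : ∀ {a b l r l′ r′ l″ r″} k k′ k″ → l ≡ r → l′ ≡ r′ → l″ ≡ r″ →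
             a - b ≡ k * (l - r) + k′ * (l′ - r′) + k″ * (l″ - r″) → a ≡ b
  combine₃ {a} {b} {l} {l′ = l′} {l″ = l″} k k′ k″ refl refl refl eq =
    i-j≡0⇒i≡j a b (trans eq (lemma k l k′ l′ k″ l″))
    where
    lemma : ∀ k l k′ l′ k″ l″ → k * (l - l) + k′ * (l′ - l′) + k″ * (l″ - l″) ≡ 0ℤ
    lemma = solve-∀

  cancelˡ : ∀ {k a b} → k ≢ 0ℤ → k * a ≡ k * b → a ≡ b
  cancelˡ {k} {a} {b} k≢0 = *-cancelˡ-≡ k a b {{≢-nonZero k≢0}}

  *-≢0 : ∀ {a b} → a ≢ 0ℤ → b ≢ 0ℤ → a * b ≢ 0ℤ
  *-≢0 {a} a≢0 b≢0 ab≡0 with i*j≡0⇒i≡0∨j≡0 a ab≡0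
  ... | inj₁ a≡0 = a≢0 a≡0
  ... | inj₂ b≡0 = b≢0 b≡0

  0≤i² : ∀ i → 0ℤ ≤ i * i
  0≤i² (+ n) = subst (0ℤ ≤_) (pos-* n n) (+≤+ z≤n)
  0≤i² -[1+ n ] = +≤+ z≤n

  0≤i*j : ∀ {i j} → 0ℤ ≤ i → 0ℤ ≤ j → 0ℤ ≤ i * j
  0≤i*j {+ m} {+ n} _ _ = subst (0ℤ ≤_) (pos-* m n) (+≤+ z≤n)

  0<i*j : ∀ {i j} → 0ℤ < i → 0ℤ < j → 0ℤ < i * j
  0<i*j {i} {j} 0<i 0<j = positive⁻¹ (i * j) {{lemma i j 0<i 0<j}}
    where
    lemma : ∀ i j → 0ℤ < i → 0ℤ < j → Positive (i * j)
    lemma +[1+ m ] +[1+ n ] _ _ = _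
    lemma (+ 0) _ (+<+ ()) _
    lemma +[1+ m ] (+ 0) _ (+<+ ())

  0<i² : ∀ {i} → i ≢ 0ℤ → 0ℤ < i * i
  0<i² {+ 0} i≢0 = contradiction refl i≢0
  0<i² {+[1+ n ]} _ = +<+ (s≤s z≤n)
  0<i² { -[1+ n ]} _ = +<+ (s≤s z≤n)

  1≤i² : ∀ {i} → i ≢ 0ℤ → 1ℤ ≤ i * i
  1≤i² i≢0 = i<j⇒suc[i]≤j (0<i² i≢0)

  ≤-by : ∀ {a b} k → 0ℤ ≤ k → b - a ≡ k → a ≤ b
  ≤-by k 0≤k refl = 0≤i-j⇒j≤i 0≤k

  0≤+ : ∀ {i j} → 0ℤ ≤ i → 0ℤ ≤ j → 0ℤ ≤ i + j
  0≤+ = +-mono-≤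

  pos⇒≢0 : ∀ {i} → 0ℤ < i → i ≢ 0ℤ
  pos⇒≢0 0<i refl = i≮i 0<i

  i²≡0⇒i≡0 : ∀ {i} → i * i ≡ 0ℤ → i ≡ 0ℤ
  i²≡0⇒i≡0 {i} eq with i*j≡0⇒i≡0∨j≡0 i eq
  ... | inj₁ p = p
  ... | inj₂ p = p

  i²≡j²⇒i≡±j : ∀ {i j} → i * i ≡ j * j → i ≡ j ⊎ i ≡ - j
  i²≡j²⇒i≡±j {i} {j} eq = choose (i*j≡0⇒i≡0∨j≡0 (i - j) (combine₁ 1ℤ eq (lemma₁ i j)))
    where
    lemma₁ : ∀ i j → (i - j) * (i + j) - 0ℤ ≡ 1ℤ * (i * i - j * j)
    lemma₁ = solve-∀
    lemma₂ : ∀ i j → i - (- j) ≡ 1ℤ * (i + j - 0ℤ)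
    lemma₂ = solve-∀
    choose : i - j ≡ 0ℤ ⊎ i + j ≡ 0ℤ → i ≡ j ⊎ i ≡ - j
    choose (inj₁ p) = inj₁ (i-j≡0⇒i≡j i j p)
    choose (inj₂ p) = inj₂ (combine₁ 1ℤ p (lemma₂ i j))

  parity : ∀ z → (∃[ k ] z ≡ + 2 * k) ⊎ (∃[ k ] z ≡ + 2 * k + 1ℤ)
  parity z with z %ℕ 2 | n%ℕd<d z 2 | a≡a%ℕn+[a/ℕn]*n z 2
  ... | 0 | _ | eq = inj₁ (z /ℕ 2 , trans eq (lemma (z /ℕ 2)))
    where
    lemma : ∀ k → 0ℤ + k * + 2 ≡ + 2 * k
    lemma = solve-∀
  ... | 1 | _ | eq = inj₂ (z /ℕ 2 , trans eq (lemma (z /ℕ 2)))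
    where
    lemma : ∀ k → 1ℤ + k * + 2 ≡ + 2 * k + 1ℤ
    lemma = solve-∀
  ... | suc (suc _) | s≤s (s≤s ()) | _

  unit-square : ∀ k n → k * n ≡ 1ℤ → n * n ≡ 1ℤ
  unit-square k n eq = square n (ℕ.m*n≡1⇒n≡1 (∣ k ∣) (∣ n ∣) (trans (sym (abs-* k n)) (cong ∣_∣ eq)))
    where
    square : ∀ n → ∣ n ∣ ≡ 1 → n * n ≡ 1ℤ
    square (+ 1) refl = refl
    square -[1+ 0 ] refl = refl

  2*i≢1 : ∀ i → + 2 * i ≢ 1ℤ
  2*i≢1 i eq with ℕ.m*n≡1⇒m≡1 2 (∣ i ∣) (trans (sym (abs-* (+ 2) i)) (cong ∣_∣ eq))
  ... | ()

  even≢odd : ∀ k l → + 2 * k ≢ + 2 * l + 1ℤ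
  even≢odd k l eq = 2*i≢1 (k - l) (combine₁ 1ℤ eq (lemma k l))
    where
    lemma : ∀ k l → + 2 * (k - l) - 1ℤ ≡ 1ℤ * (+ 2 * k - (+ 2 * l + 1ℤ))
    lemma = solve-∀

  prime-Bézout : ∀ {p} → Prime p → ∀ n → ¬ (p ℕ.∣ n) → ∃[ a ] ∃[ b ] a * + p + b * + n ≡ 1ℤ
  prime-Bézout {p} p-prime n p∤n = integral (Coprimality.coprime-Bézout coprime)
    where
    coprime : Coprimality.Coprime p n
    coprime (i∣p , i∣n) = one i∣n (prime⇒irreducible p-prime i∣p)
      where
      one : ∀ {i} → i ℕ.∣ n → i ≡ 1 ⊎ i ≡ p → i ≡ 1
      one _ (inj₁ i≡1) = i≡1
      one i∣n (inj₂ refl) = contradiction i∣n p∤n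
    lift : ∀ x y m k → 1 ℕ.+ y ℕ.* m ≡ x ℕ.* k → 1ℤ + + y * + m ≡ + x * + k
    lift x y m k eq = trans (cong (λ z → 1ℤ + z) (sym (pos-* y m))) (trans (cong +_ eq) (pos-* x k))
    integral : ℕ.Bézout.Identity 1 p n → ∃[ a ] ∃[ b ] a * + p + b * + n ≡ 1ℤ
    integral (ℕ.Bézout.+- x y eq) = + x , - + y , combine₁ -1ℤ (lift x y n p eq) (lemma (+ x) (+ y) (+ n) (+ p))
      where
      lemma : ∀ x y n p → x * p + - y * n - 1ℤ ≡ -1ℤ * (1ℤ + y * n - x * p)
      lemma = solve-∀
    integral (ℕ.Bézout.-+ x y eq) = - + x , + y , combine₁ -1ℤ (lift y x p n eq) (lemma (+ x) (+ y) (+ n) (+ p))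
      where
      lemma : ∀ x y n p → - x * p + y * n - 1ℤ ≡ -1ℤ * (1ℤ + x * p - y * n)
      lemma = solve-∀

  -- Rounding to the nearest integer is the floor of a / n + 1/2 for n = |b|, that is, the quotient
  -- of 2 a + n by 2 n. The remainder `s` lies between 0 and 2 n and 2 r = s - n, hence |2 r| ≤ n;
  -- squaring the bound removes the sign of b.
  nearest : ∀ a b → b ≢ 0ℤ → ∃[ q ] ∃[ r ] (a ≡ q * b + r × + 4 * (r * r) ≤ b * b)
  nearest a b b≢0 = result (+∣i∣≡i⊎+∣i∣≡-i b)
    where
    n : ℕ
    n = ∣ b ∣
    instance
      2n≢0 : ℕ.NonZero (n ℕ.+ n)
      2n≢0 = ℕ.>-nonZero (ℕ.+-mono-≤ {1} {n} {0} (ℕ.n≢0⇒n>0 λ n≡0 → b≢0 (∣i∣≡0⇒i≡0 n≡0)) z≤n)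
    t q s : ℤ
    t = + 2 * a + + n
    q = t /ℕ (n ℕ.+ n)
    s = + (t %ℕ (n ℕ.+ n))
    s≤2n : 0ℤ ≤ + n + + n - s
    s≤2n = i≤j⇒0≤j-i (+≤+ (ℕ.<⇒≤ (n%ℕd<d t (n ℕ.+ n))))
    t≡s+2nq : t ≡ s + q * (+ n + + n)
    t≡s+2nq = a≡a%ℕn+[a/ℕn]*n t (n ℕ.+ n)
    bound : ∀ r → a ≡ q * + n + r → + 4 * (r * r) ≤ + n * + n
    bound r eq = ≤-by (s * (+ n + + n - s)) (0≤i*j {s} (+≤+ z≤n) s≤2n)
      (combine₁ (+ n - s - + 2 * r) 2r≡s-n (lemma₂ r s (+ n)))
      where
      lemma₁ : ∀ a n s q r → + 2 * r - (s - n) ≡ + 1 * (+ 2 * a + n - (s + q * (n + n))) + (- + 2) * (a - (q * n + r))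
      lemma₁ = solve-∀
      2r≡s-n : + 2 * r ≡ s - + n
      2r≡s-n = combine₂ 1ℤ (- + 2) t≡s+2nq eq (lemma₁ a (+ n) s q r)
      lemma₂ : ∀ r s n → n * n - + 4 * (r * r) - s * (n + n - s) ≡ (n - s - + 2 * r) * (+ 2 * r - (s - n))
      lemma₂ = solve-∀
    result : + n ≡ b ⊎ + n ≡ - b → ∃[ q ] ∃[ r ] (a ≡ q * b + r × + 4 * (r * r) ≤ b * b)
    result (inj₁ n≡b) = q , a - q * + n , trans (lemma a q (+ n)) (cong (λ z → q * z + (a - q * + n)) n≡b)
                      , subst (+ 4 * ((a - q * + n) * (a - q * + n)) ≤_) (cong₂ _*_ n≡b n≡b) (bound (a - q * + n) (lemma a q (+ n)))
      where
      lemma : ∀ a q n → a ≡ q * n + (a - q * n)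
      lemma = solve-∀
    result (inj₂ n≡-b) = - q , a - q * + n , trans (lemma′ a q (+ n)) (cong (λ z → - q * z + (a - q * + n)) (trans (cong -_ n≡-b) (neg-involutive b)))
                      , subst (+ 4 * ((a - q * + n) * (a - q * + n)) ≤_) (trans (cong₂ _*_ n≡-b n≡-b) (square-neg b)) (bound (a - q * + n) (lemma a q (+ n)))
      where
      lemma : ∀ a q n → a ≡ q * n + (a - q * n)
      lemma = solve-∀
      lemma′ : ∀ a q n → a ≡ - q * - n + (a - q * n)
      lemma′ = solve-∀
      square-neg : ∀ b → - b * - b ≡ b * b
      square-neg = solve-∀

  -- Division by the gcd gives coprime `p′`, `q′` with d p′² = n q′², so q′² ∣ d and `q′` is 1. The
  -- divisibility takes two rounds: first q′ ∣ d, then, after cancelling one `q′`, also q′ ∣ d / q′.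
  rootℕ : ∀ {d} → Squarefree d → ∀ p q n → q ≢ 0 → d ℕ.* (p ℕ.* p) ≡ n ℕ.* (q ℕ.* q) → q ℕ.∣ p
  rootℕ {d} sf p q n q≢0 eq = subst (ℕ._∣ p) q≡g (ℕ.gcd[m,n]∣m p q)
    where
    g : ℕ
    g = ℕ.gcd p q
    instance
      g≢0 : ℕ.NonZero g
      g≢0 = ℕ.≢-nonZero (ℕ.gcd[m,n]≢0 p q (inj₂ q≢0))
    p′ q′ : ℕ
    p′ = p ℕ./ g
    q′ = q ℕ./ g
    coprime : Coprimality.Coprime q′ p′
    coprime = Coprimality.sym (Coprimality.coprime-/gcd p q)
    p≡ : p ≡ p′ ℕ.* g
    p≡ = sym (ℕ.m/n*n≡m (ℕ.gcd[m,n]∣m p q))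
    q≡ : q ≡ q′ ℕ.* g
    q≡ = sym (ℕ.m/n*n≡m (ℕ.gcd[m,n]∣n p q))
    swap : ∀ a b c → a ℕ.* (b ℕ.* c ℕ.* (b ℕ.* c)) ≡ b ℕ.* (b ℕ.* a) ℕ.* (c ℕ.* c)
    swap = ℕSolver.solve-∀
    eq′ : p′ ℕ.* (p′ ℕ.* d) ≡ q′ ℕ.* (q′ ℕ.* n)
    eq′ = ℕ.*-cancelʳ-≡ _ _ (g ℕ.* g) {{ℕ.m*n≢0 g g}}
      (trans (sym (swap d p′ g))
        (trans (subst₂ (λ x y → d ℕ.* (x ℕ.* x) ≡ n ℕ.* (y ℕ.* y)) p≡ q≡ eq) (swap n q′ g)))
    q′∣d : q′ ℕ.∣ d
    q′∣d = Coprimality.coprime-divisor coprime (Coprimality.coprime-divisor coprime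
             (subst (q′ ℕ.∣_) (sym eq′) (ℕ.m∣m*n (q′ ℕ.* n))))
    q′≢0 : ℕ.NonZero q′
    q′≢0 = ℕ.≢-nonZero λ q′≡0 → q≢0 (trans q≡ (cong (ℕ._* g) q′≡0))
    swap′ : ∀ a b c → a ℕ.* (a ℕ.* (b ℕ.* c)) ≡ c ℕ.* (a ℕ.* (a ℕ.* b))
    swap′ = ℕSolver.solve-∀
    k : ℕ
    k = ℕ.quotient q′∣d
    d≡ : d ≡ k ℕ.* q′
    d≡ = ℕ._∣_.equality q′∣d
    q′∣k : q′ ℕ.∣ k
    q′∣k = Coprimality.coprime-divisor coprime (Coprimality.coprime-divisor coprime
      (ℕ.divides n (trans (ℕ.*-cancelˡ-≡ _ _ q′ {{q′≢0}}
        (trans (sym (swap′ p′ k q′)) (trans (cong (λ z → p′ ℕ.* (p′ ℕ.* z)) (sym d≡)) eq′))) (ℕ.*-comm q′ n))))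
    square∣d : q′ ℕ.* q′ ℕ.∣ d
    square∣d = subst (q′ ℕ.* q′ ℕ.∣_) (sym d≡) (ℕ.*-monoˡ-∣ q′ q′∣k)
    q≡g : g ≡ q
    q≡g = sym (trans q≡ (trans (cong (ℕ._* g) (sf q′ square∣d)) (ℕ.*-identityˡ g)))

  abstract
    -- A rational p / q with d (p / q)² an integer is itself an integer when d is squarefree.
    root : ∀ {d} → Squarefree d → ∀ p q n → q ≢ 0ℤ → + d * (p * p) ≡ n * (q * q) → q ∣ p
    root {d} sf p q n q≢0 eq = ∣ᵤ⇒∣ (rootℕ sf (∣ p ∣) (∣ q ∣) (∣ n ∣) (λ z → q≢0 (∣i∣≡0⇒i≡0 z))
      (trans (sym (abs (+ d) p)) (trans (cong ∣_∣ eq) (abs n q))))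
      where
      abs : ∀ i j → ∣ i * (j * j) ∣ ≡ ∣ i ∣ ℕ.* (∣ j ∣ ℕ.* ∣ j ∣)
      abs i j = trans (abs-* i (j * j)) (cong (∣ i ∣ ℕ.*_) (abs-* j j))

-- Half-integer coordinates in the quadratic field.

module Coordinates where
  open import Data.Integer as ℤ using (ℤ; +_; _+_; _*_; _-_; -_; 0ℤ; 1ℤ)
  import Data.Integer.Properties as ℤ
  open import Data.Integer.Divisibility.Signed using (_∣_)
  open import Data.Integer.Tactic.RingSolver using (solve-∀)
  open import Data.Rational as ℚ using (ℚ; 0ℚ; 1ℚ; ½)
  import Data.Rational.Properties as ℚ
  import Data.Rational.Unnormalised as ℚᵘ
  import Data.Rational.Unnormalised.Properties as ℚᵘ
  open import Data.Product using (∃-syntax; _×_; _,_)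
  open import Relation.Binary.PropositionalEquality
  open import Relation.Nullary.Decidable using (dec⇒maybe)
  import Tactic.RingSolver as RingSolver
  import Tactic.RingSolver.Core.AlmostCommutativeRing as ACR
  open IntegerArithmetic

  ℚ-ring : ACR.AlmostCommutativeRing _ _
  ℚ-ring = ACR.fromCommutativeRing ℚ.+-*-commutativeRing (λ x → dec⇒maybe (0ℚ ℚ.≟ x))

  fromℤ : ℤ → ℚ
  fromℤ x = x ℚ./ 1

  private
    toℚᵘ-fromℤ : ∀ x → ℚ.toℚᵘ (fromℤ x) ℚᵘ.≃ ℚᵘ.mkℚᵘ x 0
    toℚᵘ-fromℤ x = ℚ.toℚᵘ-fromℚᵘ (ℚᵘ.mkℚᵘ x 0)

  fromℤ-+ : ∀ x y → fromℤ (x + y) ≡ fromℤ x ℚ.+ fromℤ y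
  fromℤ-+ x y = ℚ.toℚᵘ-injective (ℚᵘ.≃-trans (toℚᵘ-fromℤ (x + y)) (ℚᵘ.≃-trans (ℚᵘ.*≡* (lemma x y))
    (ℚᵘ.≃-sym (ℚᵘ.≃-trans (ℚ.toℚᵘ-homo-+ (fromℤ x) (fromℤ y)) (ℚᵘ.+-cong (toℚᵘ-fromℤ x) (toℚᵘ-fromℤ y))))))
    where
    lemma : ∀ x y → (x + y) * 1ℤ ≡ (x * 1ℤ + y * 1ℤ) * 1ℤ
    lemma = solve-∀

  fromℤ-* : ∀ x y → fromℤ (x * y) ≡ fromℤ x ℚ.* fromℤ y
  fromℤ-* x y = ℚ.toℚᵘ-injective (ℚᵘ.≃-trans (toℚᵘ-fromℤ (x * y))
    (ℚᵘ.≃-sym (ℚᵘ.≃-trans (ℚ.toℚᵘ-homo-* (fromℤ x) (fromℤ y)) (ℚᵘ.*-cong (toℚᵘ-fromℤ x) (toℚᵘ-fromℤ y)))))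

  fromℤ-neg : ∀ x → fromℤ (- x) ≡ ℚ.- fromℤ x
  fromℤ-neg x = ℚ.toℚᵘ-injective (ℚᵘ.≃-trans (toℚᵘ-fromℤ (- x))
    (ℚᵘ.≃-sym (ℚᵘ.≃-trans (ℚ.toℚᵘ-homo‿- (fromℤ x)) (ℚᵘ.-‿cong (toℚᵘ-fromℤ x)))))

  fromℤ-sub : ∀ x y → fromℤ (x - y) ≡ fromℤ x ℚ.- fromℤ y
  fromℤ-sub x y = trans (fromℤ-+ x (- y)) (cong (fromℤ x ℚ.+_) (fromℤ-neg y))

  fromℤ-injective : ∀ {x y} → fromℤ x ≡ fromℤ y → x ≡ y
  fromℤ-injective {x} {y} eq = ℤ.*-cancelʳ-≡ x y 1ℤ
    (ℚᵘ.drop-*≡* (ℚᵘ.≃-trans (ℚᵘ.≃-sym (toℚᵘ-fromℤ x)) (ℚᵘ.≃-trans (ℚᵘ.≃-reflexive (cong ℚ.toℚᵘ eq)) (toℚᵘ-fromℤ y))))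

  fromℤ-mono-≤ : ∀ {x y} → x ℤ.≤ y → fromℤ x ℚ.≤ fromℤ y
  fromℤ-mono-≤ {x} {y} x≤y = ℚ.toℚᵘ-cancel-≤ (ℚᵘ.≤-respˡ-≃ (ℚᵘ.≃-sym (toℚᵘ-fromℤ x))
    (ℚᵘ.≤-respʳ-≃ (ℚᵘ.≃-sym (toℚᵘ-fromℤ y)) (ℚᵘ.*≤* (ℤ.*-monoʳ-≤-nonNeg 1ℤ x≤y))))

  fromℤ-cancel-≤ : ∀ {x y} → fromℤ x ℚ.≤ fromℤ y → x ℤ.≤ y
  fromℤ-cancel-≤ {x} {y} p = ℤ.*-cancelʳ-≤-pos x y 1ℤ (ℚᵘ.drop-*≤* (ℚᵘ.≤-respˡ-≃ (toℚᵘ-fromℤ x)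
    (ℚᵘ.≤-respʳ-≃ (toℚᵘ-fromℤ y) (ℚ.toℚᵘ-mono-≤ p))))

  *-fromℤ-denominator : ∀ p → p ℚ.* fromℤ (ℚ.↧ p) ≡ fromℤ (ℚ.↥ p)
  *-fromℤ-denominator p@(ℚ.mkℚ n m _) = ℚ.toℚᵘ-injective (ℚᵘ.≃-trans (ℚ.toℚᵘ-homo-* p (fromℤ (ℚ.↧ p)))
    (ℚᵘ.≃-trans (ℚᵘ.*-cong (ℚᵘ.≃-refl {ℚ.toℚᵘ p}) (toℚᵘ-fromℤ (ℚ.↧ p)))
    (ℚᵘ.≃-trans (ℚᵘ.*≡* (lemma n (ℚ.↧ p))) (ℚᵘ.≃-sym (toℚᵘ-fromℤ (ℚ.↥ p))))))
    where
    lemma : ∀ n m → n * m * 1ℤ ≡ n * (m * 1ℤ)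
    lemma = solve-∀

  ℚ-cancelʳ : ∀ {p q r} → r ≢ 0ℚ → p ℚ.* r ≡ q ℚ.* r → p ≡ q
  ℚ-cancelʳ {p} {q} {r} r≢0 eq = begin
    p                        ≡⟨ ℚ.*-identityʳ p ⟨
    p ℚ.* 1ℚ                 ≡⟨ cong (p ℚ.*_) (ℚ.*-inverseʳ r) ⟨
    p ℚ.* (r ℚ.* ℚ.1/ r)     ≡⟨ ℚ.*-assoc p r (ℚ.1/ r) ⟨
    p ℚ.* r ℚ.* ℚ.1/ r       ≡⟨ cong (ℚ._* ℚ.1/ r) eq ⟩
    q ℚ.* r ℚ.* ℚ.1/ r       ≡⟨ ℚ.*-assoc q r (ℚ.1/ r) ⟩
    q ℚ.* (r ℚ.* ℚ.1/ r)     ≡⟨ cong (q ℚ.*_) (ℚ.*-inverseʳ r) ⟩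
    q ℚ.* 1ℚ                 ≡⟨ ℚ.*-identityʳ q ⟩
    q ∎
    where
    open ≡-Reasoning
    instance
      r-nonZero : ℚ.NonZero r
      r-nonZero = ℚ.≢-nonZero r≢0

  fromℤ-≢0 : ∀ {x} → x ≢ 0ℤ → fromℤ x ≢ 0ℚ
  fromℤ-≢0 x≢0 eq = x≢0 (fromℤ-injective eq)

  fromℤ-pos : ∀ {x} → 0ℤ ℤ.< x → 0ℚ ℚ.< fromℤ x
  fromℤ-pos 0<x = ℚ.≰⇒> λ x≤0 → ℤ.<⇒≱ 0<x (fromℤ-cancel-≤ x≤0)

  ½-injective : ∀ {x y} → ½ ℚ.* fromℤ x ≡ ½ ℚ.* fromℤ y → x ≡ y
  ½-injective {x} {y} eq = fromℤ-injective (trans (sym (double (fromℤ x))) (trans (cong₂ ℚ._+_ eq eq) (double (fromℤ y))))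
    where
    double : ∀ p → ½ ℚ.* p ℚ.+ ½ ℚ.* p ≡ p
    double = RingSolver.solve-∀ ℚ-ring

  module Half (d : ℕ) where

    open Field d

    opaque
      -- Algebraic integers have coordinates with denominator at most 2, so integer pairs suffice
      -- for all of `O`. Opacity keeps later goals about integers from unfolding into normalised
      -- rationals.
      half : ℤ → ℤ → K
      half x y = _+_√d (½ ℚ.* fromℤ x) (½ ℚ.* fromℤ y)

    opaque
      unfolding half

      half≡ : ∀ x y → half x y ≡ _+_√d (½ ℚ.* fromℤ x) (½ ℚ.* fromℤ y)
      half≡ x y = refl

      half-injective : ∀ {x y x′ y′} → half x y ≡ half x′ y′ → x ≡ x′ × y ≡ y′
      half-injective eq = ½-injective (cong re eq) , ½-injective (cong im eq)

      half-⊕ : ∀ x y x′ y′ → half x y ⊕ half x′ y′ ≡ half (x + x′) (y + y′)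
      half-⊕ x y x′ y′ = cong₂ _+_√d (lemma x x′) (lemma y y′)
        where
        lemma : ∀ x x′ → ½ ℚ.* fromℤ x ℚ.+ ½ ℚ.* fromℤ x′ ≡ ½ ℚ.* fromℤ (x + x′)
        lemma x x′ = trans (sym (ℚ.*-distribˡ-+ ½ (fromℤ x) (fromℤ x′))) (cong (½ ℚ.*_) (sym (fromℤ-+ x x′)))

      half-⊝ : ∀ x y → ⊝ half x y ≡ half (- x) (- y)
      half-⊝ x y = cong₂ _+_√d (lemma x) (lemma y)
        where
        lemma : ∀ x → ℚ.- (½ ℚ.* fromℤ x) ≡ ½ ℚ.* fromℤ (- x)
        lemma x = trans (ℚ.neg-distribʳ-* ½ (fromℤ x)) (cong (½ ℚ.*_) (sym (fromℤ-neg x)))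

      fromℤ-bilinear : ∀ x y z w → fromℤ (x * y + + d * (z * w)) ≡ fromℤ x ℚ.* fromℤ y ℚ.+ dℚ ℚ.* (fromℤ z ℚ.* fromℤ w)
      fromℤ-bilinear x y z w = trans (fromℤ-+ (x * y) (+ d * (z * w)))
        (cong₂ ℚ._+_ (fromℤ-* x y) (trans (fromℤ-* (+ d) (z * w)) (cong (dℚ ℚ.*_) (fromℤ-* z w))))

      -- A product of two halves has denominator 4 and returns to denominator 2 only for suitable
      -- factors; the two hypotheses supply the halved numerators.
      half-⊛ : ∀ x y x′ y′ s t → x * x′ + + d * (y * y′) ≡ + 2 * s → x * y′ + y * x′ ≡ + 2 * t →
               half x y ⊛ half x′ y′ ≡ half s t
      half-⊛ x y x′ y′ s t eqₛ eqₜ = cong₂ _+_√d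
        (trans (lemma₁ (fromℤ x) (fromℤ x′) (fromℤ y) (fromℤ y′) dℚ)
               (trans (cong (λ p → ½ ℚ.* (½ ℚ.* p)) (trans (sym (fromℤ-bilinear x x′ y y′)) (trans (cong fromℤ eqₛ) (fromℤ-* (+ 2) s))))
                      (lemma₃ (fromℤ s))))
        (trans (lemma₂ (fromℤ x) (fromℤ x′) (fromℤ y) (fromℤ y′))
               (trans (cong (λ p → ½ ℚ.* (½ ℚ.* p)) (trans (sym (trans (fromℤ-+ (x * y′) (y * x′)) (cong₂ ℚ._+_ (fromℤ-* x y′) (fromℤ-* y x′)))) (trans (cong fromℤ eqₜ) (fromℤ-* (+ 2) t))))
                      (lemma₃ (fromℤ t))))
        where
        lemma₁ : ∀ x x′ y y′ d → ½ ℚ.* x ℚ.* (½ ℚ.* x′) ℚ.+ d ℚ.* (½ ℚ.* y ℚ.* (½ ℚ.* y′)) ≡ ½ ℚ.* (½ ℚ.* (x ℚ.* x′ ℚ.+ d ℚ.* (y ℚ.* y′)))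
        lemma₁ = RingSolver.solve-∀ ℚ-ring
        lemma₂ : ∀ x x′ y y′ → ½ ℚ.* x ℚ.* (½ ℚ.* y′) ℚ.+ ½ ℚ.* y ℚ.* (½ ℚ.* x′) ≡ ½ ℚ.* (½ ℚ.* (x ℚ.* y′ ℚ.+ y ℚ.* x′))
        lemma₂ = RingSolver.solve-∀ ℚ-ring
        lemma₃ : ∀ p → ½ ℚ.* (½ ℚ.* (fromℤ (+ 2) ℚ.* p)) ≡ ½ ℚ.* p
        lemma₃ = RingSolver.solve-∀ ℚ-ring

      0K≡half : 0K ≡ half 0ℤ 0ℤ
      0K≡half = refl

      1K≡half : 1K ≡ half (+ 2) 0ℤ
      1K≡half = refl

      ι≡half : ∀ m → ι m ≡ half (+ 2 * m) 0ℤ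
      ι≡half m = cong₂ _+_√d (trans (lemma (fromℤ m)) (cong (½ ℚ.*_) (sym (fromℤ-* (+ 2) m)))) refl
        where
        lemma : ∀ p → p ≡ ½ ℚ.* (fromℤ (+ 2) ℚ.* p)
        lemma = RingSolver.solve-∀ ℚ-ring

      ι-⊛-half : ∀ m x y → ι m ⊛ half x y ≡ half (m * x) (m * y)
      ι-⊛-half m x y = trans (cong (_⊛ half x y) (ι≡half m)) (half-⊛ (+ 2 * m) 0ℤ x y (m * x) (m * y) (lemma₁ m x y (+ d)) (lemma₂ m x y))
        where
        lemma₁ : ∀ m x y d → + 2 * m * x + d * (0ℤ * y) ≡ + 2 * (m * x)
        lemma₁ = solve-∀
        lemma₂ : ∀ m x y → + 2 * m * y + 0ℤ * x ≡ + 2 * (m * y)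
        lemma₂ = solve-∀

      √d-⊛-half : ∀ x y → √d ⊛ half x y ≡ half (+ d * y) x
      √d-⊛-half x y = half-⊛ 0ℤ (+ 2) x y (+ d * y) x (lemma₁ x y (+ d)) (lemma₂ x y)
        where
        lemma₁ : ∀ x y d → 0ℤ * x + d * (+ 2 * y) ≡ + 2 * (d * y)
        lemma₁ = solve-∀
        lemma₂ : ∀ x y → 0ℤ * y + + 2 * x ≡ + 2 * x
        lemma₂ = solve-∀

      tr-half : ∀ x y → tr (half x y) ≡ fromℤ x
      tr-half x y = lemma (fromℤ x)
        where
        lemma : ∀ p → ½ ℚ.* p ℚ.+ ½ ℚ.* p ≡ p
        lemma = RingSolver.solve-∀ ℚ-ring

      4nm-half : ∀ x y → fromℤ (+ 4) ℚ.* nm (half x y) ≡ fromℤ (x * x - + d * (y * y))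
      4nm-half x y = trans (lemma (fromℤ x) (fromℤ y) dℚ)
        (sym (trans (fromℤ-sub (x * x) (+ d * (y * y))) (cong₂ ℚ._-_ (fromℤ-* x x) (trans (fromℤ-* (+ d) (y * y)) (cong (dℚ ℚ.*_) (fromℤ-* y y))))))
        where
        lemma : ∀ x y d → fromℤ (+ 4) ℚ.* (½ ℚ.* x ℚ.* (½ ℚ.* x) ℚ.- d ℚ.* (½ ℚ.* y ℚ.* (½ ℚ.* y))) ≡ x ℚ.* x ℚ.- d ℚ.* (y ℚ.* y)
        lemma = RingSolver.solve-∀ ℚ-ring

      nm-half : ∀ x y n → x * x - + d * (y * y) ≡ + 4 * n → nm (half x y) ≡ fromℤ n
      nm-half x y n eq = ℚ-cancelʳ {r = fromℤ (+ 4)} (λ ()) (trans (ℚ.*-comm (nm (half x y)) (fromℤ (+ 4)))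
        (trans (4nm-half x y) (trans (cong fromℤ eq) (trans (fromℤ-* (+ 4) n) (ℚ.*-comm (fromℤ (+ 4)) (fromℤ n))))))

      nm-half⁻¹ : ∀ x y n → nm (half x y) ≡ fromℤ n → x * x - + d * (y * y) ≡ + 4 * n
      nm-half⁻¹ x y n eq = fromℤ-injective (trans (sym (4nm-half x y)) (trans (cong (fromℤ (+ 4) ℚ.*_) eq) (sym (fromℤ-* (+ 4) n))))

      ‖half‖² : ∀ x y → ‖ half x y ‖² ≡ ½ ℚ.* fromℤ (x * x + + d * (y * y))
      ‖half‖² x y = trans (lemma (fromℤ x) (fromℤ y) dℚ) (cong (½ ℚ.*_) (sym (fromℤ-bilinear x x y y)))
        where
        lemma : ∀ x y d → fromℤ (+ 2) ℚ.* (½ ℚ.* x ℚ.* (½ ℚ.* x) ℚ.+ d ℚ.* (½ ℚ.* y ℚ.* (½ ℚ.* y))) ≡ ½ ℚ.* (x ℚ.* x ℚ.+ d ℚ.* (y ℚ.* y))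
        lemma = RingSolver.solve-∀ ℚ-ring

      ‖half‖²-mono : ∀ x y x′ y′ → x * x + + d * (y * y) ℤ.≤ x′ * x′ + + d * (y′ * y′) → ‖ half x y ‖² ℚ.≤ ‖ half x′ y′ ‖²
      ‖half‖²-mono x y x′ y′ p = subst₂ ℚ._≤_ (sym (‖half‖² x y)) (sym (‖half‖² x′ y′)) (ℚ.*-monoˡ-≤-nonNeg ½ (fromℤ-mono-≤ p))

      ‖half‖²-cancel : ∀ x y x′ y′ → ‖ half x y ‖² ℚ.≤ ‖ half x′ y′ ‖² → x * x + + d * (y * y) ℤ.≤ x′ * x′ + + d * (y′ * y′)
      ‖half‖²-cancel x y x′ y′ p = fromℤ-cancel-≤ (ℚ.*-cancelˡ-≤-pos ½ (subst₂ ℚ._≤_ (‖half‖² x y) (‖half‖² x′ y′) p))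

      det-half : ∀ x y x′ y′ → re (half x y) ℚ.* im (half x′ y′) ≡ im (half x y) ℚ.* re (half x′ y′) → x * y′ ≡ y * x′
      det-half x y x′ y′ eq = ½-injective (½½ x y′ y x′ eq)
        where
        lemma : ∀ p q → ½ ℚ.* p ℚ.* (½ ℚ.* q) ≡ ½ ℚ.* (p ℚ.* q) ℚ.* ½
        lemma = RingSolver.solve-∀ ℚ-ring
        ½½ : ∀ x y z w → ½ ℚ.* fromℤ x ℚ.* (½ ℚ.* fromℤ y) ≡ ½ ℚ.* fromℤ z ℚ.* (½ ℚ.* fromℤ w) → ½ ℚ.* fromℤ (x * y) ≡ ½ ℚ.* fromℤ (z * w)
        ½½ x y z w eq = ℚ-cancelʳ {r = ½} (λ ()) (trans (cong (λ p → ½ ℚ.* p ℚ.* ½) (fromℤ-* x y)) (trans (sym (lemma (fromℤ x) (fromℤ y)))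
          (trans eq (trans (lemma (fromℤ z) (fromℤ w)) (cong (λ p → ½ ℚ.* p ℚ.* ½) (sym (fromℤ-* z w)))))))

      det-half⁻¹ : ∀ x y x′ y′ → x * y′ ≡ y * x′ → re (half x y) ℚ.* im (half x′ y′) ≡ im (half x y) ℚ.* re (half x′ y′)
      det-half⁻¹ x y x′ y′ eq = trans (lemma (fromℤ x) (fromℤ y′)) (trans (cong (½ ℚ.* ½ ℚ.*_)
        (trans (sym (fromℤ-* x y′)) (trans (cong fromℤ eq) (fromℤ-* y x′)))) (sym (lemma (fromℤ y) (fromℤ x′))))
        where
        lemma : ∀ p q → ½ ℚ.* p ℚ.* (½ ℚ.* q) ≡ ½ ℚ.* ½ ℚ.* (p ℚ.* q)
        lemma = RingSolver.solve-∀ ℚ-ring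

      ⊛-comm : ∀ x y → x ⊛ y ≡ y ⊛ x
      ⊛-comm (_+_√d a b) (_+_√d a′ b′) = cong₂ _+_√d (lemma₁ a b a′ b′ dℚ) (lemma₂ a b a′ b′)
        where
        lemma₁ : ∀ a b a′ b′ d → a ℚ.* a′ ℚ.+ d ℚ.* (b ℚ.* b′) ≡ a′ ℚ.* a ℚ.+ d ℚ.* (b′ ℚ.* b)
        lemma₁ = RingSolver.solve-∀ ℚ-ring
        lemma₂ : ∀ a b a′ b′ → a ℚ.* b′ ℚ.+ b ℚ.* a′ ≡ a′ ℚ.* b ℚ.+ b′ ℚ.* a
        lemma₂ = RingSolver.solve-∀ ℚ-ring

      ⊛-assoc : ∀ x y z → (x ⊛ y) ⊛ z ≡ x ⊛ (y ⊛ z)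
      ⊛-assoc (_+_√d a b) (_+_√d a′ b′) (_+_√d a″ b″) = cong₂ _+_√d (lemma₁ a b a′ b′ a″ b″ dℚ) (lemma₂ a b a′ b′ a″ b″ dℚ)
        where
        lemma₁ : ∀ a b a′ b′ a″ b″ d → (a ℚ.* a′ ℚ.+ d ℚ.* (b ℚ.* b′)) ℚ.* a″ ℚ.+ d ℚ.* ((a ℚ.* b′ ℚ.+ b ℚ.* a′) ℚ.* b″) ≡ a ℚ.* (a′ ℚ.* a″ ℚ.+ d ℚ.* (b′ ℚ.* b″)) ℚ.+ d ℚ.* (b ℚ.* (a′ ℚ.* b″ ℚ.+ b′ ℚ.* a″))
        lemma₁ = RingSolver.solve-∀ ℚ-ring
        lemma₂ : ∀ a b a′ b′ a″ b″ d → (a ℚ.* a′ ℚ.+ d ℚ.* (b ℚ.* b′)) ℚ.* b″ ℚ.+ (a ℚ.* b′ ℚ.+ b ℚ.* a′) ℚ.* a″ ≡ a ℚ.* (a′ ℚ.* b″ ℚ.+ b′ ℚ.* a″) ℚ.+ b ℚ.* (a′ ℚ.* a″ ℚ.+ d ℚ.* (b′ ℚ.* b″))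
        lemma₂ = RingSolver.solve-∀ ℚ-ring

      ⊛-identityʳ : ∀ x → x ⊛ 1K ≡ x
      ⊛-identityʳ (_+_√d a b) = cong₂ _+_√d (lemma₁ a b dℚ) (lemma₂ a b)
        where
        lemma₁ : ∀ a b d → a ℚ.* 1ℚ ℚ.+ d ℚ.* (b ℚ.* 0ℚ) ≡ a
        lemma₁ = RingSolver.solve-∀ ℚ-ring
        lemma₂ : ∀ a b → a ℚ.* 0ℚ ℚ.+ b ℚ.* 1ℚ ≡ b
        lemma₂ = RingSolver.solve-∀ ℚ-ring

      ι-cancel : ∀ {m} → m ≢ 0ℤ → ∀ z w → ι m ⊛ z ≡ ι m ⊛ w → z ≡ w
      ι-cancel {m} m≢0 (_+_√d a b) (_+_√d a′ b′) eq = cong₂ _+_√d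
        (cancel (trans (sym (lemma₁ (fromℤ m) a b dℚ)) (trans (cong re eq) (lemma₁ (fromℤ m) a′ b′ dℚ))))
        (cancel (trans (sym (lemma₂ (fromℤ m) a b)) (trans (cong im eq) (lemma₂ (fromℤ m) a′ b′))))
        where
        cancel : ∀ {p q} → p ℚ.* fromℤ m ≡ q ℚ.* fromℤ m → p ≡ q
        cancel = ℚ-cancelʳ (fromℤ-≢0 m≢0)
        lemma₁ : ∀ m a b d → m ℚ.* a ℚ.+ d ℚ.* (0ℚ ℚ.* b) ≡ a ℚ.* m
        lemma₁ = RingSolver.solve-∀ ℚ-ring
        lemma₂ : ∀ m a b → m ℚ.* b ℚ.+ 0ℚ ℚ.* a ≡ b ℚ.* m
        lemma₂ = RingSolver.solve-∀ ℚ-ring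

      half∈O : ∀ x y n → x * x - + d * (y * y) ≡ + 4 * n → O (half x y)
      half∈O x y n eq = (x , tr-half x y) , (n , nm-half x y n eq)

      √d∈O : O √d
      √d∈O = half∈O 0ℤ (+ 2) (- + d) (lemma (+ d))
        where
        lemma : ∀ d → 0ℤ * 0ℤ - d * (+ 2 * + 2) ≡ + 4 * (- d)
        lemma = solve-∀

      ι∈O : ∀ m → O (ι m)
      ι∈O m = subst O (sym (ι≡half m)) (half∈O (+ 2 * m) 0ℤ (m * m) (lemma m (+ d)))
        where
        lemma : ∀ m d → + 2 * m * (+ 2 * m) - d * (0ℤ * 0ℤ) ≡ + 4 * (m * m)
        lemma = solve-∀

      -- The trace gives 2 a at once. For the other coordinate only d (2 b)² = x² - 4 n is known to
      -- be an integer; `root`, applied after clearing the denominator of `b`, makes 2 b itself an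
      -- integer.
      O⇒half : Squarefree d → ∀ z → O z → ∃[ x ] ∃[ y ] ∃[ n ] (z ≡ half x y × x * x - + d * (y * y) ≡ + 4 * n)
      O⇒half sf (_+_√d a b) ((x , tr≡) , (n , nm≡)) = x , y , n , z≡ , nm-half⁻¹ x y n (trans (cong nm (sym z≡)) nm≡)
        where
        P Q : ℤ
        P = ℚ.↥ b
        Q = ℚ.↧ b
        Q≢0 : Q ≢ 0ℤ
        Q≢0 ()
        halve : ∀ a p → a ℚ.+ a ≡ p → a ≡ ½ ℚ.* p
        halve a _ refl = lemma a
          where
          lemma : ∀ a → a ≡ ½ ℚ.* (a ℚ.+ a)
          lemma = RingSolver.solve-∀ ℚ-ring
        a≡ : a ≡ ½ ℚ.* fromℤ x
        a≡ = halve a (fromℤ x) tr≡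
        rational : dℚ ℚ.* ((b ℚ.+ b) ℚ.* (b ℚ.+ b)) ≡ fromℤ (x * x - + 4 * n)
        rational = trans (lemma a b dℚ) (trans (cong₂ (λ t m → t ℚ.* t ℚ.- fromℤ (+ 4) ℚ.* m) tr≡ nm≡)
          (sym (trans (fromℤ-sub (x * x) (+ 4 * n)) (cong₂ ℚ._-_ (fromℤ-* x x) (fromℤ-* (+ 4) n)))))
          where
          lemma : ∀ a b d → d ℚ.* ((b ℚ.+ b) ℚ.* (b ℚ.+ b)) ≡ (a ℚ.+ a) ℚ.* (a ℚ.+ a) ℚ.- fromℤ (+ 4) ℚ.* (a ℚ.* a ℚ.- d ℚ.* (b ℚ.* b))
          lemma = RingSolver.solve-∀ ℚ-ring
        bQ≡P : b ℚ.* fromℤ Q ≡ fromℤ P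
        bQ≡P = *-fromℤ-denominator b
        2bQ≡ : (b ℚ.+ b) ℚ.* fromℤ Q ≡ fromℤ (P + P)
        2bQ≡ = trans (ℚ.*-distribʳ-+ (fromℤ Q) b b) (trans (cong₂ ℚ._+_ bQ≡P bQ≡P) (sym (fromℤ-+ P P)))
        integral : + d * ((P + P) * (P + P)) ≡ (x * x - + 4 * n) * (Q * Q)
        integral = fromℤ-injective (begin
          fromℤ (+ d * ((P + P) * (P + P)))                             ≡⟨ trans (fromℤ-* (+ d) _) (cong (dℚ ℚ.*_) (fromℤ-* (P + P) (P + P))) ⟩
          dℚ ℚ.* (fromℤ (P + P) ℚ.* fromℤ (P + P))                       ≡⟨ cong (λ p → dℚ ℚ.* (p ℚ.* p)) 2bQ≡ ⟨
          dℚ ℚ.* ((b ℚ.+ b) ℚ.* fromℤ Q ℚ.* ((b ℚ.+ b) ℚ.* fromℤ Q))     ≡⟨ lemma dℚ (b ℚ.+ b) (fromℤ Q) ⟩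
          dℚ ℚ.* ((b ℚ.+ b) ℚ.* (b ℚ.+ b)) ℚ.* (fromℤ Q ℚ.* fromℤ Q)     ≡⟨ cong₂ ℚ._*_ rational (sym (fromℤ-* Q Q)) ⟩
          fromℤ (x * x - + 4 * n) ℚ.* fromℤ (Q * Q)                     ≡⟨ fromℤ-* (x * x - + 4 * n) (Q * Q) ⟨
          fromℤ ((x * x - + 4 * n) * (Q * Q))                           ∎)
          where
          open ≡-Reasoning
          lemma : ∀ d b q → d ℚ.* (b ℚ.* q ℚ.* (b ℚ.* q)) ≡ d ℚ.* (b ℚ.* b) ℚ.* (q ℚ.* q)
          lemma = RingSolver.solve-∀ ℚ-ring
        Q∣2P : Q ∣ P + P
        Q∣2P = root sf (P + P) Q (x * x - + 4 * n) Q≢0 integral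
        y : ℤ
        y = _∣_.quotient Q∣2P
        2P≡yQ : P + P ≡ y * Q
        2P≡yQ = _∣_.equality Q∣2P
        b≡ : b ≡ ½ ℚ.* fromℤ y
        b≡ = halve b (fromℤ y) (ℚ-cancelʳ (fromℤ-≢0 Q≢0) (trans 2bQ≡ (trans (cong fromℤ 2P≡yQ) (fromℤ-* y Q))))
        z≡ : _+_√d a b ≡ half x y
        z≡ = cong₂ _+_√d a≡ b≡

-- Minimal vectors of a plane lattice stable under √d.

module MinimalVectors
  (d : ℕ) (squarefree : Squarefree d) (3≤d : + 3 ℤ.≤ + d) (d≢4 : + d ≢ + 4)
  (J : ℤ → ℤ → Set)
  (J-+ : ∀ {x y x′ y′} → J x y → J x′ y′ → J (x ℤ.+ x′) (y ℤ.+ y′))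
  (J-* : ∀ k {x y} → J x y → J (k ℤ.* x) (k ℤ.* y))
  (J-√d : ∀ {x y} → J x y → J (+ d ℤ.* y) x)
  where
  open import Data.Integer
  open import Data.Product using (∃-syntax; _×_; _,_; proj₁; proj₂)
  open import Data.Sum using (_⊎_; inj₁; inj₂)
  open import Relation.Binary.PropositionalEquality hiding (J)
  open import Data.Integer.Properties
  open import Data.Integer.Divisibility.Signed using (_∣_)
  open import Data.Integer.Tactic.RingSolver using (solve-∀)
  open import Relation.Binary.Definitions using (Tri; tri<; tri≈; tri>)
  open import Relation.Nullary using (¬_; Dec; yes; no; contradiction)
  open IntegerArithmetic

  private
    δ : ℤ
    δ = + d

    0<δ : 0ℤ < δ
    0<δ = <-≤-trans (+<+ (ℕ.s≤s ℕ.z≤n)) 3≤d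

    δ≢0 : δ ≢ 0ℤ
    δ≢0 = pos⇒≢0 0<δ

  -- Twice the squared length of `half x y`, which has the same minimal vectors.
  q : ℤ → ℤ → ℤ
  q x y = x * x + δ * (y * y)

  0≤q : ∀ x y → 0ℤ ≤ q x y
  0≤q x y = 0≤+ (0≤i² x) (0≤i*j {δ} (<⇒≤ 0<δ) (0≤i² y))

  q≡0⇒≡0 : ∀ {x y} → q x y ≡ 0ℤ → x ≡ 0ℤ × y ≡ 0ℤ
  q≡0⇒≡0 {x} {y} eq = i²≡0⇒i≡0 x²≡0 , i²≡0⇒i≡0 (cancelˡ δ≢0 (trans δy²≡0 (sym (*-zeroʳ δ))))
    where
    x²≡0 : x * x ≡ 0ℤ
    x²≡0 = ≤-antisym (subst (x * x ≤_) eq (≤-by (δ * (y * y)) (0≤i*j {δ} (<⇒≤ 0<δ) (0≤i² y)) (lemma (x * x) (δ * (y * y))))) (0≤i² x)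
      where
      lemma : ∀ a b → a + b - a ≡ b
      lemma = solve-∀
    δy²≡0 : δ * (y * y) ≡ 0ℤ
    δy²≡0 = trans (sym (+-identityˡ (δ * (y * y)))) (trans (cong (_+ δ * (y * y)) (sym x²≡0)) eq)

  -- The disjunction, in place of a hypothesis that the vector is nonzero, lets `basis` branch on
  -- whether a remainder vanishes.
  Minimal : ℤ → ℤ → Set
  Minimal x y = J x y × (∀ x′ y′ → J x′ y′ → (x′ ≡ 0ℤ × y′ ≡ 0ℤ) ⊎ q x y ≤ q x′ y′)

  det : ℤ → ℤ → ℤ → ℤ → ℤ
  det x y x′ y′ = x * y′ - x′ * y

  det≢0⇒≢0 : ∀ x y x′ y′ → det x y x′ y′ ≢ 0ℤ → ¬ (x ≡ 0ℤ × y ≡ 0ℤ)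
  det≢0⇒≢0 _ _ x′ y′ det≢0 (refl , refl) = det≢0 (lemma x′ y′)
    where
    lemma : ∀ x′ y′ → 0ℤ * y′ - x′ * 0ℤ ≡ 0ℤ
    lemma = solve-∀

  det-swap : ∀ x y x′ y′ → det x y x′ y′ ≡ - det x′ y′ x y
  det-swap = lemma
    where
    lemma : ∀ x y x′ y′ → x * y′ - x′ * y ≡ - (x′ * y - x * y′)
    lemma = solve-∀

  J-neg : ∀ {x y} → J x y → J (- x) (- y)
  J-neg {x} {y} j = subst₂ J (-1*i≡-i x) (-1*i≡-i y) (J-* -1ℤ j)

  -- Both coordinates of a remainder being at most half a period in size makes its length
  -- at most 3/4 of the minimum.
  remainder-short : ∀ {m h ρ σ D Q} → 0ℤ < m → D ≢ 0ℤ → 0ℤ ≤ m - + 2 * h → 0ℤ ≤ m + + 2 * h →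
                    + 4 * (ρ * ρ) ≤ D * D → + 4 * (σ * σ) ≤ D * D →
                    D * D * Q ≡ ρ * ρ * m + + 2 * (ρ * σ) * h + σ * σ * m → ¬ (m ≤ Q)
  remainder-short {m} {h} {ρ} {σ} {D} {Q} 0<m D≢0 0≤m-2h 0≤m+2h ρ-bound σ-bound eq m≤Q =
    <⇒≱ (0<i*j {+ 2} (+<+ (ℕ.s≤s ℕ.z≤n)) (0<i*j {m} 0<m (0<i² D≢0))) (0≤i-j⇒j≤i (subst (0ℤ ≤_) (sym total) (0≤+ (0≤+
      (0≤i*j {+ 8 * (D * D)} (0≤i*j {+ 8} (+≤+ ℕ.z≤n) (0≤i² D)) (i≤j⇒0≤j-i m≤Q))
      (0≤i*j {+ 3 * m} (0≤i*j {+ 3} (+≤+ ℕ.z≤n) (<⇒≤ 0<m)) (0≤+ (i≤j⇒0≤j-i ρ-bound) (i≤j⇒0≤j-i σ-bound))))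
      (0≤i*j {+ 2} (+≤+ ℕ.z≤n) (0≤+ (0≤i*j 0≤m-2h (0≤i² (ρ + σ))) (0≤i*j 0≤m+2h (0≤i² (ρ - σ))))))))
    where
    lemma : ∀ m h ρ σ D Q → 0ℤ - + 2 * (m * (D * D)) - (+ 8 * (D * D) * (Q - m) + + 3 * m * (D * D - + 4 * (ρ * ρ) + (D * D - + 4 * (σ * σ))) + + 2 * ((m - + 2 * h) * ((ρ + σ) * (ρ + σ)) + (m + + 2 * h) * ((ρ - σ) * (ρ - σ)))) ≡ - + 8 * (D * D * Q - (ρ * ρ * m + + 2 * (ρ * σ) * h + σ * σ * m))
    lemma = solve-∀
    -- If m ≤ Q held, the three summands on the right would all be nonnegative, yet their sum is - 2
    -- m D². The squares weighted by m ± 2 h encode |2 h| ≤ m and absorb the mixed term in ρ σ h.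
    total : 0ℤ - + 2 * (m * (D * D)) ≡ + 8 * (D * D) * (Q - m) + + 3 * m * (D * D - + 4 * (ρ * ρ) + (D * D - + 4 * (σ * σ))) + + 2 * ((m - + 2 * h) * ((ρ + σ) * (ρ + σ)) + (m + + 2 * h) * ((ρ - σ) * (ρ - σ)))
    total = combine₁ (- + 8) eq (lemma m h ρ σ D Q)

  module Pair {X Y X′ Y′} (u-min : Minimal X Y) (v-min : Minimal X′ Y′) (D≢0 : det X Y X′ Y′ ≢ 0ℤ) where

    D m h : ℤ
    D = det X Y X′ Y′
    m = q X Y
    h = X * X′ + δ * (Y * Y′)

    private
      u≢0 : ¬ (X ≡ 0ℤ × Y ≡ 0ℤ)
      u≢0 = det≢0⇒≢0 X Y X′ Y′ D≢0

      v≢0 : ¬ (X′ ≡ 0ℤ × Y′ ≡ 0ℤ)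
      v≢0 = det≢0⇒≢0 X′ Y′ X Y λ eq → D≢0 (trans (det-swap X Y X′ Y′) (cong -_ eq))

      nonzero⇒≤ : ∀ {x y x′ y′} → Minimal x y → J x′ y′ → ¬ (x′ ≡ 0ℤ × y′ ≡ 0ℤ) → q x y ≤ q x′ y′
      nonzero⇒≤ (_ , min) j ≢0 with min _ _ j
      ... | inj₁ ≡0 = contradiction ≡0 ≢0
      ... | inj₂ le = le

    same-length : q X Y ≡ q X′ Y′
    same-length = ≤-antisym (nonzero⇒≤ u-min (proj₁ v-min) v≢0) (nonzero⇒≤ v-min (proj₁ u-min) u≢0)

    0<m : 0ℤ < m
    0<m = ≤∧≢⇒< (0≤q X Y) (λ eq → u≢0 (q≡0⇒≡0 (sym eq)))

    -- `h` is the inner product of u and v. Since u + v is a nonzero lattice vector, its length 2 m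
    -- + 2 h is at least `m`. Together with `0≤m-2h`, from u - v, this confines the angle between u
    -- and v to 60° through 120°.
    0≤m+2h : 0ℤ ≤ m + + 2 * h
    0≤m+2h = subst (0ℤ ≤_) (combine₁ (- 1ℤ) same-length (lemma X Y X′ Y′ δ))
      (i≤j⇒0≤j-i (nonzero⇒≤ u-min (J-+ (proj₁ u-min) (proj₁ v-min)) (det≢0⇒≢0 (X + X′) (Y + Y′) X′ Y′ λ eq → D≢0 (trans (lemma′ X Y X′ Y′) eq))))
      where
      lemma : ∀ X Y X′ Y′ δ → (X + X′) * (X + X′) + δ * ((Y + Y′) * (Y + Y′)) - (X * X + δ * (Y * Y)) - (X * X + δ * (Y * Y) + + 2 * (X * X′ + δ * (Y * Y′))) ≡ - 1ℤ * (X * X + δ * (Y * Y) - (X′ * X′ + δ * (Y′ * Y′)))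
      lemma = solve-∀
      lemma′ : ∀ X Y X′ Y′ → X * Y′ - X′ * Y ≡ (X + X′) * Y′ - X′ * (Y + Y′)
      lemma′ = solve-∀

    0≤m-2h : 0ℤ ≤ m - + 2 * h
    0≤m-2h = subst (0ℤ ≤_) (combine₁ (- 1ℤ) same-length (lemma X Y X′ Y′ δ))
      (i≤j⇒0≤j-i (nonzero⇒≤ u-min (J-+ (proj₁ u-min) (J-neg (proj₁ v-min))) (det≢0⇒≢0 (X + - X′) (Y + - Y′) X′ Y′ λ eq → D≢0 (trans (lemma′ X Y X′ Y′) eq))))
      where
      lemma : ∀ X Y X′ Y′ δ → (X + - X′) * (X + - X′) + δ * ((Y + - Y′) * (Y + - Y′)) - (X * X + δ * (Y * Y)) - (X * X + δ * (Y * Y) - + 2 * (X * X′ + δ * (Y * Y′))) ≡ - 1ℤ * (X * X + δ * (Y * Y) - (X′ * X′ + δ * (Y′ * Y′)))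
      lemma = solve-∀
      lemma′ : ∀ X Y X′ Y′ → X * Y′ - X′ * Y ≡ (X + - X′) * Y′ - X′ * (Y + - Y′)
      lemma′ = solve-∀

    abstract
      -- By Cramer's rule the coordinates are (W Y′ - X′ Z) / D and (X Z - W Y) / D. Rounding both
      -- leaves the lattice vector (ρ u + σ v) / D, which `remainder-short` excludes unless it is
      -- zero.
      basis : ∀ W Z → J W Z → ∃[ p ] ∃[ r ] (W ≡ p * X + r * X′ × Z ≡ p * Y + r * Y′)
      basis W Z j with nearest (W * Y′ - X′ * Z) D D≢0 | nearest (X * Z - W * Y) D D≢0
      ... | p , ρ , A≡ , ρ-bound | r , σ , B≡ , σ-bound = p , r , split
        where
        W′ Z′ : ℤ
        W′ = W + (- p * X + - r * X′)
        Z′ = Z + (- p * Y + - r * Y′)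
        J-remainder : J W′ Z′
        J-remainder = J-+ j (J-+ (J-* (- p) (proj₁ u-min)) (J-* (- r) (proj₁ v-min)))
        DW′ : D * W′ ≡ ρ * X + σ * X′
        DW′ = combine₂ X X′ A≡ B≡ (lemma X Y X′ Y′ W Z p r ρ σ)
          where
          lemma : ∀ X Y X′ Y′ W Z p r ρ σ → (X * Y′ - X′ * Y) * (W + (- p * X + - r * X′)) - (ρ * X + σ * X′) ≡ X * (W * Y′ - X′ * Z - (p * (X * Y′ - X′ * Y) + ρ)) + X′ * (X * Z - W * Y - (r * (X * Y′ - X′ * Y) + σ))
          lemma = solve-∀
        DZ′ : D * Z′ ≡ ρ * Y + σ * Y′
        DZ′ = combine₂ Y Y′ A≡ B≡ (lemma X Y X′ Y′ W Z p r ρ σ)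
          where
          lemma : ∀ X Y X′ Y′ W Z p r ρ σ → (X * Y′ - X′ * Y) * (Z + (- p * Y + - r * Y′)) - (ρ * Y + σ * Y′) ≡ Y * (W * Y′ - X′ * Z - (p * (X * Y′ - X′ * Y) + ρ)) + Y′ * (X * Z - W * Y - (r * (X * Y′ - X′ * Y) + σ))
          lemma = solve-∀
        scaled-length : D * D * q W′ Z′ ≡ ρ * ρ * m + + 2 * (ρ * σ) * h + σ * σ * m
        scaled-length = trans (lemma₁ D W′ Z′ δ) (trans (cong₂ (λ x y → x * x + δ * (y * y)) DW′ DZ′)
          (combine₁ (- (σ * σ)) same-length (lemma₂ X Y X′ Y′ ρ σ δ)))
          where
          lemma₁ : ∀ D x y δ → D * D * (x * x + δ * (y * y)) ≡ D * x * (D * x) + δ * (D * y * (D * y))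
          lemma₁ = solve-∀
          lemma₂ : ∀ X Y X′ Y′ ρ σ δ → (ρ * X + σ * X′) * (ρ * X + σ * X′) + δ * ((ρ * Y + σ * Y′) * (ρ * Y + σ * Y′)) - (ρ * ρ * (X * X + δ * (Y * Y)) + + 2 * (ρ * σ) * (X * X′ + δ * (Y * Y′)) + σ * σ * (X * X + δ * (Y * Y))) ≡ - (σ * σ) * (X * X + δ * (Y * Y) - (X′ * X′ + δ * (Y′ * Y′)))
          lemma₂ = solve-∀
        lemma : ∀ w a b p r → w - (p * a + r * b) ≡ 1ℤ * (w + (- p * a + - r * b) - 0ℤ)
        lemma = solve-∀
        split : W ≡ p * X + r * X′ × Z ≡ p * Y + r * Y′
        split with proj₂ u-min W′ Z′ J-remainder
        ... | inj₁ (W′≡0 , Z′≡0) = combine₁ 1ℤ W′≡0 (lemma W X X′ p r) , combine₁ 1ℤ Z′≡0 (lemma Z Y Y′ p r)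
        ... | inj₂ m≤ = contradiction m≤ (remainder-short {h = h} {ρ} {σ} {D} 0<m D≢0 0≤m-2h 0≤m+2h ρ-bound σ-bound scaled-length)

    private
      -- √d u = a u + b v and √d v = c u + a′ v. The integers `s` and `t` will be the quotients of
      -- `M` by `D` and of `τ` by d.
      a b a′ c τ s t : ℤ
      a = proj₁ (basis _ _ (J-√d (proj₁ u-min)))
      b = proj₁ (proj₂ (basis _ _ (J-√d (proj₁ u-min))))
      c = proj₁ (basis _ _ (J-√d (proj₁ v-min)))
      a′ = proj₁ (proj₂ (basis _ _ (J-√d (proj₁ v-min))))
      τ = b + c

      √du : δ * Y ≡ a * X + b * X′ × X ≡ a * Y + b * Y′
      √du = proj₂ (proj₂ (basis _ _ (J-√d (proj₁ u-min))))

      √dv : δ * Y′ ≡ c * X + a′ * X′ × X′ ≡ c * Y + a′ * Y′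
      √dv = proj₂ (proj₂ (basis _ _ (J-√d (proj₁ v-min))))

      bD : b * D ≡ X * X - δ * (Y * Y)
      bD = combine₂ Y (- X) (proj₁ √du) (proj₂ √du) (lemma X Y X′ Y′ a b δ)
        where
        lemma : ∀ X Y X′ Y′ a b δ → b * (X * Y′ - X′ * Y) - (X * X - δ * (Y * Y)) ≡ Y * (δ * Y - (a * X + b * X′)) + - X * (X - (a * Y + b * Y′))
        lemma = solve-∀

      cD : c * D ≡ δ * (Y′ * Y′) - X′ * X′
      cD = combine₂ (- Y′) X′ (proj₁ √dv) (proj₂ √dv) (lemma X Y X′ Y′ a′ c δ)
        where
        lemma : ∀ X Y X′ Y′ a c δ → c * (X * Y′ - X′ * Y) - (δ * (Y′ * Y′) - X′ * X′) ≡ - Y′ * (δ * Y′ - (c * X + a * X′)) + X′ * (X′ - (c * Y + a * Y′))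
        lemma = solve-∀

      aD : a * D ≡ δ * (Y * Y′) - X * X′
      aD = combine₂ (- Y′) X′ (proj₁ √du) (proj₂ √du) (lemma X Y X′ Y′ a b δ)
        where
        lemma : ∀ X Y X′ Y′ a b δ → a * (X * Y′ - X′ * Y) - (δ * (Y * Y′) - X * X′) ≡ - Y′ * (δ * Y - (a * X + b * X′)) + X′ * (X - (a * Y + b * Y′))
        lemma = solve-∀

      M : ℤ
      M = + 2 * (X * Y - X′ * Y′)

      τD : τ * D ≡ + 2 * δ * (Y′ * Y′ - Y * Y)
      τD = combine₃ 1ℤ 1ℤ 1ℤ bD cD same-length (lemma X Y X′ Y′ b c δ (X * Y′ - X′ * Y))
        where
        lemma : ∀ X Y X′ Y′ b c δ D → (b + c) * D - + 2 * δ * (Y′ * Y′ - Y * Y) ≡ 1ℤ * (b * D - (X * X - δ * (Y * Y))) + 1ℤ * (c * D - (δ * (Y′ * Y′) - X′ * X′)) + 1ℤ * (X * X + δ * (Y * Y) - (X′ * X′ + δ * (Y′ * Y′)))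
        lemma = solve-∀

      -- With U = X + √-d Y and V = X′ + √-d Y′, the number U² - V² has real part τ D and imaginary
      -- part √d M, and for |U| = |V| its modulus is 2 |Im (Ū V)| = 2 √d |D|. The claim is
      -- Pythagoras for this number.
      dM²≡ : δ * (M * M) ≡ (+ 4 * δ - τ * τ) * (D * D)
      dM²≡ = combine₂ (τ * D + + 2 * δ * (Y′ * Y′ - Y * Y)) (- + 4 * δ * (Y′ * Y′ - Y * Y)) τD same-length (lemma X Y X′ Y′ τ δ)
        where
        lemma : ∀ X Y X′ Y′ τ δ → δ * (+ 2 * (X * Y - X′ * Y′) * (+ 2 * (X * Y - X′ * Y′))) - (+ 4 * δ - τ * τ) * ((X * Y′ - X′ * Y) * (X * Y′ - X′ * Y)) ≡ (τ * (X * Y′ - X′ * Y) + + 2 * δ * (Y′ * Y′ - Y * Y)) * (τ * (X * Y′ - X′ * Y) - + 2 * δ * (Y′ * Y′ - Y * Y)) + - + 4 * δ * (Y′ * Y′ - Y * Y) * (X * X + δ * (Y * Y) - (X′ * X′ + δ * (Y′ * Y′)))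
        lemma = solve-∀

      D∣M : D ∣ M
      D∣M = root squarefree M D (+ 4 * δ - τ * τ) D≢0 dM²≡

      s = _∣_.quotient D∣M

      ds²≡ : δ * (s * s) ≡ + 4 * δ - τ * τ
      ds²≡ = *-cancelʳ-≡ _ _ (D * D) {{≢-nonZero (*-≢0 D≢0 D≢0)}} (trans (lemma δ s D)
        (trans (cong (λ z → δ * (z * z)) (sym (_∣_.equality D∣M))) dM²≡))
        where
        lemma : ∀ δ s D → δ * (s * s) * (D * D) ≡ δ * (s * D * (s * D))
        lemma = solve-∀

      d∣τ : δ ∣ τ
      -- Here d itself serves as the denominator: τ² = d (4 - s²) is rewritten as d τ² = (4 - s²)
      -- d².
      d∣τ = root squarefree τ δ (+ 4 - s * s) δ≢0 (combine₁ δ ds²≡ (lemma δ s τ))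
        where
        lemma : ∀ δ s τ → δ * (τ * τ) - (+ 4 - s * s) * (δ * δ) ≡ δ * (δ * (s * s) - (+ 4 * δ - τ * τ))
        lemma = solve-∀

      t = _∣_.quotient d∣τ

      τ≡td : τ ≡ t * δ
      τ≡td = _∣_.equality d∣τ

    -- In the basis u, v multiplication by √d is symmetric for the length form; its
    -- off-diagonal entries b, c satisfy b + c = t d, and then (s, t) solves this equation.
    norm-equation : s * s + δ * (t * t) ≡ + 4
    norm-equation = cancelˡ δ≢0 (combine₂ 1ℤ (- (τ + t * δ)) ds²≡ τ≡td (lemma δ s t τ))
      where
      lemma : ∀ δ s t τ → δ * (s * s + δ * (t * t)) - δ * + 4 ≡ 1ℤ * (δ * (s * s) - (+ 4 * δ - τ * τ)) + - (τ + t * δ) * (τ - t * δ)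
      lemma = solve-∀

    tD : t * D ≡ + 2 * (Y′ * Y′ - Y * Y)
    tD = cancelˡ δ≢0 (combine₂ 1ℤ (- D) τD τ≡td (lemma δ t τ D (Y′ * Y′ - Y * Y)))
      where
      lemma : ∀ δ t τ D y → δ * (t * D) - δ * (+ 2 * y) ≡ 1ℤ * (τ * D - + 2 * δ * y) + - D * (τ - t * δ)
      lemma = solve-∀

    -- Self-adjointness of multiplication by √d, combined with its trace 0: a h + b m = ⟨√d u , v⟩ =
    -- ⟨u , √d v⟩ = c m - a h.
    symmetric : + 2 * (a * h) ≡ (c - b) * m
    symmetric = cancelˡ D≢0 (combine₃ (+ 2 * h) (- m) m aD cD bD (lemma₁ a b c D h m _ _ _) ∙ lemma₂)
      where
      lemma₁ : ∀ a b c D h m x y z → D * (+ 2 * (a * h)) - (D * ((c - b) * m) + (+ 2 * h * x - m * y + m * z)) ≡ + 2 * h * (a * D - x) + - m * (c * D - y) + m * (b * D - z)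
      lemma₁ = solve-∀
      _∙_ = trans
      lemma₂ : D * ((c - b) * m) + (+ 2 * h * (δ * (Y * Y′) - X * X′) - m * (δ * (Y′ * Y′) - X′ * X′) + m * (X * X - δ * (Y * Y))) ≡ D * ((c - b) * m)
      lemma₂ = combine₁ (X * X - δ * (Y * Y)) same-length (lemma X Y X′ Y′ δ (D * ((c - b) * m)))
        where
        lemma : ∀ X Y X′ Y′ δ e → e + (+ 2 * (X * X′ + δ * (Y * Y′)) * (δ * (Y * Y′) - X * X′) - (X * X + δ * (Y * Y)) * (δ * (Y′ * Y′) - X′ * X′) + (X * X + δ * (Y * Y)) * (X * X - δ * (Y * Y))) - e ≡ (X * X - δ * (Y * Y)) * (X * X + δ * (Y * Y) - (X′ * X′ + δ * (Y′ * Y′)))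
        lemma = solve-∀

    private
      1≤⇒≡1 : ∀ {y} → 1ℤ ≤ y → ¬ (+ 2 ≤ y) → y ≡ 1ℤ
      1≤⇒≡1 1≤y 2≰y = ≤-antisym (i<j⇒i≤pred[j] (≰⇒> 2≰y)) 1≤y

      determinant : a * a + b * c ≡ δ
      determinant = cancelˡ (*-≢0 D≢0 D≢0) (trans (lemma₁ a b c D) (trans (cong₂ _+_ (cong (λ z → z * z) aD) (cong₂ _*_ bD cD))
        (lemma₂ X Y X′ Y′ δ)))
        where
        lemma₁ : ∀ a b c D → D * D * (a * a + b * c) ≡ a * D * (a * D) + b * D * (c * D)
        lemma₁ = solve-∀
        lemma₂ : ∀ X Y X′ Y′ δ → (δ * (Y * Y′) - X * X′) * (δ * (Y * Y′) - X * X′) + (X * X - δ * (Y * Y)) * (δ * (Y′ * Y′) - X′ * X′) ≡ (X * Y′ - X′ * Y) * (X * Y′ - X′ * Y) * δ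
        lemma₂ = solve-∀

    -- As d ≥ 3 and d ≠ 4, `norm-equation` leaves only t² = s² = 1, so d = 3. Then (c - b)² = (b +
    -- c)² - 4 b c = 4 a² - 3, and `symmetric` turns this into 4 a² (m² - h²) = 3 m². From 4 h² ≤ m²
    -- follows a² ≤ 1; a = 0 is impossible, so a² = 1 and 4 h² = m².
    hexagonal : t ≢ 0ℤ → t * t ≡ 1ℤ × (+ 2 * h ≡ m ⊎ + 2 * h ≡ - m)
    hexagonal t≢0 = t²≡1 , i²≡j²⇒i≡±j 4h²≡m²
      where
      t²≡1 : t * t ≡ 1ℤ
      t²≡1 = 1≤⇒≡1 (1≤i² t≢0) λ 2≤t² → contradiction
        (0≤+ (0≤+ (0≤i² s) (0≤i*j {δ - + 3} (i≤j⇒0≤j-i 3≤d) (0≤i² t))) (0≤i*j {+ 3} (+≤+ ℕ.z≤n) (i≤j⇒0≤j-i 2≤t²)))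
        (subst (λ z → ¬ (0ℤ ≤ z)) (sym (combine₁ {b = -[1+ 1 ]} 1ℤ norm-equation (lemma δ s t))) λ ())
        where
        lemma : ∀ δ s t → s * s + (δ - + 3) * (t * t) + + 3 * (t * t - + 2) - - + 2 ≡ 1ℤ * (s * s + δ * (t * t) - + 4)
        lemma = solve-∀
      s²+δ≡4 : s * s + δ ≡ + 4
      s²+δ≡4 = combine₂ 1ℤ (- δ) norm-equation t²≡1 (lemma s δ t)
        where
        lemma : ∀ s δ t → s * s + δ - + 4 ≡ 1ℤ * (s * s + δ * (t * t) - + 4) + - δ * (t * t - 1ℤ)
        lemma = solve-∀
      s≢0 : s ≢ 0ℤ
      s≢0 s≡0 = d≢4 (trans (sym (+-identityˡ δ)) (trans (cong (λ z → z * z + δ) (sym s≡0)) s²+δ≡4))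
      s²≡1 : s * s ≡ 1ℤ
      s²≡1 = 1≤⇒≡1 (1≤i² s≢0) λ 2≤s² → contradiction (0≤+ (i≤j⇒0≤j-i 3≤d) (i≤j⇒0≤j-i 2≤s²))
        (subst (λ z → ¬ (0ℤ ≤ z)) (sym (combine₁ {b = -1ℤ} 1ℤ s²+δ≡4 (lemma s δ))) λ ())
        where
        lemma : ∀ s δ → δ - + 3 + (s * s - + 2) - - 1ℤ ≡ 1ℤ * (s * s + δ - + 4)
        lemma = solve-∀
      [c-b]² : (c - b) * (c - b) ≡ + 4 * (a * a) - + 3
      [c-b]² = combine₁ (- + 4) determinant (lemma₀ a b c δ) ∙ combine₃ 1ℤ (- 1ℤ) (1ℤ - δ) ds²≡ s²+δ≡4 s²≡1 (lemma a τ δ s)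
        where
        _∙_ = trans
        lemma₀ : ∀ a b c δ → (c - b) * (c - b) - ((b + c) * (b + c) - + 4 * δ + + 4 * (a * a)) ≡ - + 4 * (a * a + b * c - δ)
        lemma₀ = solve-∀
        lemma : ∀ a τ δ s → τ * τ - + 4 * δ + + 4 * (a * a) - (+ 4 * (a * a) - + 3) ≡ 1ℤ * (δ * (s * s) - (+ 4 * δ - τ * τ)) + - 1ℤ * (s * s + δ - + 4) + (1ℤ - δ) * (s * s - 1ℤ)
        lemma = solve-∀
      4a²h² : + 4 * (a * a) * (h * h) ≡ (+ 4 * (a * a) - + 3) * (m * m)
      4a²h² = trans (lemma₁ a h) (trans (cong (λ z → z * z) symmetric) (trans (lemma₂ (c - b) m) (cong (_* (m * m)) [c-b]²)))
        where
        lemma₁ : ∀ a h → + 4 * (a * a) * (h * h) ≡ + 2 * (a * h) * (+ 2 * (a * h))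
        lemma₁ = solve-∀
        lemma₂ : ∀ x m → x * m * (x * m) ≡ x * x * (m * m)
        lemma₂ = solve-∀
      0<m² : 0ℤ < m * m
      0<m² = 0<i*j 0<m 0<m
      a≢0 : a ≢ 0ℤ
      a≢0 a≡0 = <⇒≢ (0<i*j {+ 3} (+<+ (ℕ.s≤s ℕ.z≤n)) 0<m²) (combine₂ (+ 4 * a * (h * h) - + 4 * a * (m * m)) -1ℤ a≡0 4a²h² (lemma a h m))
        where
        lemma : ∀ a h m → 0ℤ - + 3 * (m * m) ≡ (+ 4 * a * (h * h) - + 4 * a * (m * m)) * (a - 0ℤ) + -1ℤ * (+ 4 * (a * a) * (h * h) - (+ 4 * (a * a) - + 3) * (m * m))
        lemma = solve-∀
      a²≡1 : a * a ≡ 1ℤ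
      a²≡1 = 1≤⇒≡1 (1≤i² a≢0) λ 2≤a² → <⇒≱ (0<i*j {+ 3} (+<+ (ℕ.s≤s ℕ.z≤n)) 0<m²) (0≤i-j⇒j≤i (subst (0ℤ ≤_)
        (sym (combine₁ 1ℤ 4a²h² (lemma (a * a) h m)))
        (0≤+ (0≤i*j (0≤i² a) (0≤i*j 0≤m-2h 0≤m+2h)) (0≤i*j {+ 3} (+≤+ ℕ.z≤n) (0≤i*j (i≤j⇒0≤j-i 2≤a²) (<⇒≤ 0<m²))))))
        where
        lemma : ∀ a² h m → 0ℤ - + 3 * (m * m) - (a² * ((m - + 2 * h) * (m + + 2 * h)) + + 3 * ((a² - + 2) * (m * m))) ≡ 1ℤ * (+ 4 * a² * (h * h) - (+ 4 * a² - + 3) * (m * m))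
        lemma = solve-∀
      4h²≡m² : + 2 * h * (+ 2 * h) ≡ m * m
      4h²≡m² = combine₂ 1ℤ (+ 4 * (m * m) - + 4 * (h * h)) 4a²h² a²≡1 (lemma (a * a) h m)
        where
        lemma : ∀ a² h m → + 2 * h * (+ 2 * h) - m * m ≡ 1ℤ * (+ 4 * a² * (h * h) - (+ 4 * a² - + 3) * (m * m)) + (+ 4 * (m * m) - + 4 * (h * h)) * (a² - 1ℤ)
        lemma = solve-∀

    -- The second case keeps the sign `t` and its relation to `D`, since the contradiction in the
    -- hexagon comes from comparing the signs of three pairs.
    Dichotomy : Set
    Dichotomy = Y′ * Y′ ≡ Y * Y ⊎ (∃[ t ] (t ≡ 1ℤ ⊎ t ≡ -1ℤ) × t * D ≡ + 2 * (Y′ * Y′ - Y * Y)) × (+ 2 * h ≡ m ⊎ + 2 * h ≡ - m)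

    dichotomy : Dichotomy
    dichotomy = split (t ≟ 0ℤ)
      where
      equal : t ≡ 0ℤ → Y′ * Y′ ≡ Y * Y
      equal t≡0 = cancelˡ {+ 2} (λ ()) (combine₂ (- 1ℤ) D tD t≡0 (lemma t D (Y * Y) (Y′ * Y′)))
        where
        lemma : ∀ t D y y′ → + 2 * y′ - + 2 * y ≡ - 1ℤ * (t * D - + 2 * (y′ - y)) + D * (t - 0ℤ)
        lemma = solve-∀
      split : Dec (t ≡ 0ℤ) → Dichotomy
      split (yes t≡0) = inj₁ (equal t≡0)
      split (no t≢0) = inj₂ ((t , i²≡j²⇒i≡±j {t} {1ℤ} (proj₁ (hexagonal t≢0)) , tD) , proj₂ (hexagonal t≢0))

  private
    -- A matter of parity: a sum of two units is even.
    unit-sum : ∀ {t₁ t₂ t₃} → t₁ ≡ 1ℤ ⊎ t₁ ≡ -1ℤ → t₂ ≡ 1ℤ ⊎ t₂ ≡ -1ℤ → t₃ ≡ 1ℤ ⊎ t₃ ≡ -1ℤ → t₁ ≢ t₂ + t₃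
    unit-sum (inj₁ refl) (inj₁ refl) (inj₁ refl) ()
    unit-sum (inj₁ refl) (inj₁ refl) (inj₂ refl) ()
    unit-sum (inj₁ refl) (inj₂ refl) (inj₁ refl) ()
    unit-sum (inj₁ refl) (inj₂ refl) (inj₂ refl) ()
    unit-sum (inj₂ refl) (inj₁ refl) (inj₁ refl) ()
    unit-sum (inj₂ refl) (inj₁ refl) (inj₂ refl) ()
    unit-sum (inj₂ refl) (inj₂ refl) (inj₁ refl) ()
    unit-sum (inj₂ refl) (inj₂ refl) (inj₂ refl) ()

  -- `J X (- Y)` places ū in the lattice, where it has the same length as u; the two nonvanishing
  -- conditions make u and ū independent.
  Symmetric : Set
  Symmetric = ∃[ X ] ∃[ Y ] (Minimal X Y × J X (- Y) × X ≢ 0ℤ × Y ≢ 0ℤ)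

  -- Equal imaginary parts up to sign force v = ±ū.
  symmetric-pair : ∀ {X Y X′ Y′} → Minimal X Y → Minimal X′ Y′ → det X Y X′ Y′ ≢ 0ℤ → Y′ * Y′ ≡ Y * Y → Symmetric
  symmetric-pair {X} {Y} {X′} {Y′} u-min v-min D≢0 Y′²≡Y² = X , Y , u-min , conjugate , X≢0 , Y≢0
    where
    X′²≡X² : X′ * X′ ≡ X * X
    X′²≡X² = combine₂ (- 1ℤ) (- δ) (Pair.same-length u-min v-min D≢0) Y′²≡Y² (lemma δ X X′ (Y * Y) (Y′ * Y′))
      where
      lemma : ∀ δ X X′ y y′ → X′ * X′ - X * X ≡ - 1ℤ * (X * X + δ * y - (X′ * X′ + δ * y′)) + - δ * (y′ - y)
      lemma = solve-∀
    X≢0 : X ≢ 0ℤ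
    X≢0 refl = D≢0 (trans (cong (λ z → 0ℤ * Y′ - z * Y) (i²≡0⇒i≡0 {X′} X′²≡X²)) (lemma Y Y′))
      where
      lemma : ∀ Y Y′ → 0ℤ * Y′ - 0ℤ * Y ≡ 0ℤ
      lemma = solve-∀
    Y≢0 : Y ≢ 0ℤ
    Y≢0 refl = D≢0 (trans (cong (λ z → X * z - X′ * 0ℤ) (i²≡0⇒i≡0 {Y′} Y′²≡Y²)) (lemma X X′))
      where
      lemma : ∀ X X′ → X * 0ℤ - X′ * 0ℤ ≡ 0ℤ
      lemma = solve-∀
    lemma : ∀ X Y → X * - Y - - X * Y ≡ 0ℤ
    lemma = solve-∀
    choose : X′ ≡ X ⊎ X′ ≡ - X → Y′ ≡ Y ⊎ Y′ ≡ - Y → J X (- Y)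
    choose (inj₁ X′≡X) (inj₁ Y′≡Y) = contradiction (trans (cong₂ (λ x y → X * y - x * Y) X′≡X Y′≡Y) (+-inverseʳ (X * Y))) D≢0
    choose (inj₁ X′≡X) (inj₂ Y′≡-Y) = subst₂ J X′≡X Y′≡-Y (proj₁ v-min)
    choose (inj₂ X′≡-X) (inj₁ Y′≡Y) = subst₂ J (trans (cong -_ X′≡-X) (neg-involutive X)) (cong -_ Y′≡Y) (J-neg (proj₁ v-min))
    choose (inj₂ X′≡-X) (inj₂ Y′≡-Y) = contradiction (trans (cong₂ (λ x y → X * y - x * Y) X′≡-X Y′≡-Y) (lemma X Y)) D≢0
    conjugate : J X (- Y)
    conjugate = choose (i²≡j²⇒i≡±j {X′} {X} X′²≡X²) (i²≡j²⇒i≡±j {Y′} {Y} Y′²≡Y²)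

  -- In a hexagonal lattice (which occurs for d = 3) the six minimal vectors cannot all fail
  -- to be symmetric: the squared imaginary parts of u, v, u - v would pairwise differ by ± D / 2.
  hexagonal-symmetric : ∀ {X Y X′ Y′} → Minimal X Y → Minimal X′ Y′ → det X Y X′ Y′ ≢ 0ℤ →
                        + 2 * (X * X′ + δ * (Y * Y′)) ≡ q X Y → Symmetric
  hexagonal-symmetric {X} {Y} {X′} {Y′} u-min v-min D≢0 2h≡m =
    choose (Pair.dichotomy u-min v-min D≢0) (Pair.dichotomy u-min w-min Duw≢0) (Pair.dichotomy w-min v-min Dwv≢0)
    where
    W Z : ℤ
    W = X + - X′
    Z = Y + - Y′
    q[w]≡m : q W Z ≡ q X Y
    q[w]≡m = combine₂ (- 1ℤ) (- 1ℤ) (Pair.same-length u-min v-min D≢0) 2h≡m (lemma X Y X′ Y′ δ)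
      where
      lemma : ∀ X Y X′ Y′ δ → (X + - X′) * (X + - X′) + δ * ((Y + - Y′) * (Y + - Y′)) - (X * X + δ * (Y * Y)) ≡ - 1ℤ * (X * X + δ * (Y * Y) - (X′ * X′ + δ * (Y′ * Y′))) + - 1ℤ * (+ 2 * (X * X′ + δ * (Y * Y′)) - (X * X + δ * (Y * Y)))
      lemma = solve-∀
    w-min : Minimal W Z
    w-min = J-+ (proj₁ u-min) (J-neg (proj₁ v-min)) , λ x y j → subst (λ k → (x ≡ 0ℤ × y ≡ 0ℤ) ⊎ k ≤ q x y) (sym q[w]≡m) (proj₂ u-min x y j)
    Duw≢0 : det X Y W Z ≢ 0ℤ
    Duw≢0 eq = D≢0 (trans (lemma X Y X′ Y′) (cong -_ eq))
      where
      lemma : ∀ X Y X′ Y′ → X * Y′ - X′ * Y ≡ - (X * (Y + - Y′) - (X + - X′) * Y)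
      lemma = solve-∀
    Dwv≢0 : det W Z X′ Y′ ≢ 0ℤ
    Dwv≢0 eq = D≢0 (trans (lemma X Y X′ Y′) eq)
      where
      lemma : ∀ X Y X′ Y′ → X * Y′ - X′ * Y ≡ (X + - X′) * Y′ - X′ * (Y + - Y′)
      lemma = solve-∀
    choose : Pair.Dichotomy u-min v-min D≢0 → Pair.Dichotomy u-min w-min Duw≢0 → Pair.Dichotomy w-min v-min Dwv≢0 → Symmetric
    choose (inj₁ eq) _ _ = symmetric-pair u-min v-min D≢0 eq
    choose (inj₂ _) (inj₁ eq) _ = symmetric-pair u-min w-min Duw≢0 eq
    choose (inj₂ _) (inj₂ _) (inj₁ eq) = symmetric-pair w-min v-min Dwv≢0 eq
    -- Y′² - Y² is the sum of Z² - Y² and Y′² - Z². With w = u - v, the determinants of (u , w) and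
    -- (w , v) are - D and D, so t₁ = - t₂ + t₃.
    choose (inj₂ ((t₁ , t₁≡±1 , eq₁) , _)) (inj₂ ((t₂ , t₂≡±1 , eq₂) , _)) (inj₂ ((t₃ , t₃≡±1 , eq₃) , _)) =
      contradiction (cancelˡ D≢0 (combine₃ 1ℤ (- 1ℤ) (- 1ℤ) eq₁ eq₂ eq₃ (lemma X Y X′ Y′ t₁ t₂ t₃)))
        (unit-sum t₁≡±1 (negate t₂≡±1) t₃≡±1)
      where
      negate : ∀ {t} → t ≡ 1ℤ ⊎ t ≡ -1ℤ → - t ≡ 1ℤ ⊎ - t ≡ -1ℤ
      negate (inj₁ refl) = inj₂ refl
      negate (inj₂ refl) = inj₁ refl
      lemma : ∀ X Y X′ Y′ t₁ t₂ t₃ → (X * Y′ - X′ * Y) * t₁ - (X * Y′ - X′ * Y) * (- t₂ + t₃) ≡ 1ℤ * (t₁ * (X * Y′ - X′ * Y) - + 2 * (Y′ * Y′ - Y * Y)) + - 1ℤ * (t₂ * (X * (Y + - Y′) - (X + - X′) * Y) - + 2 * ((Y + - Y′) * (Y + - Y′) - Y * Y)) + - 1ℤ * (t₃ * ((X + - X′) * Y′ - X′ * (Y + - Y′)) - + 2 * (Y′ * Y′ - (Y + - Y′) * (Y + - Y′)))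
      lemma = solve-∀

  -- Replacing v by - v turns an angle of 120° into one of 60°, so `hexagonal-symmetric` covers both
  -- signs.
  symmetric-minimal : ∀ {X Y X′ Y′} → Minimal X Y → Minimal X′ Y′ → det X Y X′ Y′ ≢ 0ℤ → Symmetric
  symmetric-minimal {X} {Y} {X′} {Y′} u-min v-min D≢0 = choose (Pair.dichotomy u-min v-min D≢0)
    where
    -v-min : Minimal (- X′) (- Y′)
    -v-min = J-neg (proj₁ v-min) , λ x y j → subst (λ k → (x ≡ 0ℤ × y ≡ 0ℤ) ⊎ k ≤ q x y) (even X′ Y′ δ) (proj₂ v-min x y j)
      where
      even : ∀ x y δ → x * x + δ * (y * y) ≡ - x * - x + δ * (- y * - y)
      even = solve-∀
    -D≢0 : det X Y (- X′) (- Y′) ≢ 0ℤ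
    -D≢0 eq = D≢0 (trans (lemma X Y X′ Y′) (cong -_ eq))
      where
      lemma : ∀ X Y X′ Y′ → X * Y′ - X′ * Y ≡ - (X * - Y′ - - X′ * Y)
      lemma = solve-∀
    lemma : ∀ X Y X′ Y′ δ m → + 2 * (X * - X′ + δ * (Y * - Y′)) - m ≡ - 1ℤ * (+ 2 * (X * X′ + δ * (Y * Y′)) - - m)
    lemma = solve-∀
    choose : Pair.Dichotomy u-min v-min D≢0 → Symmetric
    choose (inj₁ eq) = symmetric-pair u-min v-min D≢0 eq
    choose (inj₂ (_ , inj₁ 2h≡m)) = hexagonal-symmetric u-min v-min D≢0 2h≡m
    choose (inj₂ (_ , inj₂ 2h≡-m)) = hexagonal-symmetric u-min -v-min -D≢0 (combine₁ (- 1ℤ) 2h≡-m (lemma X Y X′ Y′ δ (q X Y)))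

  -- Ambiguous ideals are those equal to their own conjugate; here the ℤ-basis is n (j + √d) / 2 and
  -- n (j - √d) / 2.
  record Ambiguous : Set where
    field
      n i j     : ℤ
      0<n       : 0ℤ < n
      0<j       : 0ℤ < j
      0<i       : 0ℤ < i
      ij≡d      : i * j ≡ + d
      j≤3i      : j ≤ + 3 * i
      i≤3j      : i ≤ + 3 * j
      generator : J (n * j) n
      conjugate : J (n * j) (- n)
      basis     : ∀ x y → J x y → ∃[ p ] ∃[ r ] (x ≡ n * (j * (p + r)) × y ≡ n * (p - r))

  -- Writing √d u = p u + r ū and comparing coordinates gives d Y = (p + r) X and X = (p - r) Y, so
  -- p + r and p - r multiply to d. The factor 3 comes from comparing u with u + ū and u - ū, whose
  -- values under `q` are 4 X² and 4 d Y².
  positive⇒ambiguous : ∀ {X Y} → Minimal X Y → J X (- Y) → 0ℤ < X → 0ℤ < Y → Ambiguous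
  positive⇒ambiguous {X} {Y} u-min ū∈J 0<X 0<Y = record
    { n = Y ; i = i ; j = j ; 0<n = 0<Y ; 0<j = 0<j ; 0<i = 0<i ; ij≡d = ij≡δ ; j≤3i = j≤3i ; i≤3j = i≤3j
    ; generator = subst (λ z → J z Y) X≡Yj (proj₁ u-min)
    ; conjugate = subst (λ z → J z (- Y)) X≡Yj ū∈J
    ; basis = λ x y xy∈J → let (p , r , eq , eq′) = span x y xy∈J in
        p , r , trans eq (trans (cong (λ z → p * z + r * z) X≡Yj) (lemma₁ Y j p r)) , trans eq′ (lemma₂ Y p r) }
    where
    lemma₁ : ∀ Y j p r → p * (Y * j) + r * (Y * j) ≡ Y * (j * (p + r))
    lemma₁ = solve-∀
    lemma₂ : ∀ Y p r → p * Y + r * - Y ≡ Y * (p - r)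
    lemma₂ = solve-∀
    X≢0 : X ≢ 0ℤ
    X≢0 = pos⇒≢0 0<X
    Y≢0 : Y ≢ 0ℤ
    Y≢0 = pos⇒≢0 0<Y
    ū-min : Minimal X (- Y)
    ū-min = ū∈J , λ x y xy∈J → subst (λ k → (x ≡ 0ℤ × y ≡ 0ℤ) ⊎ k ≤ q x y) (even X Y δ) (proj₂ u-min x y xy∈J)
      where
      even : ∀ x y δ → x * x + δ * (y * y) ≡ x * x + δ * (- y * - y)
      even = solve-∀
    D≢0 : det X Y X (- Y) ≢ 0ℤ
    D≢0 eq = *-≢0 { - + 2} (λ ()) (*-≢0 X≢0 Y≢0) (trans (lemma X Y) eq)
      where
      lemma : ∀ X Y → - + 2 * (X * Y) ≡ X * - Y - X * Y
      lemma = solve-∀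
    span : ∀ x y → J x y → ∃[ p ] ∃[ r ] (x ≡ p * X + r * X × y ≡ p * Y + r * - Y)
    span = Pair.basis u-min ū-min D≢0
    p r i j : ℤ
    p = proj₁ (span _ _ (J-√d (proj₁ u-min)))
    r = proj₁ (proj₂ (span _ _ (J-√d (proj₁ u-min))))
    i = p + r
    j = p - r
    δY≡ : δ * Y ≡ p * X + r * X
    δY≡ = proj₁ (proj₂ (proj₂ (span _ _ (J-√d (proj₁ u-min)))))
    X≡Yj : X ≡ Y * j
    X≡Yj = trans (proj₂ (proj₂ (proj₂ (span _ _ (J-√d (proj₁ u-min)))))) (lemma₂ Y p r)
    ij≡δ : i * j ≡ δ
    ij≡δ = cancelˡ Y≢0 (combine₂ (- 1ℤ) (- (p + r)) δY≡ X≡Yj (lemma X Y p r δ))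
      where
      lemma : ∀ X Y p r δ → Y * ((p + r) * (p - r)) - Y * δ ≡ - 1ℤ * (δ * Y - (p * X + r * X)) + - (p + r) * (X - Y * (p - r))
      lemma = solve-∀
    0<j : 0ℤ < j
    0<j = *-cancelˡ-<-nonNeg Y {{nonNegative (<⇒≤ 0<Y)}} (subst₂ _<_ (sym (*-zeroʳ Y)) X≡Yj 0<X)
    0<i : 0ℤ < i
    0<i = *-cancelʳ-<-nonNeg j {{nonNegative (<⇒≤ 0<j)}} (subst₂ _<_ (sym (*-zeroˡ j)) (sym ij≡δ) 0<δ)
    minimal : ∀ x y → J x y → ¬ (x ≡ 0ℤ × y ≡ 0ℤ) → q X Y ≤ q x y
    minimal x y xy∈J ≢0 with proj₂ u-min x y xy∈J
    ... | inj₁ ≡0 = contradiction ≡0 ≢0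
    ... | inj₂ le = le
    0<Y²j : 0ℤ < Y * Y * j
    0<Y²j = 0<i*j (0<i*j 0<Y 0<Y) 0<j
    i≤3j : i ≤ + 3 * j
    i≤3j = *-cancelˡ-≤-pos _ _ (Y * Y * j) {{positive 0<Y²j}} (≤-by _ (i≤j⇒0≤j-i (minimal (X + X) (Y + - Y) (J-+ (proj₁ u-min) ū∈J)
        (λ (eq , _) → *-≢0 {+ 2} (λ ()) X≢0 (trans (double X) eq))))
      (combine₂ (- (+ 3 * (X + Y * j))) (- (Y * Y)) X≡Yj ij≡δ (lemma X Y i j δ)))
      where
      double : ∀ x → + 2 * x ≡ x + x
      double = solve-∀
      lemma : ∀ X Y i j δ → Y * Y * j * (+ 3 * j) - Y * Y * j * i - ((X + X) * (X + X) + δ * ((Y + - Y) * (Y + - Y)) - (X * X + δ * (Y * Y))) ≡ - (+ 3 * (X + Y * j)) * (X - Y * j) + - (Y * Y) * (i * j - δ)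
      lemma = solve-∀
    j≤3i : j ≤ + 3 * i
    j≤3i = *-cancelˡ-≤-pos _ _ (Y * Y * j) {{positive 0<Y²j}} (≤-by _ (i≤j⇒0≤j-i (minimal (X + - X) (Y + - - Y) (J-+ (proj₁ u-min) (J-neg ū∈J))
        (λ (_ , eq) → *-≢0 {+ 2} (λ ()) Y≢0 (trans (double Y) eq))))
      (combine₂ (X + Y * j) (+ 3 * (Y * Y)) X≡Yj ij≡δ (lemma X Y i j δ)))
      where
      double : ∀ x → + 2 * x ≡ x + - - x
      double = solve-∀
      lemma : ∀ X Y i j δ → Y * Y * j * (+ 3 * i) - Y * Y * j * j - ((X + - X) * (X + - X) + δ * ((Y + - - Y) * (Y + - - Y)) - (X * X + δ * (Y * Y))) ≡ (X + Y * j) * (X - Y * j) + + 3 * (Y * Y) * (i * j - δ)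
      lemma = solve-∀

  symmetric⇒ambiguous : Symmetric → Ambiguous
  symmetric⇒ambiguous (X , Y , w-min , w̄∈J , X≢0 , Y≢0) = positive-signs (<-cmp 0ℤ X) (<-cmp 0ℤ Y)
    where
    flip : ∀ {x y x′ y′} → J x′ y′ → q x y ≡ q x′ y′ → Minimal x y → Minimal x′ y′
    flip j eq (_ , min) = j , λ x y xy∈J → subst (λ k → (x ≡ 0ℤ × y ≡ 0ℤ) ⊎ k ≤ q x y) eq (min x y xy∈J)
    neg-neg : J (- X) Y
    neg-neg = subst (J (- X)) (neg-involutive Y) (J-neg w̄∈J)
    even₁ : ∀ x y δ → x * x + δ * (y * y) ≡ x * x + δ * (- y * - y)
    even₁ = solve-∀
    even₂ : ∀ x y δ → x * x + δ * (y * y) ≡ - x * - x + δ * (y * y)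
    even₂ = solve-∀
    even₃ : ∀ x y δ → x * x + δ * (y * y) ≡ - x * - x + δ * (- y * - y)
    even₃ = solve-∀
    positive-signs : Tri (0ℤ < X) (0ℤ ≡ X) (X < 0ℤ) → Tri (0ℤ < Y) (0ℤ ≡ Y) (Y < 0ℤ) → Ambiguous
    positive-signs (tri≈ _ X≡0 _) _ = contradiction (sym X≡0) X≢0
    positive-signs _ (tri≈ _ Y≡0 _) = contradiction (sym Y≡0) Y≢0
    positive-signs (tri< 0<X _ _) (tri< 0<Y _ _) = positive⇒ambiguous w-min w̄∈J 0<X 0<Y
    positive-signs (tri< 0<X _ _) (tri> _ _ Y<0) = positive⇒ambiguous (flip w̄∈J (even₁ X Y δ) w-min)
      (subst (J X) (sym (neg-involutive Y)) (proj₁ w-min)) 0<X (neg-mono-< Y<0)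
    positive-signs (tri> _ _ X<0) (tri< 0<Y _ _) = positive⇒ambiguous (flip neg-neg (even₂ X Y δ) w-min)
      (J-neg (proj₁ w-min)) (neg-mono-< X<0) 0<Y
    positive-signs (tri> _ _ X<0) (tri> _ _ Y<0) = positive⇒ambiguous (flip (J-neg (proj₁ w-min)) (even₃ X Y δ) w-min)
      (J-neg w̄∈J) (neg-mono-< X<0) (neg-mono-< Y<0)


  ambiguous : ∀ {X Y X′ Y′} → Minimal X Y → Minimal X′ Y′ → det X Y X′ Y′ ≢ 0ℤ → Ambiguous
  ambiguous u-min v-min D≢0 = symmetric⇒ambiguous (symmetric-minimal u-min v-min D≢0)

-- Integral bases according to d modulo 4.

module IntegralBases where
  open import Data.Nat as ℕ using (ℕ; suc)
  import Data.Nat.DivMod as ℕ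
  import Data.Nat.Divisibility as ℕ
  open import Data.Integer hiding (suc)
  open import Data.Integer.Properties
  open import Data.Integer.Tactic.RingSolver using (solve-∀)
  open import Data.Product using (∃-syntax; _×_; _,_)
  open import Data.Sum using (_⊎_; inj₁; inj₂)
  open import Relation.Binary.PropositionalEquality
  open import Relation.Nullary using (¬_; contradiction)
  open IntegerArithmetic

  odd-factors : ∀ {i j d′} → i * j ≡ + 2 * d′ + 1ℤ → (∃[ i′ ] i ≡ + 2 * i′ + 1ℤ) × (∃[ j′ ] j ≡ + 2 * j′ + 1ℤ)
  odd-factors {i} {j} {d′} eq = oddˡ i j eq (parity i) , oddˡ j i (trans (*-comm j i) eq) (parity j)
    where
    lemma : ∀ i′ j → + 2 * (i′ * j) ≡ + 2 * i′ * j
    lemma = solve-∀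
    oddˡ : ∀ i j → i * j ≡ + 2 * d′ + 1ℤ → (∃[ k ] i ≡ + 2 * k) ⊎ (∃[ k ] i ≡ + 2 * k + 1ℤ) → ∃[ k ] i ≡ + 2 * k + 1ℤ
    oddˡ i j eq (inj₂ odd) = odd
    oddˡ i j eq (inj₁ (k , i≡2k)) = contradiction (trans (lemma k j) (trans (cong (_* j) (sym i≡2k)) eq)) (even≢odd (k * j) d′)

  -- `i` and `j` are odd, so modulo 2 the even number j t² - i b² is t - b.
  same-parity : ∀ {i j d′} → i * j ≡ + 2 * d′ + 1ℤ → ∀ t b z → j * (t * t) - i * (b * b) ≡ + 2 * z →
                ∃[ p ] ∃[ r ] (t ≡ p + r × b ≡ p - r)
  same-parity {i} {j} {d′} ij t b z eq = split (parity (t - b)) (odd-factors {i} {j} {d′} ij)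
    where
    split : (∃[ k ] t - b ≡ + 2 * k) ⊎ (∃[ k ] t - b ≡ + 2 * k + 1ℤ) →
            (∃[ i′ ] i ≡ + 2 * i′ + 1ℤ) × (∃[ j′ ] j ≡ + 2 * j′ + 1ℤ) → ∃[ p ] ∃[ r ] (t ≡ p + r × b ≡ p - r)
    split (inj₁ (k , t-b≡2k)) _ = b + k , k , combine₁ 1ℤ t-b≡2k (lemma₁ t b k) , lemma₂ b k
      where
      lemma₁ : ∀ t b k → t - (b + k + k) ≡ 1ℤ * (t - b - + 2 * k)
      lemma₁ = solve-∀
      lemma₂ : ∀ b k → b ≡ b + k - k
      lemma₂ = solve-∀
    split (inj₂ (k , t-b≡)) ((i′ , i≡) , (j′ , j≡)) = contradiction
      (trans (sym eq) (trans (cong₂ (λ j i → j * (t * t) - i * (b * b)) j≡ i≡)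
        (combine₁ (t + b + + 2 * k + 1ℤ) t-b≡ (lemma t b i′ j′ k))))
      (even≢odd z (j′ * (t * t) - i′ * (b * b) + + 2 * k * k + + 2 * k + b + + 2 * k * b))
      where
      lemma : ∀ t b i′ j′ k → (+ 2 * j′ + 1ℤ) * (t * t) - (+ 2 * i′ + 1ℤ) * (b * b) - (+ 2 * (j′ * (t * t) - i′ * (b * b) + + 2 * k * k + + 2 * k + b + + 2 * k * b) + 1ℤ) ≡ (t + b + + 2 * k + 1ℤ) * (t - b - (+ 2 * k + 1ℤ))
      lemma = solve-∀

  -- The ring of integers is ℤ + ℤ ω with ω = (δ + e √d) / 2, where (δ , e) is (1 , 1) if
  -- d ≡ 1 and (0 , 2) if d ≡ 3 (mod 4).
  record IntegralBasis (d : ℕ) : Set where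
    field
      δ e ν half-d half-c : ℤ
      c : ℕ
      rhs : RHS d c
      rhs-unique : ∀ {c′} → RHS d c′ → c′ ≡ c
      0<e : 0ℤ < e
      -- The pairs (e , c) are (1 , 4) and (2 , 2); their common product lets both residues of d
      -- share one computation.
      ec≡4 : e * + c ≡ + 4
      c≡2c′ : + c ≡ + 2 * half-c
      d-odd : + d ≡ + 2 * half-d + 1ℤ
      norm-ω : δ * δ - + d * (e * e) ≡ + 4 * ν
      coordinates : ∀ x y n → x * x - + d * (y * y) ≡ + 4 * n → ∃[ a ] ∃[ b ] (x ≡ + 2 * a + δ * b × y ≡ e * b)
      -- Integrality of `P` and `Q` makes ℤ u + ℤ ū stable under ω, where u = e (j + √d) / 2.
      factors : ∀ i j → i * j ≡ + d → ∃[ P ] ∃[ Q ] (+ 2 * (P + Q) ≡ δ + i * e × + 2 * (P - Q) ≡ δ + j * e)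
    e≢0 : e ≢ 0ℤ
    e≢0 = pos⇒≢0 0<e

  private
    divMod₄ : ∀ d → + d ≡ + (d ℕ.% 4) + + 4 * + (d ℕ./ 4)
    divMod₄ d = trans (cong +_ (ℕ.m≡m%n+[m/n]*n d 4)) (trans (pos-+ (d ℕ.% 4) (d ℕ./ 4 ℕ.* 4))
      (cong (λ z → + (d ℕ.% 4) + z) (trans (pos-* (d ℕ./ 4) 4) (*-comm (+ (d ℕ./ 4)) (+ 4)))))

  basis-1mod4 : ∀ d → d ℕ.% 4 ≡ 1 → IntegralBasis d
  basis-1mod4 d d%4≡1 = record
    { δ = 1ℤ ; e = 1ℤ ; ν = - m ; half-d = + 2 * m ; half-c = + 2 ; c = 4 ; rhs = inj₂ (d%4≡1 , refl)
    ; rhs-unique = λ { (inj₁ (d%4≡3 , _)) → contradiction (trans (sym d%4≡3) d%4≡1) (λ ()) ; (inj₂ (_ , c≡4)) → c≡4 }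
    ; 0<e = +<+ (ℕ.s≤s ℕ.z≤n) ; ec≡4 = refl ; c≡2c′ = refl
    ; d-odd = trans d≡ (lemma₀ m)
    ; norm-ω = trans (cong (λ d → 1ℤ * 1ℤ - d * (1ℤ * 1ℤ)) d≡) (lemma₁ m)
    ; coordinates = λ x y n eq → coordinates x y n (trans (cong (λ d → x * x - d * (y * y)) (sym d≡)) eq) (parity (x - y))
    ; factors = λ i j ij≡d → factors i j (trans ij≡d d≡) (odd-factors {i} {j} {+ 2 * m} (trans ij≡d (trans d≡ (lemma₀ m)))) }
    where
    m : ℤ
    m = + (d ℕ./ 4)
    d≡ : + d ≡ 1ℤ + + 4 * m
    d≡ = trans (divMod₄ d) (cong (λ r → + r + + 4 * m) d%4≡1)
    lemma₀ : ∀ m → 1ℤ + + 4 * m ≡ + 2 * (+ 2 * m) + 1ℤ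
    lemma₀ = solve-∀
    lemma₁ : ∀ m → 1ℤ * 1ℤ - (1ℤ + + 4 * m) * (1ℤ * 1ℤ) ≡ + 4 * - m
    lemma₁ = solve-∀
    coordinates : ∀ x y n → x * x - (1ℤ + + 4 * m) * (y * y) ≡ + 4 * n → (∃[ k ] x - y ≡ + 2 * k) ⊎ (∃[ k ] x - y ≡ + 2 * k + 1ℤ) →
                  ∃[ a ] ∃[ b ] (x ≡ + 2 * a + 1ℤ * b × y ≡ 1ℤ * b)
    coordinates x y n _ (inj₁ (k , x-y≡2k)) = k , y , combine₁ 1ℤ x-y≡2k (lemma x y k) , sym (*-identityˡ y)
      where
      lemma : ∀ x y k → x - (+ 2 * k + 1ℤ * y) ≡ 1ℤ * (x - y - + 2 * k)
      lemma = solve-∀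
    coordinates x y n eq (inj₂ (k , x-y≡)) = contradiction (combine₂ (- 1ℤ) (x + y + + 2 * k + 1ℤ) eq x-y≡ (lemma x y k n m))
      (even≢odd (+ 2 * n) (y * (+ 2 * k + 1ℤ) + + 2 * k * k + + 2 * k - + 2 * m * y * y))
      where
      lemma : ∀ x y k n m → + 2 * (+ 2 * n) - (+ 2 * (y * (+ 2 * k + 1ℤ) + + 2 * k * k + + 2 * k - + 2 * m * y * y) + 1ℤ) ≡ - 1ℤ * (x * x - (1ℤ + + 4 * m) * (y * y) - + 4 * n) + (x + y + + 2 * k + 1ℤ) * (x - y - (+ 2 * k + 1ℤ))
      lemma = solve-∀
    factors : ∀ i j → i * j ≡ 1ℤ + + 4 * m → (∃[ i′ ] i ≡ + 2 * i′ + 1ℤ) × (∃[ j′ ] j ≡ + 2 * j′ + 1ℤ) →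
              ∃[ P ] ∃[ Q ] (+ 2 * (P + Q) ≡ 1ℤ + i * 1ℤ × + 2 * (P - Q) ≡ 1ℤ + j * 1ℤ)
    factors _ _ ij≡ ((i′ , refl) , (j′ , refl)) = 1ℤ + m - i′ * j′ , m - i′ * j′ - j′ , combine₁ -1ℤ half-sum (lemma₂ i′ j′ m) , lemma₃ i′ j′ m
      where
      lemma : ∀ i′ j′ m → + 2 * (i′ + j′) - + 2 * (+ 2 * (m - i′ * j′)) ≡ 1ℤ * ((+ 2 * i′ + 1ℤ) * (+ 2 * j′ + 1ℤ) - (1ℤ + + 4 * m))
      lemma = solve-∀
      -- i j ≡ 1 (mod 4) forces i ≡ j (mod 4), so i′ + j′ is even.
      half-sum : + 2 * (i′ + j′) ≡ + 2 * (+ 2 * (m - i′ * j′))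
      half-sum = combine₁ 1ℤ ij≡ (lemma i′ j′ m)
      lemma₂ : ∀ i′ j′ m → + 2 * (1ℤ + m - i′ * j′ + (m - i′ * j′ - j′)) - (1ℤ + (+ 2 * i′ + 1ℤ) * 1ℤ) ≡ -1ℤ * (+ 2 * (i′ + j′) - + 2 * (+ 2 * (m - i′ * j′)))
      lemma₂ = solve-∀
      lemma₃ : ∀ i′ j′ m → + 2 * (1ℤ + m - i′ * j′ - (m - i′ * j′ - j′)) ≡ 1ℤ + (+ 2 * j′ + 1ℤ) * 1ℤ
      lemma₃ = solve-∀

  basis-3mod4 : ∀ d → d ℕ.% 4 ≡ 3 → IntegralBasis d
  basis-3mod4 d d%4≡3 = record
    { δ = 0ℤ ; e = + 2 ; ν = - + d ; half-d = + 2 * m + 1ℤ ; half-c = 1ℤ ; c = 2 ; rhs = inj₁ (d%4≡3 , refl)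
    ; rhs-unique = λ { (inj₁ (_ , c≡2)) → c≡2 ; (inj₂ (d%4≡1 , _)) → contradiction (trans (sym d%4≡1) d%4≡3) (λ ()) }
    ; 0<e = +<+ (ℕ.s≤s ℕ.z≤n) ; ec≡4 = refl ; c≡2c′ = refl
    ; d-odd = d-odd
    ; norm-ω = lemma₁ (+ d)
    ; coordinates = λ x y n eq → coordinates x y n (trans (cong (λ d → x * x - d * (y * y)) (sym d≡)) eq) (parity x) (parity y)
    ; factors = λ i j ij≡d → factors i j (odd-factors {i} {j} {+ 2 * m + 1ℤ} (trans ij≡d d-odd)) }
    where
    m : ℤ
    m = + (d ℕ./ 4)
    d≡ : + d ≡ + 3 + + 4 * m
    d≡ = trans (divMod₄ d) (cong (λ r → + r + + 4 * m) d%4≡3)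
    lemma₀ : ∀ m → + 3 + + 4 * m ≡ + 2 * (+ 2 * m + 1ℤ) + 1ℤ
    lemma₀ = solve-∀
    d-odd : + d ≡ + 2 * (+ 2 * m + 1ℤ) + 1ℤ
    d-odd = trans d≡ (lemma₀ m)
    lemma₁ : ∀ d → 0ℤ * 0ℤ - d * (+ 2 * + 2) ≡ + 4 * - d
    lemma₁ = solve-∀
    -- Modulo 4 the norm condition reads x² + y² ≡ 0, which only even x and y satisfy.
    coordinates : ∀ x y n → x * x - (+ 3 + + 4 * m) * (y * y) ≡ + 4 * n → (∃[ k ] x ≡ + 2 * k) ⊎ (∃[ k ] x ≡ + 2 * k + 1ℤ) →
                  (∃[ k ] y ≡ + 2 * k) ⊎ (∃[ k ] y ≡ + 2 * k + 1ℤ) → ∃[ a ] ∃[ b ] (x ≡ + 2 * a + 0ℤ * b × y ≡ + 2 * b)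
    coordinates _ _ n _ (inj₁ (k , refl)) (inj₁ (l , refl)) = k , l , lemma k l , refl
      where
      lemma : ∀ k l → + 2 * k ≡ + 2 * k + 0ℤ * l
      lemma = solve-∀
    coordinates _ _ n eq (inj₁ (k , refl)) (inj₂ (l , refl)) = contradiction (combine₁ (- 1ℤ) eq (lemma k l n m))
      (even≢odd (+ 2 * n) (+ 2 * (k * k) - + 6 * (l * l) - + 6 * l - + 2 - + 2 * m * (+ 2 * l + 1ℤ) * (+ 2 * l + 1ℤ)))
      where
      lemma : ∀ k l n m → + 2 * (+ 2 * n) - (+ 2 * (+ 2 * (k * k) - + 6 * (l * l) - + 6 * l - + 2 - + 2 * m * (+ 2 * l + 1ℤ) * (+ 2 * l + 1ℤ)) + 1ℤ) ≡ - 1ℤ * (+ 2 * k * (+ 2 * k) - (+ 3 + + 4 * m) * ((+ 2 * l + 1ℤ) * (+ 2 * l + 1ℤ)) - + 4 * n)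
      lemma = solve-∀
    coordinates _ _ n eq (inj₂ (k , refl)) (inj₁ (l , refl)) = contradiction (combine₁ (- 1ℤ) eq (lemma k l n m))
      (even≢odd (+ 2 * n) (+ 2 * (k * k) + + 2 * k - + 6 * (l * l) - + 8 * m * (l * l)))
      where
      lemma : ∀ k l n m → + 2 * (+ 2 * n) - (+ 2 * (+ 2 * (k * k) + + 2 * k - + 6 * (l * l) - + 8 * m * (l * l)) + 1ℤ) ≡ - 1ℤ * ((+ 2 * k + 1ℤ) * (+ 2 * k + 1ℤ) - (+ 3 + + 4 * m) * (+ 2 * l * (+ 2 * l)) - + 4 * n)
      lemma = solve-∀
    -- For x and y both odd the two sides are even, and the parity clash appears only after
    -- cancelling 2.
    coordinates _ _ n eq (inj₂ (k , refl)) (inj₂ (l , refl)) = contradiction (cancelˡ {+ 2} (λ ()) (combine₁ (- 1ℤ) eq (lemma k l n m)))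
      (even≢odd n (k * k + k - + 3 * (l * l) - + 3 * l - 1ℤ - m * (+ 2 * l + 1ℤ) * (+ 2 * l + 1ℤ)))
      where
      lemma : ∀ k l n m → + 2 * (+ 2 * n) - + 2 * (+ 2 * (k * k + k - + 3 * (l * l) - + 3 * l - 1ℤ - m * (+ 2 * l + 1ℤ) * (+ 2 * l + 1ℤ)) + 1ℤ) ≡ - 1ℤ * ((+ 2 * k + 1ℤ) * (+ 2 * k + 1ℤ) - (+ 3 + + 4 * m) * ((+ 2 * l + 1ℤ) * (+ 2 * l + 1ℤ)) - + 4 * n)
      lemma = solve-∀
    factors : ∀ i j → (∃[ i′ ] i ≡ + 2 * i′ + 1ℤ) × (∃[ j′ ] j ≡ + 2 * j′ + 1ℤ) →
              ∃[ P ] ∃[ Q ] (+ 2 * (P + Q) ≡ 0ℤ + i * + 2 × + 2 * (P - Q) ≡ 0ℤ + j * + 2)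
    factors _ _ ((i′ , refl) , (j′ , refl)) = i′ + j′ + 1ℤ , i′ - j′ , lemma₂ i′ j′ , lemma₃ i′ j′
      where
      lemma₂ : ∀ i′ j′ → + 2 * (i′ + j′ + 1ℤ + (i′ - j′)) ≡ 0ℤ + (+ 2 * i′ + 1ℤ) * + 2
      lemma₂ = solve-∀
      lemma₃ : ∀ i′ j′ → + 2 * (i′ + j′ + 1ℤ - (i′ - j′)) ≡ 0ℤ + (+ 2 * j′ + 1ℤ) * + 2
      lemma₃ = solve-∀

  odd-mod-4 : ∀ d → ¬ (2 ℕ.∣ d) → d ℕ.% 4 ≡ 1 ⊎ d ℕ.% 4 ≡ 3
  odd-mod-4 d 2∤d = cases (d ℕ.% 4) refl (ℕ.m%n<n d 4)
    where
    even : ∀ k → d ℕ.% 4 ≡ 2 ℕ.* k → 2 ℕ.∣ d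
    even k eq = subst (2 ℕ.∣_) (sym (ℕ.m≡m%n+[m/n]*n d 4)) (ℕ.∣m∣n⇒∣m+n (ℕ.divides k (trans eq (ℕ.*-comm 2 k)))
      (ℕ.∣n⇒∣m*n (d ℕ./ 4) (ℕ.divides 2 refl)))
      where open import Data.Nat.Properties as ℕ using ()
    cases : ∀ r → d ℕ.% 4 ≡ r → r ℕ.< 4 → d ℕ.% 4 ≡ 1 ⊎ d ℕ.% 4 ≡ 3
    cases 0 eq _ = contradiction (even 0 eq) 2∤d
    cases 1 eq _ = inj₁ eq
    cases 2 eq _ = contradiction (even 1 eq) 2∤d
    cases 3 eq _ = inj₂ eq
    cases (suc (suc (suc (suc _)))) _ (ℕ.s≤s (ℕ.s≤s (ℕ.s≤s (ℕ.s≤s ()))))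

open IntegralBases using (IntegralBasis)

-- The ideals ℤ u + ℤ ū: principality and well-roundedness.

module AmbiguousIdeals (d : ℕ) (squarefree : Squarefree d) (B : IntegralBasis d) where
  open import Data.Integer
  open import Relation.Binary.PropositionalEquality
  open IntegralBases
  open import Data.Integer.Properties
  open import Data.Integer.Tactic.RingSolver using (solve-∀)
  open import Data.Rational as ℚ using ()
  open import Data.Product using (∃-syntax; _×_; _,_; proj₁; proj₂)
  open import Relation.Nullary using (¬_; Dec; yes; no; contradiction)
  open IntegerArithmetic
  open Coordinates
  open Field d
  open Half d
  open IntegralBasis B

  -- This is a + b ω.
  int : ℤ → ℤ → K
  int a b = half (+ 2 * a + δ * b) (e * b)

  int∈O : ∀ a b → O (int a b)
  int∈O a b = half∈O (+ 2 * a + δ * b) (e * b) (a * a + a * (δ * b) + ν * (b * b)) (combine₁ (b * b) norm-ω (lemma a b δ e ν (+ d)))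
    where
    lemma : ∀ a b δ e ν d → (+ 2 * a + δ * b) * (+ 2 * a + δ * b) - d * (e * b * (e * b)) - + 4 * (a * a + a * (δ * b) + ν * (b * b)) ≡ b * b * (δ * δ - d * (e * e) - + 4 * ν)
    lemma = solve-∀

  O⇒int : ∀ {z} → O z → ∃[ a ] ∃[ b ] z ≡ int a b
  O⇒int {z} z∈O with O⇒half squarefree z z∈O
  ... | x , y , n , z≡ , eq with coordinates x y n eq
  ...   | a , b , x≡ , y≡ = a , b , trans z≡ (cong₂ half x≡ y≡)

  O-⊕ : ∀ z w → O z → O w → O (z ⊕ w)
  O-⊕ z w z∈O w∈O = sum (O⇒int {z} z∈O) (O⇒int {w} w∈O)
    where
    lemma₁ : ∀ a b a′ b′ δ → + 2 * (a + a′) + δ * (b + b′) ≡ + 2 * a + δ * b + (+ 2 * a′ + δ * b′)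
    lemma₁ = solve-∀
    sum : ∀ {z w} → ∃[ a ] ∃[ b ] z ≡ int a b → ∃[ a ] ∃[ b ] w ≡ int a b → O (z ⊕ w)
    sum (a , b , refl) (a′ , b′ , refl) = subst O (trans (cong₂ half (lemma₁ a b a′ b′ δ) (*-distribˡ-+ e b b′)) (sym (half-⊕ _ _ _ _)))
      (int∈O (a + a′) (b + b′))

  O-⊛ : ∀ z w → O z → O w → O (z ⊛ w)
  O-⊛ z w z∈O w∈O = product (O⇒int {z} z∈O) (O⇒int {w} w∈O)
    where
    lemma₁ : ∀ a b a′ b′ δ e ν d → (+ 2 * a + δ * b) * (+ 2 * a′ + δ * b′) + d * (e * b * (e * b′)) - + 2 * (+ 2 * (a * a′ - ν * (b * b′)) + δ * (a * b′ + b * a′ + δ * (b * b′))) ≡ - (b * b′) * (δ * δ - d * (e * e) - + 4 * ν)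
    lemma₁ = solve-∀
    lemma₂ : ∀ a b a′ b′ δ e → (+ 2 * a + δ * b) * (e * b′) + e * b * (+ 2 * a′ + δ * b′) ≡ + 2 * (e * (a * b′ + b * a′ + δ * (b * b′)))
    lemma₂ = solve-∀
    product : ∀ {z w} → ∃[ a ] ∃[ b ] z ≡ int a b → ∃[ a ] ∃[ b ] w ≡ int a b → O (z ⊛ w)
    product (a , b , refl) (a′ , b′ , refl) = subst O (sym (half-⊛ _ _ _ _ _ _ (combine₁ (- (b * b′)) norm-ω (lemma₁ a b a′ b′ δ e ν (+ d))) (lemma₂ a b a′ b′ δ e)))
      (int∈O (a * a′ - ν * (b * b′)) (a * b′ + b * a′ + δ * (b * b′)))

  module Factorization (i j : ℤ) (0<i : 0ℤ < i) (0<j : 0ℤ < j) (ij≡d : i * j ≡ + d) where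

    -- ω u = P u + Q ū for u = e (j + √d) / 2.
    P Q : ℤ
    P = proj₁ (factors i j ij≡d)
    Q = proj₁ (proj₂ (factors i j ij≡d))

    P+Q : + 2 * (P + Q) ≡ δ + i * e
    P+Q = proj₁ (proj₂ (proj₂ (factors i j ij≡d)))

    P-Q : + 2 * (P - Q) ≡ δ + j * e
    P-Q = proj₂ (proj₂ (proj₂ (factors i j ij≡d)))

    opaque
      -- This is p u + r ū for u = e (j + √d) / 2.
      point : ℤ → ℤ → K
      point p r = half (e * (j * (p + r))) (e * (p - r))

    L : Subset
    L z = ∃[ p ] ∃[ r ] z ≡ point p r

    private
      j≢0 : j ≢ 0ℤ
      j≢0 = pos⇒≢0 0<j

    opaque
      unfolding point

      point≡half : ∀ p r → point p r ≡ half (e * (j * (p + r))) (e * (p - r))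
      point≡half p r = refl

      point-injective : ∀ {p r p′ r′} → point p r ≡ point p′ r′ → p ≡ p′ × r ≡ r′
      point-injective {p} {r} {p′} {r′} eq = cancelˡ {+ 2} (λ ()) (combine₂ 1ℤ 1ℤ sum difference (lemma₁ p r p′ r′)) ,
                                             cancelˡ {+ 2} (λ ()) (combine₂ 1ℤ -1ℤ sum difference (lemma₂ p r p′ r′))
        where
        sum : p + r ≡ p′ + r′
        sum = cancelˡ j≢0 (cancelˡ e≢0 (proj₁ (half-injective eq)))
        difference : p - r ≡ p′ - r′
        difference = cancelˡ e≢0 (proj₂ (half-injective eq))
        lemma₁ : ∀ p r p′ r′ → + 2 * p - + 2 * p′ ≡ 1ℤ * (p + r - (p′ + r′)) + 1ℤ * (p - r - (p′ - r′))
        lemma₁ = solve-∀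
        lemma₂ : ∀ p r p′ r′ → + 2 * r - + 2 * r′ ≡ 1ℤ * (p + r - (p′ + r′)) + -1ℤ * (p - r - (p′ - r′))
        lemma₂ = solve-∀

      point-⊕ : ∀ p r p′ r′ → point p r ⊕ point p′ r′ ≡ point (p + p′) (r + r′)
      point-⊕ p r p′ r′ = trans (half-⊕ _ _ _ _) (cong₂ half (lemma₁ e j p r p′ r′) (lemma₂ e p r p′ r′))
        where
        lemma₁ : ∀ e j p r p′ r′ → e * (j * (p + r)) + e * (j * (p′ + r′)) ≡ e * (j * (p + p′ + (r + r′)))
        lemma₁ = solve-∀
        lemma₂ : ∀ e p r p′ r′ → e * (p - r) + e * (p′ - r′) ≡ e * (p + p′ - (r + r′))
        lemma₂ = solve-∀

      point-⊝ : ∀ p r → ⊝ point p r ≡ point (- p) (- r)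
      point-⊝ p r = trans (half-⊝ _ _) (cong₂ half (lemma₁ e j p r) (lemma₂ e p r))
        where
        lemma₁ : ∀ e j p r → - (e * (j * (p + r))) ≡ e * (j * (- p + - r))
        lemma₁ = solve-∀
        lemma₂ : ∀ e p r → - (e * (p - r)) ≡ e * (- p - - r)
        lemma₂ = solve-∀

    -- The coordinates of ω (p u + r ū). Conjugating ω u = P u + Q ū and using ω̄ = δ - ω gives ω ū
    -- = - Q u + (δ - P) ū.
    ωˡ ωʳ : ℤ → ℤ → ℤ
    ωˡ p r = p * P - r * Q
    ωʳ p r = p * Q + r * (δ - P)

    opaque
      unfolding point

      int-⊛-point : ∀ a b p r → int a b ⊛ point p r ≡ point (a * p + b * ωˡ p r) (a * r + b * ωʳ p r)
      int-⊛-point a b p r = half-⊛ (+ 2 * a + δ * b) (e * b) (e * (j * (p + r))) (e * (p - r)) _ _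
        (combine₃ (- (e * b * j * (p - r))) 0ℤ (- (e * e * b * (p - r))) P+Q P-Q ij≡d (lemma₁ a b p r i j δ e P Q (+ d)))
        (combine₂ 0ℤ (- (e * b * (p + r))) P+Q P-Q (lemma₂ a b p r i j δ e P Q))
        where
        lemma₁ : ∀ a b p r i j δ e P Q d → (+ 2 * a + δ * b) * (e * (j * (p + r))) + d * (e * b * (e * (p - r))) - + 2 * (e * (j * (a * p + b * (p * P - r * Q) + (a * r + b * (p * Q + r * (δ - P)))))) ≡ - (e * b * j * (p - r)) * (+ 2 * (P + Q) - (δ + i * e)) + 0ℤ * (+ 2 * (P - Q) - (δ + j * e)) + - (e * e * b * (p - r)) * (i * j - d)
        lemma₁ = solve-∀
        lemma₂ : ∀ a b p r i j δ e P Q → (+ 2 * a + δ * b) * (e * (p - r)) + e * b * (e * (j * (p + r))) - + 2 * (e * (a * p + b * (p * P - r * Q) - (a * r + b * (p * Q + r * (δ - P))))) ≡ 0ℤ * (+ 2 * (P + Q) - (δ + i * e)) + - (e * b * (p + r)) * (+ 2 * (P - Q) - (δ + j * e))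
        lemma₂ = solve-∀

    -- N p r = j⁻¹ e⁻¹ nm (p u + r ū), which up to sign is the index of (p u + r ū) in L.
    N : ℤ → ℤ → ℤ
    N p r = (+ 2 * P - δ) * (p * r) - Q * (p * p + r * r)

    4N : ∀ p r → e * (j * ((p + r) * (p + r)) - i * ((p - r) * (p - r))) ≡ + 4 * N p r
    4N p r = combine₂ ((p - r) * (p - r)) (- ((p + r) * (p + r))) P+Q P-Q (lemma p r i j δ e P Q)
      where
      lemma : ∀ p r i j δ e P Q → e * (j * ((p + r) * (p + r)) - i * ((p - r) * (p - r))) - + 4 * ((+ 2 * P - δ) * (p * r) - Q * (p * p + r * r)) ≡ (p - r) * (p - r) * (+ 2 * (P + Q) - (δ + i * e)) + - ((p + r) * (p + r)) * (+ 2 * (P - Q) - (δ + j * e))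
      lemma = solve-∀

    norm-point : ∀ p r → e * (j * (p + r)) * (e * (j * (p + r))) - + d * (e * (p - r) * (e * (p - r))) ≡ + 4 * (e * j * N p r)
    norm-point p r = combine₂ (e * j) (e * e * ((p - r) * (p - r))) (4N p r) ij≡d (lemma p r i j e (N p r) (+ d))
      where
      lemma : ∀ p r i j e n d → e * (j * (p + r)) * (e * (j * (p + r))) - d * (e * (p - r) * (e * (p - r))) - + 4 * (e * j * n) ≡ e * j * (e * (j * ((p + r) * (p + r)) - i * ((p - r) * (p - r))) - + 4 * n) + e * e * ((p - r) * (p - r)) * (i * j - d)
      lemma = solve-∀

    opaque
      unfolding point

      point∈O : ∀ p r → O (point p r)
      point∈O p r = half∈O _ _ (e * j * N p r) (norm-point p r)

      0K≡point : 0K ≡ point 0ℤ 0ℤ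
      0K≡point = trans 0K≡half (sym (cong₂ half (lemma₁ e j) (lemma₂ e)))
        where
        lemma₁ : ∀ e j → e * (j * (0ℤ + 0ℤ)) ≡ 0ℤ
        lemma₁ = solve-∀
        lemma₂ : ∀ e → e * (0ℤ - 0ℤ) ≡ 0ℤ
        lemma₂ = solve-∀

    point≡0⇒ : ∀ {p r} → point p r ≡ 0K → p ≡ 0ℤ × r ≡ 0ℤ
    point≡0⇒ eq = point-injective (trans eq 0K≡point)

    L-isIdeal : IsIdeal L
    L-isIdeal = record
      { ⊆O = λ { _ (p , r , refl) → point∈O p r }
      ; zero∈ = 0ℤ , 0ℤ , 0K≡point
      ; ⊕-closed = λ { _ _ (p , r , refl) (p′ , r′ , refl) → _ , _ , point-⊕ p r p′ r′ }
      ; ⊝-closed = λ { _ (p , r , refl) → _ , _ , point-⊝ p r }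
      ; ⊛-closed = λ { z _ z∈O (p , r , refl) → closed z p r (O⇒int z∈O) }
      ; nonzero = point 1ℤ 0ℤ , (1ℤ , 0ℤ , refl) , λ eq → 1≢0 (proj₁ (point≡0⇒ eq))
      }
      where
      1≢0 : 1ℤ ≢ 0ℤ
      1≢0 ()
      closed : ∀ z p r → (∃[ a ] ∃[ b ] z ≡ int a b) → (z ⊛ point p r) ∈ L
      closed _ p r (a , b , refl) = _ , _ , int-⊛-point a b p r

    -- The rows are the coordinates of z = p u + r ū and ω z, which span the principal ideal of z
    -- over ℤ.
    determinant : ∀ p r → p * ωʳ p r - ωˡ p r * r ≡ - N p r
    determinant p r = lemma p r P Q δ
      where
      lemma : ∀ p r P Q δ → p * (p * Q + r * (δ - P)) - (p * P - r * Q) * r ≡ - ((+ 2 * P - δ) * (p * r) - Q * (p * p + r * r))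
      lemma = solve-∀

    -- The coefficients of `β` and `β′` in the basis 1, ω form an integral inverse of the matrix
    -- with rows z and ω z, so the determinant - N of the latter is a unit.
    principal⇒unit : ∀ p r → (∃[ β ] (O β × point 1ℤ 0ℤ ≡ point p r ⊛ β)) → (∃[ β ] (O β × point 0ℤ 1ℤ ≡ point p r ⊛ β)) →
                     N p r * N p r ≡ 1ℤ
    principal⇒unit p r (β , β∈O , u≡) (β′ , β′∈O , ū≡) = result (O⇒int β∈O) (O⇒int β′∈O)
      where
      times : ∀ {γ p′ r′} a b → point p′ r′ ≡ point p r ⊛ γ → γ ≡ int a b → p′ ≡ a * p + b * ωˡ p r × r′ ≡ a * r + b * ωʳ p r
      times a b eq refl = point-injective (trans eq (trans (⊛-comm (point p r) (int a b)) (int-⊛-point a b p r)))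
      result : (∃[ a ] ∃[ b ] β ≡ int a b) → (∃[ a ] ∃[ b ] β′ ≡ int a b) → N p r * N p r ≡ 1ℤ
      result (a , b , β≡) (a′ , b′ , β′≡) = unit (times a b u≡ β≡) (times a′ b′ ū≡ β′≡)
        where
        unit : 1ℤ ≡ a * p + b * ωˡ p r × 0ℤ ≡ a * r + b * ωʳ p r → 0ℤ ≡ a′ * p + b′ * ωˡ p r × 1ℤ ≡ a′ * r + b′ * ωʳ p r → N p r * N p r ≡ 1ℤ
        unit (eq₁ , eq₂) (eq₃ , eq₄) = trans (sym (neg-square (N p r))) (trans (cong (λ z → z * z) (sym (determinant p r)))
            (unit-square (a * b′ - a′ * b) (p * ωʳ p r - ωˡ p r * r) (trans (lemma a b a′ b′ p r (ωˡ p r) (ωʳ p r))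
              (cong₂ _-_ (cong₂ _*_ (sym eq₁) (sym eq₄)) (cong₂ _*_ (sym eq₂) (sym eq₃))))))
          where
          neg-square : ∀ n → - n * - n ≡ n * n
          neg-square = solve-∀
          lemma : ∀ a b a′ b′ p r p₁ r₁ → (a * b′ - a′ * b) * (p * r₁ - p₁ * r) ≡ (a * p + b * p₁) * (a′ * r + b′ * r₁) - (a * r + b * r₁) * (a′ * p + b′ * p₁)
          lemma = solve-∀

    unit⇒principal : ∀ p r → N p r * N p r ≡ 1ℤ → IsPrincipal L
    unit⇒principal p r unit = point p r , divisible , λ β β∈O → multiple β (O⇒int β∈O)
      where
      multiple : ∀ β → (∃[ a ] ∃[ b ] β ≡ int a b) → (point p r ⊛ β) ∈ L
      multiple _ (a , b , refl) = _ , _ , trans (⊛-comm (point p r) (int a b)) (int-⊛-point a b p r)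
      n : ℤ
      n = N p r
      divisible : ∀ x → x ∈ L → ∃[ β ] (O β × x ≡ point p r ⊛ β)
      divisible _ (s , t , refl) = int a b , int∈O a b , sym (trans (⊛-comm (point p r) (int a b)) (trans (int-⊛-point a b p r) (cong₂ point eq₁ eq₂)))
        where
        a b : ℤ
        -- Cramer's rule: since N² = 1, dividing by the determinant - N is multiplying by - N.
        a = - n * (s * ωʳ p r - t * ωˡ p r)
        b = - n * (p * t - r * s)
        lemma₁ : ∀ p r p′ r′ s t n → - n * (s * r′ - t * p′) * p + - n * (p * t - r * s) * p′ - s ≡ - (n * s) * (p * r′ - p′ * r - - n) + s * (n * n - 1ℤ)
        lemma₁ = solve-∀
        lemma₂ : ∀ p r p′ r′ s t n → - n * (s * r′ - t * p′) * r + - n * (p * t - r * s) * r′ - t ≡ - (n * t) * (p * r′ - p′ * r - - n) + t * (n * n - 1ℤ)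
        lemma₂ = solve-∀
        eq₁ : a * p + b * ωˡ p r ≡ s
        eq₁ = combine₂ (- (n * s)) s (determinant p r) unit (lemma₁ p r (ωˡ p r) (ωʳ p r) s t n)
        eq₂ : a * r + b * ωʳ p r ≡ t
        eq₂ = combine₂ (- (n * t)) t (determinant p r) unit (lemma₂ p r (ωˡ p r) (ωʳ p r) s t n)

    point-independent : ∀ p r p′ r′ → r * p′ ≢ p * r′ → Independent (point p r) (point p′ r′)
    point-independent p r p′ r′ rp′≢pr′ eq = rp′≢pr′ (cancelˡ (*-≢0 {+ 2} (λ ()) (*-≢0 (*-≢0 e≢0 e≢0) j≢0))
      (combine₁ 1ℤ (det-half (e * (j * (p + r))) (e * (p - r)) (e * (j * (p′ + r′))) (e * (p′ - r′))
        (subst₂ (λ z w → re z ℚ.* im w ≡ im z ℚ.* re w) (point≡half p r) (point≡half p′ r′) eq)) (lemma e j p r p′ r′)))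
      where
      lemma : ∀ e j p r p′ r′ → + 2 * (e * e * j) * (r * p′) - + 2 * (e * e * j) * (p * r′) ≡ 1ℤ * (e * (j * (p + r)) * (e * (p′ - r′)) - e * (p - r) * (e * (j * (p′ + r′))))
      lemma = solve-∀

    well-rounded : i ≤ + 3 * j → j ≤ + 3 * i → IsWR L
    well-rounded i≤3j j≤3i = point 1ℤ 0ℤ , point 0ℤ 1ℤ , minimal 1ℤ 0ℤ (λ ()) refl refl , minimal 0ℤ 1ℤ (λ ()) refl refl , point-independent 1ℤ 0ℤ 0ℤ 1ℤ (λ ())
      where
      length : ℤ → ℤ → ℤ
      length p r = (i + j) * (p * p + r * r) + + 2 * (j - i) * (p * r)
      scaled : ∀ p r → e * (j * (p + r)) * (e * (j * (p + r))) + + d * (e * (p - r) * (e * (p - r))) ≡ e * e * j * length p r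
      scaled p r = combine₁ (- (e * e * ((p - r) * (p - r)))) ij≡d (lemma p r i j e (+ d))
        where
        lemma : ∀ p r i j e d → e * (j * (p + r)) * (e * (j * (p + r))) + d * (e * (p - r) * (e * (p - r))) - e * e * j * ((i + j) * (p * p + r * r) + + 2 * (j - i) * (p * r)) ≡ - (e * e * ((p - r) * (p - r))) * (i * j - d)
        lemma = solve-∀
      0≤i+j : 0ℤ ≤ i + j
      0≤i+j = 0≤+ (<⇒≤ 0<i) (<⇒≤ 0<j)
      -- On the axes the form is i + j times a square. Off the axes `lemma` writes the excess as a
      -- sum of squares with coefficients 3 j - i, 3 i - j and i + j, which is where the two ratio
      -- hypotheses enter.
      bound : ∀ p r → ¬ (p ≡ 0ℤ × r ≡ 0ℤ) → i + j ≤ length p r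
      bound p r ≢0 = split (p ≟ 0ℤ) (r ≟ 0ℤ)
        where
        lemma : ∀ i j p r → + 4 * ((i + j) * (p * p + r * r) + + 2 * (j - i) * (p * r)) - + 4 * (i + j) ≡ (+ 3 * j - i) * ((p + r) * (p + r)) + (+ 3 * i - j) * ((p - r) * (p - r)) + + 2 * (i + j) * (p * p - 1ℤ + (r * r - 1ℤ))
        lemma = solve-∀
        lemmaˡ : ∀ i j p r → (i + j) * (p * p + r * r) + + 2 * (j - i) * (p * r) - (i + j + (i + j) * (r * r - 1ℤ)) ≡ ((i + j) * p + + 2 * (j - i) * r) * (p - 0ℤ)
        lemmaˡ = solve-∀
        lemmaʳ : ∀ i j p r → (i + j) * (p * p + r * r) + + 2 * (j - i) * (p * r) - (i + j + (i + j) * (p * p - 1ℤ)) ≡ ((i + j) * r + + 2 * (j - i) * p) * (r - 0ℤ)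
        lemmaʳ = solve-∀
        larger : ∀ {k x} → x ≢ 0ℤ → k ≡ i + j + (i + j) * (x * x - 1ℤ) → i + j ≤ k
        larger {x = x} x≢0 refl = i≤i+j (i + j) ((i + j) * (x * x - 1ℤ)) {{nonNegative (0≤i*j {i + j} 0≤i+j (i≤j⇒0≤j-i (1≤i² x≢0)))}}
        split : Dec (p ≡ 0ℤ) → Dec (r ≡ 0ℤ) → i + j ≤ length p r
        split (yes p≡0) (yes r≡0) = contradiction (p≡0 , r≡0) ≢0
        split (yes p≡0) (no r≢0) = larger r≢0 (combine₁ ((i + j) * p + + 2 * (j - i) * r) p≡0 (lemmaˡ i j p r))
        split (no p≢0) (yes r≡0) = larger p≢0 (combine₁ ((i + j) * r + + 2 * (j - i) * p) r≡0 (lemmaʳ i j p r))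
        split (no p≢0) (no r≢0) = *-cancelˡ-≤-pos (i + j) (length p r) (+ 4) (≤-by _ (0≤+ (0≤+
          (0≤i*j {+ 3 * j - i} (i≤j⇒0≤j-i i≤3j) (0≤i² (p + r))) (0≤i*j {+ 3 * i - j} (i≤j⇒0≤j-i j≤3i) (0≤i² (p - r))))
          (0≤i*j {+ 2 * (i + j)} (0≤i*j {+ 2} (+≤+ ℕ.z≤n) 0≤i+j) (0≤+ (i≤j⇒0≤j-i (1≤i² p≢0)) (i≤j⇒0≤j-i (1≤i² r≢0))))) (lemma i j p r))
      minimal : ∀ p r → ¬ (p ≡ 0ℤ × r ≡ 0ℤ) → p * p + r * r ≡ 1ℤ → p * r ≡ 0ℤ → IsMinimal L (point p r)
      minimal p r ≢0 p²+r²≡1 pr≡0 = (p , r , refl) , (λ eq → ≢0 (point≡0⇒ eq)) , λ { _ (s , t , refl) w≢0 →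
          subst₂ (λ z w → ‖ z ‖² ℚ.≤ ‖ w ‖²) (sym (point≡half p r)) (sym (point≡half s t)) (‖half‖²-mono (e * (j * (p + r))) (e * (p - r)) (e * (j * (s + t))) (e * (s - t)) (subst₂ _≤_ (sym (trans (scaled p r) (cong (e * e * j *_) shortest))) (sym (scaled s t))
            (*-monoˡ-≤-nonNeg (e * e * j) {{nonNegative (0≤i*j (0≤i² e) (<⇒≤ 0<j))}} (bound s t λ { (refl , refl) → w≢0 (sym 0K≡point) })))) }
        where
        shortest : length p r ≡ i + j
        shortest = trans (cong₂ (λ x y → (i + j) * x + + 2 * (j - i) * y) p²+r²≡1 pr≡0) (lemma i j)
          where
          lemma : ∀ i j → (i + j) * 1ℤ + + 2 * (j - i) * 0ℤ ≡ i + j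
          lemma = solve-∀

-- Classification of the principal well-rounded ideals.

module WellRoundedIdeals (d : ℕ) (1<d : 1 ℕ.< d) (squarefree : Squarefree d) (B : IntegralBasis d) where
  open import Data.Integer
  open import Relation.Binary.PropositionalEquality hiding (J)
  open import Relation.Nullary using (¬_; Dec; yes; no; contradiction)
  import Data.Nat.Divisibility as ℕ
  open IntegralBases
  open import Data.Nat.Properties as ℕ using ()
  open import Data.Integer.Properties
  open import Data.Integer.Tactic.RingSolver using (solve-∀)
  open import Data.Rational as ℚ using ()
  open import Data.Product using (∃-syntax; _×_; _,_; proj₁; proj₂)
  open import Data.Sum using (_⊎_; inj₁; inj₂)
  open import Relation.Binary.Definitions using (Tri; tri<; tri≈; tri>)
  open IntegerArithmetic
  open Coordinates
  open Field d
  open Half d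
  open IntegralBasis B
  open AmbiguousIdeals d squarefree B

  d≢even : ∀ k → + d ≢ + 2 * k
  d≢even k eq = even≢odd k half-d (trans (sym eq) d-odd)

  3≤d : + 3 ≤ + d
  3≤d = +≤+ (ℕ.≤∧≢⇒< 1<d λ { refl → d≢even 1ℤ refl })

  d≢4 : + d ≢ + 4
  d≢4 = d≢even (+ 2)

  -- L is spanned over ℤ by u = e (j + √d) / 2 and ū; the pair (p , r) with N p r = ±1 gives a
  -- generator p u + r ū of L.
  record Classification (I : Subset) : Set where
    field
      m i j : ℤ
      0<m : 0ℤ < m
      0<i : 0ℤ < i
      0<j : 0ℤ < j
      ij≡d : i * j ≡ + d
      i≤3j : i ≤ + 3 * j
      j≤3i : j ≤ + 3 * i
    open Factorization i j 0<i 0<j ij≡d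
    field
      multiple : I ≈ scale m L
      unit : ∃[ p ] ∃[ r ] N p r * N p r ≡ 1ℤ

  module _ {I : Subset} (I-ideal : IsIdeal I) where
    open IsIdeal I-ideal

    private
      J : ℤ → ℤ → Set
      J x y = half x y ∈ I

      J-+ : ∀ {x y x′ y′} → J x y → J x′ y′ → J (x + x′) (y + y′)
      J-+ z∈I w∈I = subst I (half-⊕ _ _ _ _) (⊕-closed _ _ z∈I w∈I)

      J-* : ∀ k {x y} → J x y → J (k * x) (k * y)
      J-* k z∈I = subst I (ι-⊛-half k _ _) (⊛-closed (ι k) _ (ι∈O k) z∈I)

      J-√d : ∀ {x y} → J x y → J (+ d * y) x
      J-√d z∈I = subst I (√d-⊛-half _ _) (⊛-closed √d _ √d∈O z∈I)

    open MinimalVectors d squarefree 3≤d d≢4 J J-+ J-* J-√d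

    minimal⇒Minimal : ∀ x y → IsMinimal I (half x y) → Minimal x y
    minimal⇒Minimal x y (z∈I , _ , shortest) = z∈I , λ x′ y′ w∈I → split x′ y′ w∈I (x′ ≟ 0ℤ) (y′ ≟ 0ℤ)
      where
      nonzero⇒≤ : ∀ x′ y′ → J x′ y′ → ¬ (x′ ≡ 0ℤ × y′ ≡ 0ℤ) → q x y ≤ q x′ y′
      nonzero⇒≤ x′ y′ w∈I ≢0 = ‖half‖²-cancel x y x′ y′ (shortest (half x′ y′) w∈I (λ w≡0 → ≢0 (half-injective (trans w≡0 0K≡half))))
      split : ∀ x′ y′ → J x′ y′ → Dec (x′ ≡ 0ℤ) → Dec (y′ ≡ 0ℤ) → (x′ ≡ 0ℤ × y′ ≡ 0ℤ) ⊎ q x y ≤ q x′ y′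
      split _ _ _ (yes x′≡0) (yes y′≡0) = inj₁ (x′≡0 , y′≡0)
      split x′ y′ w∈I (no x′≢0) _ = inj₂ (nonzero⇒≤ x′ y′ w∈I (λ (x′≡0 , _) → x′≢0 x′≡0))
      split x′ y′ w∈I _ (no y′≢0) = inj₂ (nonzero⇒≤ x′ y′ w∈I (λ (_ , y′≡0) → y′≢0 y′≡0))

    wellRounded⇒ambiguous : IsWR I → Ambiguous
    wellRounded⇒ambiguous (u , v , u-min , v-min , independent) =
      coordinates′ (O⇒half squarefree u (⊆O u (proj₁ u-min))) (O⇒half squarefree v (⊆O v (proj₁ v-min)))
      where
      coordinates′ : ∃[ x ] ∃[ y ] ∃[ n ] (u ≡ half x y × x * x - + d * (y * y) ≡ + 4 * n) →
                     ∃[ x ] ∃[ y ] ∃[ n ] (v ≡ half x y × x * x - + d * (y * y) ≡ + 4 * n) → Ambiguous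
      coordinates′ (x , y , _ , u≡ , _) (x′ , y′ , _ , v≡ , _) = ambiguous
        (minimal⇒Minimal x y (subst (IsMinimal I) u≡ u-min))
        (minimal⇒Minimal x′ y′ (subst (IsMinimal I) v≡ v-min))
        (λ det≡0 → independent (subst₂ (λ z w → re z ℚ.* im w ≡ im z ℚ.* re w) (sym u≡) (sym v≡)
          (det-half⁻¹ x y x′ y′ (trans (i-j≡0⇒i≡j (x * y′) (x′ * y) det≡0) (*-comm x′ y)))))

    module _ (A : Ambiguous) where
      open Ambiguous A

      private
        int-coordinates : ∃[ a ] ∃[ b ] half (n * j) n ≡ int a b
        int-coordinates = O⇒int (⊆O _ generator)

      -- The imaginary numerator of every algebraic integer is a multiple of `e`; for the generator
      -- of I the quotient is the integer factor relating I to `L`.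
      content : ℤ
      content = proj₁ (proj₂ int-coordinates)

      n≡e*content : n ≡ e * content
      n≡e*content = proj₂ (half-injective (proj₂ (proj₂ int-coordinates)))

      0<content : 0ℤ < content
      0<content = *-cancelˡ-<-nonNeg e {{nonNegative (<⇒≤ 0<e)}} (subst₂ _<_ (sym (*-zeroʳ e)) n≡e*content 0<n)

      open Factorization i j 0<i 0<j ij≡d

      multiple-of-point : ∀ p r → ι content ⊛ point p r ≡ half (n * (j * (p + r))) (n * (p - r))
      multiple-of-point p r = trans (cong (ι content ⊛_) (point≡half p r)) (trans (ι-⊛-half content _ _)
        (cong₂ half (factor (j * (p + r))) (factor (p - r))))
        where
        lemma : ∀ b e x → b * (e * x) ≡ e * b * x
        lemma = solve-∀
        factor : ∀ x → content * (e * x) ≡ n * x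
        factor x = trans (lemma content e x) (cong (_* x) (sym n≡e*content))

      ambiguous⇒multiple : I ≈ scale content L
      ambiguous⇒multiple z = (λ z∈I → to z∈I (O⇒half squarefree z (⊆O z z∈I))) , from
        where
        to : z ∈ I → ∃[ x ] ∃[ y ] ∃[ n ] (z ≡ half x y × x * x - + d * (y * y) ≡ + 4 * n) → z ∈ scale content L
        to z∈I (x , y , _ , z≡ , _) = span (basis x y (subst I z≡ z∈I))
          where
          span : ∃[ p ] ∃[ r ] (x ≡ n * (j * (p + r)) × y ≡ n * (p - r)) → z ∈ scale content L
          span (p , r , x≡ , y≡) = point p r , (p , r , refl) , trans z≡ (trans (cong₂ half x≡ y≡) (sym (multiple-of-point p r)))
        from : z ∈ scale content L → z ∈ I
        from (_ , (p , r , refl) , refl) = subst I (trans (cong₂ half (lemma₁ n j p r) (lemma₂ n p r)) (sym (multiple-of-point p r)))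
          (J-+ (J-* p generator) (J-* r conjugate))
          where
          lemma₁ : ∀ n j p r → p * (n * j) + r * (n * j) ≡ n * (j * (p + r))
          lemma₁ = solve-∀
          lemma₂ : ∀ n p r → p * n + r * - n ≡ n * (p - r)
          lemma₂ = solve-∀

      -- A generator of I is m z with z in `L` and m the content. Cancelling m shows that z divides
      -- u and ū, as `principal⇒unit` requires.
      principal⇒norm-equation : IsPrincipal I → ∃[ p ] ∃[ r ] N p r * N p r ≡ 1ℤ
      principal⇒norm-equation (α , divisible , multiples) = generated (proj₁ (ambiguous⇒multiple α)
          (subst I (⊛-identityʳ α) (multiples 1K 1K∈O)))
        where
        1K∈O : O 1K
        1K∈O = ι∈O 1ℤ
        generated : α ∈ scale content L → ∃[ p ] ∃[ r ] N p r * N p r ≡ 1ℤ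
        generated (_ , (p , r , refl) , α≡) = p , r , principal⇒unit p r (quotient 1ℤ 0ℤ) (quotient 0ℤ 1ℤ)
          where
          quotient : ∀ s t → ∃[ β ] (O β × point s t ≡ point p r ⊛ β)
          quotient s t = reduce (divisible (ι content ⊛ point s t) (proj₂ (ambiguous⇒multiple _) (_ , (s , t , refl) , refl)))
            where
            reduce : ∃[ β ] (O β × ι content ⊛ point s t ≡ α ⊛ β) → ∃[ β ] (O β × point s t ≡ point p r ⊛ β)
            reduce (β , β∈O , eq) = β , β∈O , ι-cancel (pos⇒≢0 0<content) (point s t) (point p r ⊛ β)
              (trans eq (trans (cong (_⊛ β) α≡) (⊛-assoc (ι content) (point p r) β)))

  classify : ∀ {I} → IsPWR I → Classification I
  classify (I-ideal , principal , wr) = record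
    { m = content I-ideal A ; i = i ; j = j ; 0<m = 0<content I-ideal A ; 0<i = 0<i ; 0<j = 0<j ; ij≡d = ij≡d
    ; i≤3j = i≤3j ; j≤3i = j≤3i
    ; multiple = ambiguous⇒multiple I-ideal A ; unit = principal⇒norm-equation I-ideal A principal }
    where
    A = wellRounded⇒ambiguous I-ideal wr
    open MinimalVectors.Ambiguous A

  -- Otherwise d = j² would be a square, and the only squarefree square is 1.
  squarefree⇒≢ : ∀ {i j} → i * j ≡ + d → i ≢ j
  squarefree⇒≢ {i} {j} ij≡d i≡j = ℕ.<⇒≢ 1<d (sym (trans (sym square) (cong (λ n → n ℕ.* n) (squarefree (∣ j ∣) (ℕ.∣-reflexive square)))))
    where
    square : ∣ j ∣ ℕ.* ∣ j ∣ ≡ d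
    square = trans (sym (abs-* j j)) (cong ∣_∣ (trans (cong (_* j) (sym i≡j)) ij≡d))

  module _ (i j : ℤ) (0<i : 0ℤ < i) (0<j : 0ℤ < j) (ij≡d : i * j ≡ + d) where
    open Factorization i j 0<i 0<j ij≡d

    unit⇒equation : ∀ p r → N p r * N p r ≡ 1ℤ →
                    j * ((p + r) * (p + r)) - i * ((p - r) * (p - r)) ≡ + c ⊎ j * ((p + r) * (p + r)) - i * ((p - r) * (p - r)) ≡ - + c
    unit⇒equation p r unit = choose (i²≡j²⇒i≡±j {N p r} {1ℤ} unit)
      where
      E : ℤ
      E = j * ((p + r) * (p + r)) - i * ((p - r) * (p - r))
      lemma : ∀ e n c → e * c * n ≡ e * (n * c)
      lemma = solve-∀
      E≡Nc : E ≡ N p r * + c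
      E≡Nc = cancelˡ e≢0 (trans (4N p r) (trans (cong (_* N p r) (sym ec≡4)) (lemma e (N p r) (+ c))))
      choose : N p r ≡ 1ℤ ⊎ N p r ≡ -1ℤ → E ≡ + c ⊎ E ≡ - + c
      choose (inj₁ N≡1) = inj₁ (trans E≡Nc (trans (cong (_* + c) N≡1) (*-identityˡ (+ c))))
      choose (inj₂ N≡-1) = inj₂ (trans E≡Nc (trans (cong (_* + c) N≡-1) (-1*i≡-i (+ c))))

    -- A solution comes from a lattice element only if ℓ = p + r and k = p - r, that is, if ℓ and k
    -- have equal parity. This is automatic, since c is even while `i` and `j` are odd.
    equation⇒unit : ∀ k ℓ → k * k * i - ℓ * ℓ * j ≡ + c ⊎ k * k * i - ℓ * ℓ * j ≡ - + c → ∃[ p ] ∃[ r ] N p r * N p r ≡ 1ℤ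
    equation⇒unit k ℓ (inj₁ eq) = split (same-parity {i} {j} {half-d} (trans ij≡d d-odd) ℓ k (- half-c) (combine₂ -1ℤ -1ℤ eq c≡2c′ (lemma k ℓ i j (+ c) half-c)))
      where
      lemma : ∀ k ℓ i j c c′ → j * (ℓ * ℓ) - i * (k * k) - + 2 * - c′ ≡ -1ℤ * (k * k * i - ℓ * ℓ * j - c) + -1ℤ * (c - + 2 * c′)
      lemma = solve-∀
      split : ∃[ p ] ∃[ r ] (ℓ ≡ p + r × k ≡ p - r) → ∃[ p ] ∃[ r ] N p r * N p r ≡ 1ℤ
      split (p , r , refl , refl) = p , r , cong (λ n → n * n) {y = -1ℤ} (cancelˡ {+ 4} (λ ()) (trans (sym (4N p r))
        (combine₂ (- e) -1ℤ eq ec≡4 (lemma′ e i j (p - r) (p + r) (+ c)))))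
        where
        lemma′ : ∀ e i j k ℓ c → e * (j * (ℓ * ℓ) - i * (k * k)) - + 4 * -1ℤ ≡ - e * (k * k * i - ℓ * ℓ * j - c) + -1ℤ * (e * c - + 4)
        lemma′ = solve-∀
    equation⇒unit k ℓ (inj₂ eq) = split (same-parity {i} {j} {half-d} (trans ij≡d d-odd) ℓ k half-c (combine₂ -1ℤ 1ℤ eq c≡2c′ (lemma k ℓ i j (+ c) half-c)))
      where
      lemma : ∀ k ℓ i j c c′ → j * (ℓ * ℓ) - i * (k * k) - + 2 * c′ ≡ -1ℤ * (k * k * i - ℓ * ℓ * j - - c) + 1ℤ * (c - + 2 * c′)
      lemma = solve-∀
      split : ∃[ p ] ∃[ r ] (ℓ ≡ p + r × k ≡ p - r) → ∃[ p ] ∃[ r ] N p r * N p r ≡ 1ℤ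
      split (p , r , refl , refl) = p , r , cong (λ n → n * n) {y = 1ℤ} (cancelˡ {+ 4} (λ ()) (trans (sym (4N p r))
        (combine₂ (- e) 1ℤ eq ec≡4 (lemma′ e i j (p - r) (p + r) (+ c)))))
        where
        lemma′ : ∀ e i j k ℓ c → e * (j * (ℓ * ℓ) - i * (k * k)) - + 4 * 1ℤ ≡ - e * (k * k * i - ℓ * ℓ * j - - c) + 1ℤ * (e * c - + 4)
        lemma′ = solve-∀

    -- `L` singles out the factor `j`, whereas a good factorization is ordered by size; this records
    -- how the two match.
    Orders : ℕ → ℕ → Set
    Orders d₁ d₂ = (+ d₁ ≡ i × + d₂ ≡ j) ⊎ (+ d₁ ≡ j × + d₂ ≡ i)

    goodFactorization : i ≤ + 3 * j → j ≤ + 3 * i → ∃[ p ] ∃[ r ] N p r * N p r ≡ 1ℤ →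
                        ∃[ d₁ ] ∃[ d₂ ] (GoodFactorization d d₁ d₂ × Orders d₁ d₂)
    goodFactorization i≤3j j≤3i (p , r , unit) = order (<-cmp i j)
      where
      +∣i∣≡i : + ∣ i ∣ ≡ i
      +∣i∣≡i = 0≤i⇒+∣i∣≡i (<⇒≤ 0<i)
      +∣j∣≡j : + ∣ j ∣ ≡ j
      +∣j∣≡j = 0≤i⇒+∣i∣≡i (<⇒≤ 0<j)
      abs-product : ∀ {x y} → x * y ≡ + d → ∣ x ∣ ℕ.* ∣ y ∣ ≡ d
      abs-product {x} {y} eq = trans (sym (abs-* x y)) (cong ∣_∣ eq)
      abs-< : ∀ {x y} → + ∣ x ∣ ≡ x → + ∣ y ∣ ≡ y → x < y → ∣ x ∣ ℕ.< ∣ y ∣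
      abs-< eq eq′ x<y = drop‿+<+ (subst₂ _<_ (sym eq) (sym eq′) x<y)
      abs-≤3* : ∀ {x y} → + ∣ x ∣ ≡ x → + ∣ y ∣ ≡ y → x ≤ + 3 * y → ∣ x ∣ ℕ.≤ 3 ℕ.* ∣ y ∣
      abs-≤3* {x} {y} eq eq′ x≤3y = drop‿+≤+ (subst₂ _≤_ (sym eq) (trans (cong (+ 3 *_) (sym eq′)) (sym (pos-* 3 (∣ y ∣)))) x≤3y)
      swap : ∀ k ℓ x y → y * (ℓ * ℓ) - x * (k * k) ≡ + c ⊎ y * (ℓ * ℓ) - x * (k * k) ≡ - + c →
             ℓ * ℓ * y - k * k * x ≡ + c ⊎ ℓ * ℓ * y - k * k * x ≡ - + c
      swap k ℓ x y (inj₁ eq) = inj₁ (trans (lemma k ℓ x y) eq)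
        where
        lemma : ∀ k ℓ x y → ℓ * ℓ * y - k * k * x ≡ y * (ℓ * ℓ) - x * (k * k)
        lemma = solve-∀
      swap k ℓ x y (inj₂ eq) = inj₂ (trans (lemma k ℓ x y) eq)
        where
        lemma : ∀ k ℓ x y → ℓ * ℓ * y - k * k * x ≡ y * (ℓ * ℓ) - x * (k * k)
        lemma = solve-∀
      negate : ∀ k ℓ x y → y * (ℓ * ℓ) - x * (k * k) ≡ + c ⊎ y * (ℓ * ℓ) - x * (k * k) ≡ - + c →
               k * k * x - ℓ * ℓ * y ≡ + c ⊎ k * k * x - ℓ * ℓ * y ≡ - + c
      negate k ℓ x y (inj₁ eq) = inj₂ (trans (lemma k ℓ x y) (cong -_ eq))
        where
        lemma : ∀ k ℓ x y → k * k * x - ℓ * ℓ * y ≡ - (y * (ℓ * ℓ) - x * (k * k))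
        lemma = solve-∀
      negate k ℓ x y (inj₂ eq) = inj₁ (trans (lemma k ℓ x y) (trans (cong -_ eq) (neg-involutive (+ c))))
        where
        lemma : ∀ k ℓ x y → k * k * x - ℓ * ℓ * y ≡ - (y * (ℓ * ℓ) - x * (k * k))
        lemma = solve-∀
      Equation : ℤ → ℤ → ℤ → ℤ → Set
      Equation x y k ℓ = k * k * y - ℓ * ℓ * x ≡ + c ⊎ k * k * y - ℓ * ℓ * x ≡ - + c
      order : Tri (i < j) (i ≡ j) (j < i) → ∃[ d₁ ] ∃[ d₂ ] (GoodFactorization d d₁ d₂ × Orders d₁ d₂)
      order (tri≈ _ i≡j _) = contradiction i≡j (squarefree⇒≢ ij≡d)
      order (tri< i<j _ _) = ∣ i ∣ , ∣ j ∣ , (abs-product {i} {j} ij≡d , drop‿+<+ (subst (0ℤ <_) (sym +∣i∣≡i) 0<i) ,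
        abs-< {i} {j} +∣i∣≡i +∣j∣≡j i<j , abs-≤3* {j} {i} +∣j∣≡j +∣i∣≡i j≤3i , c , rhs , p + r , p - r ,
        subst₂ (λ x y → Equation x y (p + r) (p - r)) (sym +∣i∣≡i) (sym +∣j∣≡j) (swap (p - r) (p + r) i j (unit⇒equation p r unit))) ,
        inj₁ (+∣i∣≡i , +∣j∣≡j)
      -- With `j` the smaller factor, p + r and p - r change roles and the sign of the right side
      -- flips.
      order (tri> _ _ j<i) = ∣ j ∣ , ∣ i ∣ , (abs-product {j} {i} (trans (*-comm j i) ij≡d) , drop‿+<+ (subst (0ℤ <_) (sym +∣j∣≡j) 0<j) ,
        abs-< {j} {i} +∣j∣≡j +∣i∣≡i j<i , abs-≤3* {i} {j} +∣i∣≡i +∣j∣≡j i≤3j , c , rhs , p - r , p + r ,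
        subst₂ (λ x y → Equation x y (p - r) (p + r)) (sym +∣j∣≡j) (sym +∣i∣≡i) (negate (p - r) (p + r) i j (unit⇒equation p r unit))) ,
        inj₂ (+∣j∣≡j , +∣i∣≡i)

  module _ {d₁ d₂} (d₁d₂≡d : d₁ ℕ.* d₂ ≡ d) where

    factor-product : + d₂ * + d₁ ≡ + d
    factor-product = trans (sym (pos-* d₂ d₁)) (cong +_ (trans (ℕ.*-comm d₂ d₁) d₁d₂≡d))

    goodFactorization⇒PWR : 0 ℕ.< d₁ → d₁ ℕ.< d₂ → d₂ ℕ.≤ 3 ℕ.* d₁ → EqSolvable d d₁ d₂ → ∃[ I ] IsPWR I
    goodFactorization⇒PWR 0<d₁ d₁<d₂ d₂≤3d₁ (c′ , rhs′ , k , ℓ , eq) = L , L-isIdeal , principal ,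
        well-rounded (subst (+ d₂ ≤_) (pos-* 3 d₁) (+≤+ d₂≤3d₁))
          (subst (+ d₁ ≤_) (pos-* 3 d₂) (+≤+ (ℕ.≤-trans (ℕ.<⇒≤ d₁<d₂) (ℕ.m≤n*m d₂ 3))))
      where
      0<d₂ : 0ℤ < + d₂
      0<d₂ = +<+ (ℕ.<-trans 0<d₁ d₁<d₂)
      open Factorization (+ d₂) (+ d₁) 0<d₂ (+<+ 0<d₁) factor-product
      principal : IsPrincipal L
      principal = generated (equation⇒unit (+ d₂) (+ d₁) 0<d₂ (+<+ 0<d₁) factor-product k ℓ
          (subst (λ n → k * k * + d₂ - ℓ * ℓ * + d₁ ≡ + n ⊎ k * k * + d₂ - ℓ * ℓ * + d₁ ≡ - + n) (rhs-unique rhs′) eq))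
        where
        generated : ∃[ p ] ∃[ r ] N p r * N p r ≡ 1ℤ → IsPrincipal L
        generated (p , r , unit) = unit⇒principal p r unit

-- Products of ramified primes.

module IdealProducts (d : ℕ) (squarefree : Squarefree d) (B : IntegralBasis d) where
  open import Data.Integer
  open import Relation.Binary.PropositionalEquality
  open IntegralBases
  open import Data.Nat.Divisibility as ℕ using ()
  open import Data.Nat.Properties as ℕ using ()
  open import Data.Nat.Primality using (Prime; euclidsLemma; ¬prime[1])
  open import Data.Integer.Properties
  open import Data.Integer.Divisibility.Signed using (_∣_; divides; ∣ᵤ⇒∣; ∣⇒∣ᵤ)
  open import Data.Integer.Tactic.RingSolver using (solve-∀)
  open import Data.List using ([]; _∷_; map)
  open import Data.List.Relation.Unary.All using (All; []; _∷_)
  open import Data.Nat.ListAction using (product)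
  open import Data.Product using (∃-syntax; _×_; _,_; proj₁; proj₂)
  open import Data.Sum using ([_,_]′)
  open import Function using (id)
  open import Relation.Nullary using (¬_; Dec; yes; no; contradiction)
  open IntegerArithmetic
  open Coordinates
  open Field d
  open Half d
  open IntegralBasis B
  open AmbiguousIdeals d squarefree B

  -- n t is the trace and n s the norm of z.  For n = e j with j ∣ d this set is the product
  -- of the ramified primes above the prime factors of n.
  TraceNorm : ℤ → Subset
  TraceNorm n z = ∃[ t ] ∃[ y ] ∃[ s ] (z ≡ half (n * t) y × n * t * (n * t) - + d * (y * y) ≡ + 4 * (n * s))

  traceNorm⊆O : ∀ n {z} → z ∈ TraceNorm n → O z
  traceNorm⊆O n (t , y , s , refl , eq) = half∈O (n * t) y (n * s) eq

  traceNorm-multiple : ∀ m n {z} → z ∈ TraceNorm (m * n) → z ∈ TraceNorm m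
  traceNorm-multiple m n (t , y , s , z≡ , eq) = n * t , y , n * s , trans z≡ (cong (λ x → half x y) (*-assoc m n t)) ,
    trans (cong (λ x → x * x - + d * (y * y)) (sym (*-assoc m n t))) (trans eq (cong (+ 4 *_) (*-assoc m n s)))

  traceNorm-comm : ∀ m n {z} → z ∈ TraceNorm (m * n) → z ∈ TraceNorm (n * m)
  traceNorm-comm m n {z} = subst (λ k → z ∈ TraceNorm k) (*-comm m n)

  ι∈traceNorm : ∀ n k → ι (k * n) ∈ TraceNorm n
  ι∈traceNorm n k = + 2 * k , 0ℤ , k * k * n , trans (ι≡half (k * n)) (cong (λ x → half x 0ℤ) (lemma₁ n k)) , lemma₂ n k (+ d)
    where
    lemma₁ : ∀ n k → + 2 * (k * n) ≡ n * (+ 2 * k)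
    lemma₁ = solve-∀
    lemma₂ : ∀ n k d → n * (+ 2 * k) * (n * (+ 2 * k)) - d * (0ℤ * 0ℤ) ≡ + 4 * (n * (k * k * n))
    lemma₂ = solve-∀

  Bézout : ℤ → ℤ → Set
  Bézout m n = ∃[ a ] ∃[ b ] a * m + b * n ≡ 1ℤ

  common-multiple : ∀ {m n} → Bézout m n → ∀ {x t t′} → x ≡ m * t → x ≡ n * t′ → ∃[ k ] x ≡ m * n * k
  -- x = a m x + b n x, with x = n t′ inserted in the first term and x = m t in the second.
  common-multiple {m} {n} (a , b , am+bn≡1) {x} {t} {t′} eq eq′ = a * t′ + b * t ,
    combine₃ (- x) (b * n) (a * m) am+bn≡1 eq eq′ (lemma a b m n x t t′)
    where
    lemma : ∀ a b m n x t t′ → x - m * n * (a * t′ + b * t) ≡ - x * (a * m + b * n - 1ℤ) + b * n * (x - m * t) + a * m * (x - n * t′)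
    lemma = solve-∀

  traceNorm-∩ : ∀ {m n} → Bézout m n → ∀ {z} → z ∈ TraceNorm m → z ∈ TraceNorm n → z ∈ TraceNorm (m * n)
  traceNorm-∩ {m} {n} bézout {z} (t , y , s , z≡ , eq) (t′ , y′ , s′ , z≡′ , eq′) =
    combined (half-injective (trans (sym z≡) z≡′))
    where
    combined : m * t ≡ n * t′ × y ≡ y′ → z ∈ TraceNorm (m * n)
    combined (x≡x′ , y≡y′) = build (common-multiple bézout {m * t} {t} {t′} refl x≡x′) (common-multiple bézout {m * s} {s} {s′} refl
        (cancelˡ {+ 4} (λ ()) (trans (sym eq) (trans (cong₂ (λ x y → x * x - + d * (y * y)) x≡x′ y≡y′) eq′))))
      where
      build : ∃[ k ] m * t ≡ m * n * k → ∃[ k ] m * s ≡ m * n * k → z ∈ TraceNorm (m * n)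
      build (k , mt≡) (l , ms≡) = k , y , l , trans z≡ (cong (λ x → half x y) mt≡) ,
        trans (cong (λ x → x * x - + d * (y * y)) (sym mt≡)) (trans eq (cong (+ 4 *_) ms≡))

  -- For `TraceNorm n` closure under addition is the delicate point, as the norm is quadratic. It is
  -- imported from a prime ideal and passes to coprime products because those are intersections.
  record Closed (S : Subset) : Set where
    field
      ⊕-closed : ∀ x y → x ∈ S → y ∈ S → (x ⊕ y) ∈ S
      ⊛-closed : ∀ r x → O r → x ∈ S → (r ⊛ x) ∈ S
  open Closed

  ≈-closed : ∀ {S T} → S ≈ T → Closed S → Closed T
  ≈-closed S≈T closed = record
    { ⊕-closed = λ x y x∈T y∈T → proj₁ (S≈T _) (⊕-closed closed x y (proj₂ (S≈T x) x∈T) (proj₂ (S≈T y) y∈T))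
    ; ⊛-closed = λ r x r∈O x∈T → proj₁ (S≈T _) (⊛-closed closed r x r∈O (proj₂ (S≈T x) x∈T)) }

  ideal-closed : ∀ {S} → IsIdeal S → Closed S
  ideal-closed ideal = record { ⊕-closed = IsIdeal.⊕-closed ideal ; ⊛-closed = IsIdeal.⊛-closed ideal }

  O-closed : Closed O
  O-closed = record { ⊕-closed = O-⊕ ; ⊛-closed = O-⊛ }

  module _ {m n} (bézout : Bézout m n) (m-closed : Closed (TraceNorm m)) (n-closed : Closed (TraceNorm n)) where

    traceNorm-closed : Closed (TraceNorm (m * n))
    traceNorm-closed = record
      { ⊕-closed = λ x y x∈ y∈ → traceNorm-∩ {m} {n} bézout
          (⊕-closed m-closed x y (traceNorm-multiple m n x∈) (traceNorm-multiple m n y∈))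
          (⊕-closed n-closed x y (traceNorm-multiple n m (traceNorm-comm m n x∈)) (traceNorm-multiple n m (traceNorm-comm m n y∈)))
      ; ⊛-closed = λ r x r∈O x∈ → traceNorm-∩ {m} {n} bézout
          (⊛-closed m-closed r x r∈O (traceNorm-multiple m n x∈))
          (⊛-closed n-closed r x r∈O (traceNorm-multiple n m (traceNorm-comm m n x∈))) }

    -- A product of elements lies in both sets, hence in their intersection. Conversely a m + b n =
    -- 1 gives z = (a m) z + z (b n), where a m lies in I, b n in J, and z in both.
    traceNorm-product : ∀ {I J} → I ≈ TraceNorm m → J ≈ TraceNorm n → (I · J) ≈ TraceNorm (m * n)
    traceNorm-product {I} {J} I≈ J≈ z = forward , backward
      where
      forward : ∀ {z} → z ∈ (I · J) → z ∈ TraceNorm (m * n)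
      forward sp-nil = 0ℤ , 0ℤ , 0ℤ , trans 0K≡half (cong (λ x → half x 0ℤ) (sym (*-zeroʳ (m * n)))) , lemma m n (+ d)
        where
        lemma : ∀ m n d → m * n * 0ℤ * (m * n * 0ℤ) - d * (0ℤ * 0ℤ) ≡ + 4 * (m * n * 0ℤ)
        lemma = solve-∀
      forward (sp-cons {a} {b} {s} a∈I b∈J s∈) = ⊕-closed traceNorm-closed (a ⊛ b) s (traceNorm-∩ {m} {n} bézout
        (subst (TraceNorm m) (⊛-comm b a) (⊛-closed m-closed b a (traceNorm⊆O n b∈) a∈))
        (⊛-closed n-closed a b (traceNorm⊆O m a∈) b∈)) (forward s∈)
        where
        a∈ : a ∈ TraceNorm m
        a∈ = proj₁ (I≈ a) a∈I
        b∈ : b ∈ TraceNorm n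
        b∈ = proj₁ (J≈ b) b∈J
      backward : z ∈ TraceNorm (m * n) → z ∈ (I · J)
      backward z∈ = split bézout z∈
        where
        split : Bézout m n → z ∈ TraceNorm (m * n) → z ∈ (I · J)
        split (a , b , am+bn≡1) (t , y , _ , z≡ , _) = subst (I · J) (trans (cong (λ z → (ι (a * m) ⊛ z) ⊕ ((z ⊛ ι (b * n)) ⊕ 0K)) z≡) (trans sum (sym z≡)))
          (sp-cons (proj₂ (I≈ _) (ι∈traceNorm m a)) (proj₂ (J≈ z) (traceNorm-multiple n m (traceNorm-comm m n z∈)))
          (sp-cons (proj₂ (I≈ z) (traceNorm-multiple m n z∈)) (proj₂ (J≈ _) (ι∈traceNorm n b)) sp-nil))
          where
          x : ℤ
          x = m * n * t
          part : ∀ v → a * m * v + (b * n * v + 0ℤ) ≡ v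
          part v = combine₁ v am+bn≡1 (lemma a b m n v)
            where
            lemma : ∀ a b m n v → a * m * v + (b * n * v + 0ℤ) - v ≡ v * (a * m + b * n - 1ℤ)
            lemma = solve-∀
          sum : (ι (a * m) ⊛ half x y) ⊕ ((half x y ⊛ ι (b * n)) ⊕ 0K) ≡ half x y
          sum = trans (cong₂ _⊕_ (ι-⊛-half (a * m) x y) (cong₂ _⊕_ (trans (⊛-comm (half x y) (ι (b * n))) (ι-⊛-half (b * n) x y)) 0K≡half))
            (trans (cong (half (a * m * x) (a * m * y) ⊕_) (half-⊕ _ _ _ _)) (trans (half-⊕ _ _ _ _) (cong₂ half (part x) (part y))))

  traceNorm-1 : O ≈ TraceNorm 1ℤ
  traceNorm-1 z = (λ z∈O → to (O⇒half squarefree z z∈O)) , traceNorm⊆O 1ℤ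
    where
    to : ∃[ x ] ∃[ y ] ∃[ n ] (z ≡ half x y × x * x - + d * (y * y) ≡ + 4 * n) → z ∈ TraceNorm 1ℤ
    to (x , y , n , z≡ , eq) = x , y , n , trans z≡ (cong (λ x → half x y) (sym (*-identityˡ x))) ,
      trans (cong (λ x → x * x - + d * (y * y)) (*-identityˡ x)) (trans eq (cong (+ 4 *_) (sym (*-identityˡ n))))

  -- Ramification enters as the property that a norm divisible by p has a trace divisible by p. The
  -- prime above p is then determined by traces and norms, hence unique.
  module _ {p} (p-prime : Prime p) {𝔓 : Subset} (above : LiesAbove 𝔓 p)
    (ramified : ∀ x y n → x * x - + d * (y * y) ≡ + 4 * n → + p ∣ n → + p ∣ x) where

    open IsPrimeIdeal (proj₁ above)
    private module 𝔓 = IsIdeal ideal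

    -- An integer n prime to p would put 1 = a p + b |n| into the prime ideal.
    integers-in-prime : ∀ n → ι n ∈ 𝔓 → + p ∣ n
    integers-in-prime n ιn∈𝔓 = decide (p ℕ.∣? ∣ n ∣)
      where
      decide : Dec (p ℕ.∣ ∣ n ∣) → + p ∣ n
      decide (yes p∣n) = ∣ᵤ⇒∣ p∣n
      decide (no p∤n) = contradiction (bézout (prime-Bézout p-prime ∣ n ∣ p∤n)) proper
        where
        multiple : ∀ a k → ι k ∈ 𝔓 → half (a * (+ 2 * k)) 0ℤ ∈ 𝔓
        multiple a k k∈ = subst 𝔓 (trans (cong (ι a ⊛_) (ι≡half k)) (trans (ι-⊛-half a (+ 2 * k) 0ℤ) (cong (half (a * (+ 2 * k))) (*-zeroʳ a))))
          (𝔓.⊛-closed (ι a) (ι k) (ι∈O a) k∈)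
        ∣n∣∈𝔓 : ι (+ ∣ n ∣) ∈ 𝔓
        ∣n∣∈𝔓 = [ (λ eq → subst (λ k → ι k ∈ 𝔓) (sym eq) ιn∈𝔓) , (λ eq → subst (λ k → ι k ∈ 𝔓) (sym eq) -ιn∈𝔓) ]′ (+∣i∣≡i⊎+∣i∣≡-i n)
          where
          lemma : ∀ n → - (+ 2 * n) ≡ + 2 * - n
          lemma = solve-∀
          -ιn∈𝔓 : ι (- n) ∈ 𝔓
          -ιn∈𝔓 = subst 𝔓 (trans (cong ⊝_ (ι≡half n)) (trans (half-⊝ _ _) (trans (cong (λ x → half x 0ℤ) (lemma n)) (sym (ι≡half (- n))))))
            (𝔓.⊝-closed (ι n) ιn∈𝔓)
        bézout : Bézout (+ p) (+ ∣ n ∣) → 1K ∈ 𝔓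
        bézout (a , b , eq) = subst 𝔓 (trans (half-⊕ _ _ _ _) (trans (cong (λ x → half x 0ℤ) (combine₁ (+ 2) eq (lemma a b (+ p) (+ ∣ n ∣)))) (sym 1K≡half)))
          (𝔓.⊕-closed _ _ (multiple a (+ p) (proj₂ above)) (multiple b (+ ∣ n ∣) ∣n∣∈𝔓))
          where
          lemma : ∀ a b p n → a * (+ 2 * p) + b * (+ 2 * n) - + 2 ≡ + 2 * (a * p + b * n - 1ℤ)
          lemma = solve-∀

    -- The norm z̄ z is an integer in the prime ideal, so p divides it; `ramified` then handles the
    -- trace.
    prime⊆traceNorm : ∀ {z} → z ∈ 𝔓 → z ∈ TraceNorm (+ p)
    prime⊆traceNorm {z} z∈𝔓 = to (O⇒half squarefree z (𝔓.⊆O z z∈𝔓))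
      where
      to : ∃[ x ] ∃[ y ] ∃[ n ] (z ≡ half x y × x * x - + d * (y * y) ≡ + 4 * n) → z ∈ TraceNorm (+ p)
      to (x , y , n , z≡ , eq) = build p∣n (ramified x y n eq p∣n)
        where
        lemma₁ : ∀ x y n d → x * x + d * (- y * y) - + 2 * (+ 2 * n) ≡ 1ℤ * (x * x - d * (y * y) - + 4 * n)
        lemma₁ = solve-∀
        lemma₂ : ∀ x y → x * y + - y * x ≡ + 2 * 0ℤ
        lemma₂ = solve-∀
        lemma₃ : ∀ x y d → x * x - d * (- y * - y) ≡ x * x - d * (y * y)
        lemma₃ = solve-∀
        z̄z : half x (- y) ⊛ half x y ≡ ι n
        z̄z = trans (half-⊛ x (- y) x y (+ 2 * n) 0ℤ (combine₁ 1ℤ eq (lemma₁ x y n (+ d))) (lemma₂ x y)) (sym (ι≡half n))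
        p∣n : + p ∣ n
        p∣n = integers-in-prime n (subst 𝔓 z̄z (𝔓.⊛-closed (half x (- y)) (half x y) (half∈O x (- y) n (trans (lemma₃ x y (+ d)) eq)) (subst 𝔓 z≡ z∈𝔓)))
        build : + p ∣ n → + p ∣ x → z ∈ TraceNorm (+ p)
        build (divides s n≡) (divides t x≡) = t , y , s , trans z≡ (cong (λ x → half x y) x≡′) ,
          trans (cong (λ x → x * x - + d * (y * y)) (sym x≡′)) (trans eq (cong (+ 4 *_) (trans n≡ (*-comm s (+ p)))))
          where
          x≡′ : x ≡ + p * t
          x≡′ = trans x≡ (*-comm t (+ p))

    -- z² = tr z · z - nm z is a multiple of p.
    traceNorm⊆prime : ∀ {z} → z ∈ TraceNorm (+ p) → z ∈ 𝔓
    traceNorm⊆prime (t , y , s , refl , eq) = [ id , id ]′ (prime z z z∈O z∈O (subst 𝔓 (sym z²) (𝔓.⊛-closed w (ι (+ p)) w∈O (proj₂ above))))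
      where
      x : ℤ
      x = + p * t
      z w : K
      z = half x y
      w = half (t * x - + 2 * s) (t * y)
      z∈O : O z
      z∈O = half∈O x y (+ p * s) eq
      w∈O : O w
      w∈O = half∈O (t * x - + 2 * s) (t * y) (s * s) (combine₁ (t * t) eq (lemma (+ p) t y s (+ d)))
        where
        lemma : ∀ p t y s d → (t * (p * t) - + 2 * s) * (t * (p * t) - + 2 * s) - d * (t * y * (t * y)) - + 4 * (s * s) ≡ t * t * (p * t * (p * t) - d * (y * y) - + 4 * (p * s))
        lemma = solve-∀
      z² : z ⊛ z ≡ w ⊛ ι (+ p)
      z² = trans (half-⊛ x y x y (+ p * (t * x - + 2 * s)) (+ p * (t * y)) (combine₁ -1ℤ eq (lemma₁ (+ p) t y s (+ d))) (lemma₂ (+ p) t y))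
        (sym (trans (⊛-comm w (ι (+ p))) (ι-⊛-half (+ p) _ _)))
        where
        lemma₁ : ∀ p t y s d → p * t * (p * t) + d * (y * y) - + 2 * (p * (t * (p * t) - + 2 * s)) ≡ -1ℤ * (p * t * (p * t) - d * (y * y) - + 4 * (p * s))
        lemma₁ = solve-∀
        lemma₂ : ∀ p t y → p * t * y + y * (p * t) ≡ + 2 * (p * (t * y))
        lemma₂ = solve-∀

    prime≈traceNorm : 𝔓 ≈ TraceNorm (+ p)
    prime≈traceNorm z = prime⊆traceNorm , traceNorm⊆prime

    traceNorm-prime-closed : Closed (TraceNorm (+ p))
    traceNorm-prime-closed = ≈-closed prime≈traceNorm (ideal-closed ideal)

    prime-product : ∀ {n J} → ¬ (p ℕ.∣ n) → Closed (TraceNorm (+ n)) → J ≈ TraceNorm (+ n) →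
                    (𝔓 · J) ≈ TraceNorm (+ (p ℕ.* n)) × Closed (TraceNorm (+ (p ℕ.* n)))
    prime-product {n} {J} p∤n n-closed J≈ = subst (λ k → (𝔓 · J) ≈ TraceNorm k × Closed (TraceNorm k)) (sym (pos-* p n))
      (traceNorm-product {+ p} {+ n} bézout traceNorm-prime-closed n-closed prime≈traceNorm J≈ ,
       traceNorm-closed {+ p} {+ n} bézout traceNorm-prime-closed n-closed)
      where
      bézout : Bézout (+ p) (+ n)
      bézout = prime-Bézout p-prime n p∤n

  -- x² = 4 n + d y² is a multiple of p.
  divisor-ramified : ∀ {p} → Prime p → p ℕ.∣ d → ∀ x y n → x * x - + d * (y * y) ≡ + 4 * n → + p ∣ n → + p ∣ x
  divisor-ramified {p} p-prime (ℕ.divides k d≡kp) x y n eq (divides s n≡sp) =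
    ∣ᵤ⇒∣ ([ id , id ]′ (euclidsLemma (∣ x ∣) (∣ x ∣) p-prime (subst (p ℕ.∣_) (abs-* x x) (∣⇒∣ᵤ p∣x²))))
    where
    lemma : ∀ x y n s k p d → x * x - (+ 4 * s + k * (y * y)) * p ≡ 1ℤ * (x * x - d * (y * y) - + 4 * n) + + 4 * (n - s * p) + y * y * (d - k * p)
    lemma = solve-∀
    p∣x² : + p ∣ x * x
    p∣x² = divides (+ 4 * s + + k * (y * y)) (combine₃ 1ℤ (+ 4) (y * y) eq n≡sp (trans (cong +_ d≡kp) (pos-* k p)) (lemma x y n s (+ k) (+ p) (+ d)))

  primes-product : (𝔓 : ℕ → Subset) → (∀ p → Prime p → p ℕ.∣ d → LiesAbove (𝔓 p) p) →
                   ∀ ps → All Prime ps → product ps ℕ.∣ d →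
                   prodIdeals (map 𝔓 ps) ≈ TraceNorm (+ product ps) × Closed (TraceNorm (+ product ps))
  primes-product 𝔓 above [] [] _ = traceNorm-1 , ≈-closed traceNorm-1 O-closed
  primes-product 𝔓 above (p ∷ ps) (p-prime ∷ ps-prime) pn∣d =
    prime-product p-prime (above p p-prime p∣d) (divisor-ramified p-prime p∣d) p∤n (proj₂ tail) (proj₁ tail)
    where
    p∣d : p ℕ.∣ d
    p∣d = ℕ.∣-trans (ℕ.m∣m*n (product ps)) pn∣d
    tail : prodIdeals (map 𝔓 ps) ≈ TraceNorm (+ product ps) × Closed (TraceNorm (+ product ps))
    tail = primes-product 𝔓 above ps ps-prime (ℕ.∣-trans (ℕ.n∣m*n p) pn∣d)
    -- A repeated prime would give p² ∣ d.
    p∤n : ¬ (p ℕ.∣ product ps)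
    p∤n p∣n = ¬prime[1] (subst Prime (squarefree p (ℕ.∣-trans (ℕ.*-monoʳ-∣ p p∣n) pn∣d)) p-prime)

  module _ (i j : ℤ) (0<i : 0ℤ < i) (0<j : 0ℤ < j) (ij≡d : i * j ≡ + d) where
    open Factorization i j 0<i 0<j ij≡d

    -- For trace e j t and imaginary numerator e b, dividing the norm condition by e² j leaves j t²
    -- - i b² = c s. As c is even, t and b have equal parity and are p + r and p - r. The converse
    -- is `norm-point`.
    traceNorm≈L : TraceNorm (e * j) ≈ L
    traceNorm≈L z = to , from
      where
      to : z ∈ TraceNorm (e * j) → z ∈ L
      to (t , y , s , z≡ , eq) = build (coordinates (e * j * t) y (e * j * s) eq)
        where
        build : ∃[ a ] ∃[ b ] (e * j * t ≡ + 2 * a + δ * b × y ≡ e * b) → z ∈ L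
        build (_ , b , _ , y≡eb) = split (same-parity {i} {j} {half-d} (trans ij≡d d-odd) t b (half-c * s)
            (cancelˡ (*-≢0 (*-≢0 e≢0 e≢0) (pos⇒≢0 0<j)) (trans scaled (combine₂ (e * j * s) (e * e * j * s) ec≡4⁻¹ c≡2c′ (lemma₂ e j s (+ c) half-c)))))
          where
          ec≡4⁻¹ : + 4 ≡ e * + c
          ec≡4⁻¹ = sym ec≡4
          lemma₁ : ∀ e i j t b y s d → e * e * j * (j * (t * t) - i * (b * b)) - + 4 * (e * j * s) ≡ 1ℤ * (e * j * t * (e * j * t) - d * (y * y) - + 4 * (e * j * s)) + d * (y + e * b) * (y - e * b) + - (e * e * (b * b)) * (i * j - d)
          lemma₁ = solve-∀
          scaled : e * e * j * (j * (t * t) - i * (b * b)) ≡ + 4 * (e * j * s)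
          scaled = combine₃ 1ℤ (+ d * (y + e * b)) (- (e * e * (b * b))) eq y≡eb ij≡d (lemma₁ e i j t b y s (+ d))
          lemma₂ : ∀ e j s c c′ → + 4 * (e * j * s) - e * e * j * (+ 2 * (c′ * s)) ≡ e * j * s * (+ 4 - e * c) + e * e * j * s * (c - + 2 * c′)
          lemma₂ = solve-∀
          split : ∃[ p ] ∃[ r ] (t ≡ p + r × b ≡ p - r) → z ∈ L
          split (p , r , t≡ , b≡) = p , r , trans z≡ (trans (cong₂ half (trans (*-assoc e j t) (cong (λ t → e * (j * t)) t≡)) (trans y≡eb (cong (e *_) b≡)))
            (sym (point≡half p r)))
      from : z ∈ L → z ∈ TraceNorm (e * j)
      from (p , r , z≡) = p + r , e * (p - r) , N p r , trans z≡ (trans (point≡half p r) (cong (λ x → half x (e * (p - r))) (sym (*-assoc e j (p + r))))) ,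
        trans (cong (λ x → x * x - + d * (e * (p - r) * (e * (p - r)))) (*-assoc e j (p + r))) (norm-point p r)

-- Similarity of the two ideals of a factorization.

module Similarity (d : ℕ) (squarefree : Squarefree d) (B : IntegralBasis d) where
  open import Data.Integer as ℤ using (ℤ; +_; 0ℤ)
  open import Relation.Binary.PropositionalEquality
  open IntegralBases
  import Data.Integer.Properties as ℤ
  import Data.Integer.Tactic.RingSolver as ℤSolver
  open import Data.Rational
  open import Data.Rational.Properties
  open import Data.Product using (_,_; proj₁; proj₂)
  import Tactic.RingSolver as RingSolver
  open IntegerArithmetic
  open Coordinates
  open Field d
  open Half d
  open IntegralBasis B
  open AmbiguousIdeals d squarefree B

  similar-resp-≈ : ∀ {I J I′ J′} → I ≈ I′ → J ≈ J′ → Similar I′ J′ → Similar I J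
  similar-resp-≈ I≈ J≈ (φ , c , 0<c , into , onto , additive , scaling) = φ , c , 0<c ,
    (λ x x∈I → proj₂ (J≈ (φ x)) (into x (proj₁ (I≈ x) x∈I))) ,
    (λ y y∈J → let (x , x∈I′ , eq) = onto y (proj₁ (J≈ y) y∈J) in x , proj₂ (I≈ x) x∈I′ , eq) ,
    (λ x y x∈I y∈I → additive x y (proj₁ (I≈ x) x∈I) (proj₁ (I≈ y) y∈I)) ,
    (λ x x∈I → scaling x (proj₁ (I≈ x) x∈I))

  module _ (i j : ℤ) (0<i : 0ℤ ℤ.< i) (0<j : 0ℤ ℤ.< j) (ij≡d : i ℤ.* j ≡ + d) (ji≡d : j ℤ.* i ≡ + d) where

    private
      module Lᵢⱼ = Factorization i j 0<i 0<j ij≡d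
      module Lⱼᵢ = Factorization j i 0<j 0<i ji≡d

      iℚ jℚ κ : ℚ
      iℚ = fromℤ i
      jℚ = fromℤ j

      instance
        jℚ-positive : Positive jℚ
        jℚ-positive = positive (fromℤ-pos 0<j)
        jℚ-nonZero : NonZero jℚ
        jℚ-nonZero = pos⇒nonZero jℚ
        iℚ-positive : Positive iℚ
        iℚ-positive = positive (fromℤ-pos 0<i)

      κ = 1/ jℚ

      κj≡1 : κ * jℚ ≡ 1ℚ
      κj≡1 = *-inverseˡ jℚ

      d≡ij : dℚ ≡ iℚ * jℚ
      d≡ij = trans (cong fromℤ (sym ij≡d)) (fromℤ-* i j)

      -- Multiplication by √d / j.
      φ : K → K
      φ z = _+_√d (iℚ * im z) (κ * re z)

      -- (√d / j) u = e (i + √d) / 2 is the generator for the exchanged factors, while (√d / j) ū is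
      -- minus its conjugate, whence the sign of `r`.
      φ-point : ∀ p r → φ (Lᵢⱼ.point p r) ≡ Lⱼᵢ.point p (ℤ.- r)
      φ-point p r = trans (cong φ (trans (Lᵢⱼ.point≡half p r) (half≡ _ _))) (trans (cong₂ _+_√d real imaginary)
        (sym (trans (Lⱼᵢ.point≡half p (ℤ.- r)) (half≡ _ _))))
        where
        lemma₁ : ∀ i v → i * (½ * v) ≡ ½ * (i * v)
        lemma₁ = RingSolver.solve-∀ ℚ-ring
        lemma₂ : ∀ κ j v → κ * (½ * (j * v)) ≡ κ * j * (½ * v)
        lemma₂ = RingSolver.solve-∀ ℚ-ring
        lemma₃ : ∀ e i p r → i ℤ.* (e ℤ.* (p ℤ.- r)) ≡ e ℤ.* (i ℤ.* (p ℤ.+ ℤ.- r))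
        lemma₃ = ℤSolver.solve-∀
        lemma₄ : ∀ e j p r → e ℤ.* (j ℤ.* (p ℤ.+ r)) ≡ j ℤ.* (e ℤ.* (p ℤ.- ℤ.- r))
        lemma₄ = ℤSolver.solve-∀
        real : iℚ * (½ * fromℤ (e ℤ.* (p ℤ.- r))) ≡ ½ * fromℤ (e ℤ.* (i ℤ.* (p ℤ.+ ℤ.- r)))
        real = trans (lemma₁ iℚ _) (cong (½ *_) (trans (sym (fromℤ-* i _)) (cong fromℤ (lemma₃ e i p r))))
        imaginary : κ * (½ * fromℤ (e ℤ.* (j ℤ.* (p ℤ.+ r)))) ≡ ½ * fromℤ (e ℤ.* (p ℤ.- ℤ.- r))
        imaginary = trans (cong (λ v → κ * (½ * v)) (trans (cong fromℤ (lemma₄ e j p r)) (fromℤ-* j _)))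
          (trans (lemma₂ κ jℚ _) (trans (cong (_* (½ * fromℤ (e ℤ.* (p ℤ.- ℤ.- r)))) κj≡1) (*-identityˡ _)))

      -- Both embeddings are scaled by √d / j in absolute value, so squared lengths by d / j² = i /
      -- j. The ring solver sees `κ` as a variable, so κ j = 1 is first used to remove a factor and
      -- then to insert one.
      φ-scales : ∀ z → ‖ φ z ‖² ≡ iℚ * κ * ‖ z ‖²
      φ-scales z = trans (cong (λ d → fromℤ (+ 2) * (iℚ * im z * (iℚ * im z) + d * (κ * re z * (κ * re z)))) d≡ij)
        (trans (lemma₁ (re z) (im z) iℚ jℚ κ) (trans (cong (λ t → fromℤ (+ 2) * (iℚ * iℚ * (im z * im z) + iℚ * κ * t * (re z * re z))) κj≡1)
        (trans (lemma₂ (re z) (im z) iℚ κ) (trans (cong (λ t → iℚ * κ * (fromℤ (+ 2) * (re z * re z)) + fromℤ (+ 2) * (iℚ * iℚ * t * (im z * im z))) (sym κj≡1))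
        (trans (lemma₃ (re z) (im z) iℚ jℚ κ) (cong (λ d → iℚ * κ * (fromℤ (+ 2) * (re z * re z + d * (im z * im z)))) (sym d≡ij)))))))
        where
        lemma₁ : ∀ a b i j κ → fromℤ (+ 2) * (i * b * (i * b) + i * j * (κ * a * (κ * a))) ≡ fromℤ (+ 2) * (i * i * (b * b) + i * κ * (κ * j) * (a * a))
        lemma₁ = RingSolver.solve-∀ ℚ-ring
        lemma₂ : ∀ a b i κ → fromℤ (+ 2) * (i * i * (b * b) + i * κ * 1ℚ * (a * a)) ≡ i * κ * (fromℤ (+ 2) * (a * a)) + fromℤ (+ 2) * (i * i * 1ℚ * (b * b))
        lemma₂ = RingSolver.solve-∀ ℚ-ring
        lemma₃ : ∀ a b i j κ → i * κ * (fromℤ (+ 2) * (a * a)) + fromℤ (+ 2) * (i * i * (κ * j) * (b * b)) ≡ i * κ * (fromℤ (+ 2) * (a * a + i * j * (b * b)))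
        lemma₃ = RingSolver.solve-∀ ℚ-ring

    similar : Similar Lᵢⱼ.L Lⱼᵢ.L
    similar = φ , iℚ * κ , positive⁻¹ (iℚ * κ) {{pos*pos⇒pos iℚ κ {{1/pos⇒pos jℚ}}}} ,
      (λ { _ (p , r , refl) → p , ℤ.- r , φ-point p r }) ,
      (λ { _ (p , r , refl) → Lᵢⱼ.point p (ℤ.- r) , (p , ℤ.- r , refl) , trans (φ-point p (ℤ.- r)) (cong (Lⱼᵢ.point p) (ℤ.neg-involutive r)) }) ,
      (λ z w _ _ → cong₂ _+_√d (*-distribˡ-+ iℚ (im z) (im w)) (*-distribˡ-+ κ (re z) (re w))) ,
      (λ z _ → φ-scales z)

-- Primitive ideals, and the two residues of d brought together.

module Assembly where
  open import Data.Nat as ℕ using (ℕ; suc)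
  import Data.Nat.Properties as ℕ
  open import Data.Nat.Divisibility as ℕ using ()
  open import Data.Nat.Primality using (Prime; prime[2])
  open import Data.Nat.ListAction using (product)
  open import Data.Bool using (if_then_else_)
  open import Data.Integer using (ℤ; +_; +[1+_]; 0ℤ; 1ℤ; _+_; _-_; _*_; _<_; +<+)
  open import Data.Integer.Properties using (+-injective; *-identityˡ; *-comm; +-identityʳ; pos-*)
  open import Data.Integer.Divisibility.Signed using (_∣_; divides)
  open import Data.List using (List; []; _∷_; map; _++_)
  open import Data.Product using (∃-syntax; _×_; _,_; proj₁; proj₂)
  open import Data.Sum using (_⊎_; inj₁; inj₂)
  open import Relation.Binary.PropositionalEquality
  open import Relation.Nullary using (¬_; contradiction)
  open Coordinates using (module Half)
  open IntegralBases

  module PrincipalWellRounded (d : ℕ) (1<d : 1 ℕ.< d) (squarefree : Squarefree d) (B : IntegralBasis d) where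

    open Field d
    open Ideals d
    open IntegralBasis B
    open AmbiguousIdeals d squarefree B
    open WellRoundedIdeals d 1<d squarefree B
    open IdealProducts d squarefree B
    open Similarity d squarefree B
    open Half d using (⊛-comm; ⊛-identityʳ)

    -- Quantifying over both orders of the factors lets one statement serve I₁, with j = d₁, and I₂,
    -- with j = d₂.
    IdealOf≈L : (ℕ → Subset) → Set
    IdealOf≈L 𝔓 = ∀ i j 0<i 0<j ij≡d ps → PrimeFactorization ps j → idealOf 𝔓 ps ≈ Factorization.L (+ i) (+ j) 0<i 0<j ij≡d

    PWR⇒goodFactorization : ∃[ I ] IsPWR I → ∃[ d₁ ] ∃[ d₂ ] GoodFactorization d d₁ d₂
    PWR⇒goodFactorization (I , I-pwr) = forget (goodFactorization i j 0<i 0<j ij≡d i≤3j j≤3i unit)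
      where
      open Classification (classify I-pwr)
      forget : ∃[ d₁ ] ∃[ d₂ ] (GoodFactorization d d₁ d₂ × Orders i j 0<i 0<j ij≡d d₁ d₂) → ∃[ d₁ ] ∃[ d₂ ] GoodFactorization d d₁ d₂
      forget (d₁ , d₂ , good , _) = d₁ , d₂ , good

    goodFactorization⇒∃PWR : ∃[ d₁ ] ∃[ d₂ ] GoodFactorization d d₁ d₂ → ∃[ I ] IsPWR I
    goodFactorization⇒∃PWR (d₁ , d₂ , d₁d₂≡d , 0<d₁ , d₁<d₂ , d₂≤3d₁ , solvable) =
      goodFactorization⇒PWR d₁d₂≡d 0<d₁ d₁<d₂ d₂≤3d₁ solvable

    ≈-sym : ∀ {I J} → I ≈ J → J ≈ I
    ≈-sym I≈J x = proj₂ (I≈J x) , proj₁ (I≈J x)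

    ≈-trans : ∀ {I J H} → I ≈ J → J ≈ H → I ≈ H
    ≈-trans I≈J J≈H x = (λ x∈ → proj₁ (J≈H x) (proj₁ (I≈J x) x∈)) , (λ x∈ → proj₂ (I≈J x) (proj₂ (J≈H x) x∈))

    scale-1 : ∀ {I} → scale 1ℤ I ≈ I
    scale-1 {I} z = (λ { (y , y∈I , refl) → subst I (sym (1⊛ y)) y∈I }) , (λ z∈I → z , z∈I , sym (1⊛ z))
      where
      1⊛ : ∀ y → ι 1ℤ ⊛ y ≡ y
      1⊛ y = trans (⊛-comm (ι 1ℤ) y) (⊛-identityʳ y)

    primitive⇒≈ : ∀ {I J} m → 0ℤ < m → IsIdeal J → I ≈ scale m J → IsPrimitive I → I ≈ J
    primitive⇒≈ (+ 0) (+<+ ()) _ _ _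
    primitive⇒≈ +[1+ 0 ] _ _ I≈ _ = ≈-trans I≈ scale-1
    primitive⇒≈ {J = J} +[1+ suc k ] _ J-ideal I≈ I-primitive = contradiction (suc (suc k) , J , ℕ.s≤s (ℕ.s≤s ℕ.z≤n) , J-ideal , I≈) I-primitive

    module _ {𝔓 : ℕ → Subset} (idealOf≈L : IdealOf≈L 𝔓) where

      -- The lattice belongs to its second factor `j`, so the list of primes that factors `j` names
      -- the ideal.
      one-of-two : ∀ {I} i j 0<i 0<j ij≡d → I ≈ Factorization.L i j 0<i 0<j ij≡d → ∀ d₁ d₂ → Orders i j 0<i 0<j ij≡d d₁ d₂ →
                   ∀ ps qs → PrimeFactorization ps d₁ → PrimeFactorization qs d₂ → (I ≈ idealOf 𝔓 ps) ⊎ (I ≈ idealOf 𝔓 qs)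
      one-of-two _ _ 0<i 0<j ij≡d I≈L d₁ d₂ (inj₁ (refl , refl)) ps qs _ qs-fact =
        inj₂ (≈-trans I≈L (≈-sym (idealOf≈L d₁ d₂ 0<i 0<j ij≡d qs qs-fact)))
      one-of-two _ _ 0<i 0<j ij≡d I≈L d₁ d₂ (inj₂ (refl , refl)) ps qs ps-fact _ =
        inj₁ (≈-trans I≈L (≈-sym (idealOf≈L d₂ d₁ 0<i 0<j ij≡d ps ps-fact)))

      primitive-PWR : (I : Subset) → IsPWR I → IsPrimitive I →
        ∃[ d₁ ] ∃[ d₂ ] (GoodFactorization d d₁ d₂
          × ((ps qs : List ℕ) → PrimeFactorization ps d₁ → PrimeFactorization qs d₂ →
               (I ≈ idealOf 𝔓 ps) ⊎ (I ≈ idealOf 𝔓 qs)))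
      primitive-PWR I I-pwr I-primitive = conclude (goodFactorization i j 0<i 0<j ij≡d i≤3j j≤3i unit)
        where
        open Classification (classify I-pwr)
        conclude : ∃[ d₁ ] ∃[ d₂ ] (GoodFactorization d d₁ d₂ × Orders i j 0<i 0<j ij≡d d₁ d₂) →
          ∃[ d₁ ] ∃[ d₂ ] (GoodFactorization d d₁ d₂
          × ((ps qs : List ℕ) → PrimeFactorization ps d₁ → PrimeFactorization qs d₂ →
               (I ≈ idealOf 𝔓 ps) ⊎ (I ≈ idealOf 𝔓 qs)))
        conclude (d₁ , d₂ , good , orders) = d₁ , d₂ , good , one-of-two i j 0<i 0<j ij≡d
          (primitive⇒≈ m 0<m (Factorization.L-isIdeal i j 0<i 0<j ij≡d) multiple I-primitive) d₁ d₂ orders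

      similar-ideals : (d₁ d₂ : ℕ) → GoodFactorization d d₁ d₂ →
        (ps qs : List ℕ) → PrimeFactorization ps d₁ → PrimeFactorization qs d₂ →
        Similar (idealOf 𝔓 ps) (idealOf 𝔓 qs)
      similar-ideals d₁ d₂ (d₁d₂≡d , 0<d₁ , d₁<d₂ , _) ps qs ps-fact qs-fact = similar-resp-≈
        (idealOf≈L d₂ d₁ (+<+ 0<d₂) (+<+ 0<d₁) d₂d₁≡d ps ps-fact)
        (idealOf≈L d₁ d₂ (+<+ 0<d₁) (+<+ 0<d₂) (trans (*-comm (+ d₁) (+ d₂)) d₂d₁≡d) qs qs-fact)
        (similar (+ d₂) (+ d₁) (+<+ 0<d₂) (+<+ 0<d₁) d₂d₁≡d (trans (*-comm (+ d₁) (+ d₂)) d₂d₁≡d))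
        where
        0<d₂ : 0 ℕ.< d₂
        0<d₂ = ℕ.<-trans 0<d₁ d₁<d₂
        d₂d₁≡d : + d₂ * + d₁ ≡ + d
        d₂d₁≡d = factor-product {d₁} {d₂} d₁d₂≡d

  open PrincipalWellRounded using (IdealOf≈L; ≈-trans)

  module _ {d : ℕ} (squarefree : Squarefree d) (𝔓 : ℕ → Field.Subset d)
    (above : ∀ p → Prime p → p ℕ.∣ d → Field.LiesAbove d (𝔓 p) p) where

    open Field d
    open Ideals d

    private
      twoPart≡ : ∀ {r} → d ℕ.% 4 ≡ r → twoPart 𝔓 ≡ (if r ℕ.≡ᵇ 3 then 𝔓 2 ∷ [] else [])
      twoPart≡ eq = cong (λ r → if r ℕ.≡ᵇ 3 then 𝔓 2 ∷ [] else []) eq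

      product∣d : ∀ {i j n} → + i * + j ≡ + d → n ≡ j → n ℕ.∣ d
      product∣d {i} {j} ij≡d refl = ℕ.divides i (sym (+-injective (trans (pos-* i j) ij≡d)))

      idealOf≡ : ∀ {r} → d ℕ.% 4 ≡ r → ∀ ps → idealOf 𝔓 ps ≡ prodIdeals ((if r ℕ.≡ᵇ 3 then 𝔓 2 ∷ [] else []) ++ map 𝔓 ps)
      idealOf≡ eq ps = cong (λ Is → prodIdeals (Is ++ map 𝔓 ps)) (twoPart≡ eq)

    idealOf≈L-1mod4 : ∀ 1<d (d%4≡1 : d ℕ.% 4 ≡ 1) → IdealOf≈L d 1<d squarefree (basis-1mod4 d d%4≡1) 𝔓
    idealOf≈L-1mod4 1<d d%4≡1 i j 0<i 0<j ij≡d ps (ps-prime , product≡j) =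
      subst (_≈ L) (sym (idealOf≡ d%4≡1 ps)) (≈-trans d 1<d squarefree B
        (subst (λ k → prodIdeals (map 𝔓 ps) ≈ TraceNorm k) (trans (cong +_ product≡j) (sym (*-identityˡ (+ j))))
          (proj₁ (primes-product 𝔓 above ps ps-prime (product∣d {i} {j} ij≡d product≡j))))
        (traceNorm≈L (+ i) (+ j) 0<i 0<j ij≡d))
      where
      B = basis-1mod4 d d%4≡1
      open IdealProducts d squarefree B
      open AmbiguousIdeals.Factorization d squarefree B (+ i) (+ j) 0<i 0<j ij≡d using (L)

    idealOf≈L-3mod4 : ∀ 1<d (d%4≡3 : d ℕ.% 4 ≡ 3) → ¬ (2 ℕ.∣ d) → LiesAbove (𝔓 2) 2 → IdealOf≈L d 1<d squarefree (basis-3mod4 d d%4≡3) 𝔓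
    idealOf≈L-3mod4 1<d d%4≡3 2∤d above₂ i j 0<i 0<j ij≡d ps (ps-prime , product≡j) =
      subst (_≈ L) (sym (idealOf≡ d%4≡3 ps)) (≈-trans d 1<d squarefree B
        (subst (λ k → (𝔓 2 · prodIdeals (map 𝔓 ps)) ≈ TraceNorm k) (trans (pos-* 2 (product ps)) (cong (λ n → + 2 * + n) product≡j))
          (proj₁ (prime-product prime[2] above₂ two-ramified (λ 2∣n → 2∤d (ℕ.∣-trans 2∣n n∣d)) (proj₂ odd-part) (proj₁ odd-part))))
        (traceNorm≈L (+ i) (+ j) 0<i 0<j ij≡d))
      where
      B = basis-3mod4 d d%4≡3
      open IdealProducts d squarefree B
      open AmbiguousIdeals.Factorization d squarefree B (+ i) (+ j) 0<i 0<j ij≡d using (L)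
      n∣d : product ps ℕ.∣ d
      n∣d = product∣d {i} {j} ij≡d product≡j
      odd-part : prodIdeals (map 𝔓 ps) ≈ TraceNorm (+ product ps) × Closed (TraceNorm (+ product ps))
      odd-part = primes-product 𝔓 above ps ps-prime n∣d
      -- For d ≡ 3 (mod 4) every algebraic integer has even trace, so 2 behaves like a ramified
      -- prime outright.
      two-ramified : ∀ x y n → x * x - + d * (y * y) ≡ + 4 * n → + 2 ∣ n → + 2 ∣ x
      two-ramified x y n eq _ = even (IntegralBasis.coordinates B x y n eq)
        where
        even : ∃[ a ] ∃[ b ] (x ≡ + 2 * a + 0ℤ * b × y ≡ + 2 * b) → + 2 ∣ x
        even (a , b , x≡ , _) = divides a (trans x≡ (trans (+-identityʳ (+ 2 * a)) (*-comm (+ 2) a)))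

  -- The split on d modulo 4 is made here. Pairing the integral basis with the description of the
  -- prime products keeps the final argument uniform in both cases.
  basis-with-ideals : ∀ d (1<d : 1 ℕ.< d) (squarefree : Squarefree d) → ¬ (2 ℕ.∣ d) → let open Field d in
    ∃[ B ] (∀ 𝔓 → (∀ p → Prime p → p ℕ.∣ d → LiesAbove (𝔓 p) p) → (d ℕ.% 4 ≡ 3 → LiesAbove (𝔓 2) 2) → IdealOf≈L d 1<d squarefree B 𝔓)
  basis-with-ideals d 1<d squarefree 2∤d = choose (odd-mod-4 d 2∤d)
    where
    open Field d
    choose : d ℕ.% 4 ≡ 1 ⊎ d ℕ.% 4 ≡ 3 →
      ∃[ B ] (∀ 𝔓 → (∀ p → Prime p → p ℕ.∣ d → LiesAbove (𝔓 p) p) → (d ℕ.% 4 ≡ 3 → LiesAbove (𝔓 2) 2) → IdealOf≈L d 1<d squarefree B 𝔓)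
    choose (inj₁ eq) = basis-1mod4 d eq , λ 𝔓 above _ → idealOf≈L-1mod4 squarefree 𝔓 above 1<d eq
    choose (inj₂ eq) = basis-3mod4 d eq , λ 𝔓 above above₂ → idealOf≈L-3mod4 squarefree 𝔓 above 1<d eq 2∤d (above₂ eq)

open import Data.Nat using (ℕ; _<_; _%_)
open import Data.Nat.Divisibility using (_∣_)
open import Data.Nat.Primality using (Prime)
open import Data.Product using (Σ; ∃; ∃-syntax; _×_)
open import Data.Sum using (_⊎_)
open import Data.List using (List)
open import Relation.Binary.PropositionalEquality using (_≡_)
open import Relation.Nullary using (¬_)
open import Data.Product using (_,_; proj₁; proj₂)

theorem3p1 : (d : ℕ) → 1 < d → ¬ (2 ∣ d) → Squarefree d →
  let open Field d
      open Ideals d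
  in ((∃[ I ] IsPWR I) → ∃[ d₁ ] ∃[ d₂ ] GoodFactorization d d₁ d₂)
   × ((∃[ d₁ ] ∃[ d₂ ] GoodFactorization d d₁ d₂) → ∃[ I ] IsPWR I)
   × ((𝔓 : ℕ → Subset)
      → (∀ p → Prime p → p ∣ d → LiesAbove (𝔓 p) p)
      → (d % 4 ≡ 3 → LiesAbove (𝔓 2) 2)
      → ((I : Subset) → IsPWR I → IsPrimitive I →
           ∃[ d₁ ] ∃[ d₂ ] (GoodFactorization d d₁ d₂
             × ((ps qs : List ℕ) → PrimeFactorization ps d₁ → PrimeFactorization qs d₂ →
                  (I ≈ idealOf 𝔓 ps) ⊎ (I ≈ idealOf 𝔓 qs))))
      × ((d₁ d₂ : ℕ) → GoodFactorization d d₁ d₂ →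
           (ps qs : List ℕ) → PrimeFactorization ps d₁ → PrimeFactorization qs d₂ →
           Similar (idealOf 𝔓 ps) (idealOf 𝔓 qs)))
theorem3p1 d 1<d 2∤d squarefree =
    PWR⇒goodFactorization , goodFactorization⇒∃PWR , λ 𝔓 above above₂ →
      primitive-PWR (proj₂ basis 𝔓 above above₂) , similar-ideals (proj₂ basis 𝔓 above above₂)
  where
  basis = Assembly.basis-with-ideals d 1<d squarefree 2∤d
  open Assembly.PrincipalWellRounded d 1<d squarefree (proj₁ basis)
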